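{- There is a sequence of unweighted trees $B_h$ ($h\ge1$, all edge weights equal to $1$) of maximum degree at most $3$ (exactly $3$ for $h\ge2$), with $n_h=2^{h+1}-1$ vertices, such that $$\frac{\operatorname{OPT}_{\mathrm{card}}(B_h)}{\operatorname{OPT}_{\mathrm{free}}(B_h)}=\Theta(\log n_h),$$ i.e. there are constants $0<c\le C$ such that the ratio lies in $[c\log n_h,\,C\log n_h]$ for all $h\ge1$. Moreover, for every $h$ and every vertex set $S$ with $|S|\ge2$ inducing a connected subgraph of $B_h$, one has $\operatorname{frag}_{1/3}(S)\le1$.
   Context: For a finite connected graph $G=(V,E,w)$ with positive weights, $d_G$ is the shortest-path metric of $(V,E)$ with every edge of length $1$. $\operatorname{OPT}_{\mathrm{free}}(G)$ is the minimum of $\sum_{xy\in E}w_{xy}u(x,y)$ over all ultrametrics $u$ on $V$ (metrics with $u(x,y)\le\max\{u(x,z),u(z,y)\}$) with $u\ge d_G$ on all pairs. A rooted binary hierarchy $H$ on $V$ is a rooted tree whose leaves are the vertices of $V$ and whose internal nodes have exactly two children; $C_H(x,y)$ is the set of leaves below the lowest common ancestor of $x,y$; $h_H(x,x)=0$ and $h_H(x,y)=|C_H(x,y)|-1$ for $x\ne y$. $\operatorname{OPT}_{\mathrm{card}}(G)$ is the minimum of $\sum_{xy\in E}w_{xy}h_H(x,y)$ over all rooted binary hierarchies $H$ on $V$ with $h_H\ge d_G$ on all pairs. For $S\subseteq V$ with $G[S]$ connected and $|S|\ge2$, and $\alpha\in(0,1/2]$, $\operatorname{frag}_\alpha(S)$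 is the minimum of $(|S|-1)\,w(A,B)/W(S)$ over all bipartitions $S=A\mathbin{\dot\cup}B$ with $G[A],G[B]$ connected (nonempty) and $\max\{|A|-1,|B|-1\}\le(1-\alpha)(|S|-1)$ ($+\infty$ if none exists), where $W(S)$ is the total weight of edges of $G[S]$ and $w(A,B)$ the total weight of edges between $A$ and $B$. -}

module Defs where

open import Level using (Level; Lift; _⊔_; 0ℓ) renaming (suc to lsuc)
open import Algebra.Bundles using (CommutativeRing)
import Algebra.Construct.NaturalChoice.Max as Max
import Algebra.Definitions.RawMonoid as RawMonoidDefs
import Algebra.Properties.CommutativeMonoid.Sum as Sum
open import Data.Bool.Base using (Bool; if_then_else_; _∧_)
open import Data.Fin.Base using (Fin; zero; suc; inject₁; fromℕ)
open import Data.Fin.Properties using (_≟_; _<?_)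
open import Data.Fin.Subset using (Subset; _∈_; _∪_; _∩_; ⊥; ∣_∣; Nonempty)
open import Data.Fin.Subset.Properties using (_∈?_)
open import Data.List.Base using (map; allFin)
open import Data.List.Extrema.Nat using (max)
import Data.List.Membership.DecPropositional as ListMembership
open import Data.List.Relation.Binary.Permutation.Propositional using (_↭_)
open import Data.Nat.Base as ℕ using (ℕ)
open import Data.Product.Base using (∃; _×_; _,_)
open import Data.Tree.Binary using (Tree; leaf; node; #leaves; module Leaves)
open import Data.Unit.Base using (⊤)
open import Data.Vec.Base using (tabulate)
open import Function.Base using (_∘_)
open import Function.Definitions using (Injective)
import Function.Metric.Structures as Metric
open import Relation.Binary.Bundles using (DecTotalOrder)
open import Relation.Binary.Construct.Closure.ReflexiveTransitive using (Star; fold)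
import Relation.Binary.Construct.NonStrictToStrict as NonStrictToStrict
open import Relation.Binary.Core using (Rel)
open import Relation.Binary.Definitions using (Decidable; Symmetric; Irreflexive)
open import Relation.Binary.PropositionalEquality.Core using (_≡_)
open import Relation.Binary.Structures using (IsDecTotalOrder)
open import Relation.Nullary.Construct.Add.Supremum using (_⁺; ⊤⁺; [_])
open import Relation.Nullary.Decidable.Core using (does; _×-dec_)
open import Relation.Nullary.Negation.Core using (¬_)

IsMinimum : ∀ {a b p ℓ₁ ℓ₂} {A : Set a} {B : Set b} →
            Rel B ℓ₁ → Rel B ℓ₂ → (A → Set p) → (A → B) → B → Set (a ⊔ p ⊔ ℓ₁ ⊔ ℓ₂)
IsMinimum _≈_ _≤_ P f m = (∃ λ a → P a × f a ≈ m) × (∀ a → P a → m ≤ f a)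

------------------------------------------------------------------------
-- Finite simple graphs

record Graph (n : ℕ) : Set₁ where
  infix 4 _~_ _~?_
  field
    _~_      : Rel (Fin n) 0ℓ
    _~?_     : Decidable _~_
    ~-sym    : Symmetric _~_
    ~-irrefl : Irreflexive _≡_ _~_

module _ {n : ℕ} (G : Graph n) where
  open Graph G

  InducedAdjacency : Subset n → Rel (Fin n) 0ℓ
  InducedAdjacency S x y = x ∈ S × y ∈ S × x ~ y

  Connected : Set
  Connected = ∀ x y → Star _~_ x y

  ConnectedOn : Subset n → Set
  ConnectedOn S = ∀ x y → x ∈ S → y ∈ S → Star (InducedAdjacency S) x y

  walkLength : ∀ {x y} → Star _~_ x y → ℕ
  walkLength = fold (λ _ _ → ℕ) (λ _ → ℕ.suc) 0

  IsDistance : Fin n → Fin n → ℕ → Set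
  IsDistance x y = IsMinimum {A = Star _~_ x y} _≡_ ℕ._≤_ (λ _ → ⊤) walkLength

  record Cycle : Set where
    field
      k         : ℕ
      vertex    : Fin (3 ℕ.+ k) → Fin n
      injective : Injective _≡_ _≡_ vertex
      step      : ∀ (i : Fin (2 ℕ.+ k)) → vertex (inject₁ i) ~ vertex (suc i)
      closing   : vertex (fromℕ (2 ℕ.+ k)) ~ vertex zero

  IsTree : Set
  IsTree = Connected × ¬ Cycle

  degree : Fin n → ℕ
  degree x = ∣ tabulate (λ y → does (x ~? y)) ∣

  maxDegree : ℕ
  maxDegree = max 0 (map degree (allFin n))

------------------------------------------------------------------------
-- Rooted binary hierarchies

-- The two children of a node are ordered here; none of the notions below
-- depends on the order.
record Hierarchy (n : ℕ) : Set where
  field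
    tree    : Tree ⊤ (Fin n)
    leaves↭ : Leaves.toList tree ↭ allFin n

module _ {n : ℕ} where
  open ListMembership (_≟_ {n}) using () renaming (_∈?_ to _∈ᴸ?_)

  bothIn : Fin n → Fin n → Tree ⊤ (Fin n) → Bool
  bothIn x y t = does (x ∈ᴸ? Leaves.toList t) ∧ does (y ∈ᴸ? Leaves.toList t)

  -- The subtree rooted at the lowest common ancestor of x and y, assuming
  -- that both occur as leaves of the given tree.
  lcaSubtree : Fin n → Fin n → Tree ⊤ (Fin n) → Tree ⊤ (Fin n)
  lcaSubtree x y (leaf v)     = leaf v
  lcaSubtree x y (node l _ r) =
    if bothIn x y l then lcaSubtree x y l else
    if bothIn x y r then lcaSubtree x y r else
    node l _ r

  height : Hierarchy n → Fin n → Fin n → ℕ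
  height H x y =
    if does (x ≟ y) then 0 else #leaves (lcaSubtree x y (Hierarchy.tree H)) ℕ.∸ 1

------------------------------------------------------------------------
-- Ordered fields

-- The library has no real numbers.  Classically ℝ is an instance of this
-- structure, and for ℝ the notions below are the usual ones.
record OrderedField (a ℓ₁ ℓ₂ : Level) : Set (lsuc (a ⊔ ℓ₁ ⊔ ℓ₂)) where
  infix  4 _≤_
  infix  8 _⁻¹
  field
    commutativeRing : CommutativeRing a ℓ₁

  open CommutativeRing commutativeRing public
    using (Carrier; _≈_; _+_; _*_; -_; _-_; 0#; 1#)

  field
    _≤_             : Rel Carrier ℓ₂
    isDecTotalOrder : IsDecTotalOrder _≈_ _≤_
    +-monoʳ-≤       : ∀ x {y z} → y ≤ z → x + y ≤ x + z
    *-nonNegative   : ∀ {x y} → 0# ≤ x → 0# ≤ y → 0# ≤ x * y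
    0≉1             : ¬ (0# ≈ 1#)
    -- The value of 0# ⁻¹ is unconstrained.
    _⁻¹             : Carrier → Carrier
    ⁻¹-cong         : ∀ {x y} → x ≈ y → x ⁻¹ ≈ y ⁻¹
    ⁻¹-inverseʳ     : ∀ {x} → ¬ (x ≈ 0#) → x * x ⁻¹ ≈ 1#

  decTotalOrder : DecTotalOrder a ℓ₁ ℓ₂
  decTotalOrder = record { isDecTotalOrder = isDecTotalOrder }

  open NonStrictToStrict _≈_ _≤_ public using (_<_)
  open Max (DecTotalOrder.totalOrder decTotalOrder) public using ()
    renaming (_⊔_ to _⊔ᴷ_)
  open Sum (CommutativeRing.+-commutativeMonoid commutativeRing) public using (sum)

  infixl 7 _/_
  _/_ : Carrier → Carrier → Carrier
  x / y = x * y ⁻¹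

  fromNat : ℕ → Carrier
  fromNat m = m ·ℕ 1#
    where open RawMonoidDefs (CommutativeRing.+-rawMonoid commutativeRing)
            renaming (_×_ to _·ℕ_)

  -- Comparison with multiples of log₂ m, for c ≥ 0 and m ≥ 1.  The real
  -- number log₂ m is the supremum of the p / q with 2 ^ p ≤ m ^ q, and the
  -- infimum of the p / q with m ^ q ≤ 2 ^ p, where p, q ∈ ℕ and q > 0.
  infix 4 _·log₂_≼_ _≼_·log₂_

  _·log₂_≼_ : Carrier → ℕ → Carrier → Set ℓ₂
  c ·log₂ m ≼ x = ∀ p q → 0 ℕ.< q → 2 ℕ.^ p ℕ.≤ m ℕ.^ q → c * (fromNat p / fromNat q) ≤ x

  _≼_·log₂_ : Carrier → Carrier → ℕ → Set ℓ₂
  x ≼ c ·log₂ m = ∀ p q → 0 ℕ.< q → m ℕ.^ q ℕ.≤ 2 ℕ.^ p → x ≤ c * (fromNat p / fromNat q)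

------------------------------------------------------------------------
-- Weighted graphs and their optimal values

module Weighted {a ℓ₁ ℓ₂ : Level} (K : OrderedField a ℓ₁ ℓ₂) where
  open OrderedField K

  record WeightedGraph (n : ℕ) : Set (lsuc 0ℓ ⊔ a ⊔ ℓ₁ ⊔ ℓ₂) where
    field
      graph      : Graph n
    open Graph graph public
    field
      weight     : Fin n → Fin n → Carrier
      weight-sym : ∀ x y → weight x y ≈ weight y x
      weight-pos : ∀ {x y} → x ~ y → 0# < weight x y

  -- The sum of f x y over the pairs (x , y) satisfying P.
  ∑[_]_ : ∀ {n p} {P : Rel (Fin n) p} → Decidable P → (Fin n → Fin n → Carrier) → Carrier
  ∑[ P? ] f = sum λ x → sum λ y → if does (P? x y) then f x y else 0#

  module _ {n : ℕ} (G : WeightedGraph n) where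
    open WeightedGraph G

    Unweighted : Set ℓ₁
    Unweighted = ∀ x y → x ~ y → weight x y ≈ 1#

    -- Each edge is counted once, with its endpoints in increasing order.
    cost : (Fin n → Fin n → Carrier) → Carrier
    cost u = ∑[ (λ x y → (x <? y) ×-dec (x ~? y)) ] λ x y → weight x y * u x y

    DominatesDistance : (Fin n → Fin n → Carrier) → Set ℓ₂
    DominatesDistance u = ∀ x y d → IsDistance graph x y d → fromNat d ≤ u x y

    IsUltrametric : (Fin n → Fin n → Carrier) → Set (ℓ₁ ⊔ ℓ₂ ⊔ a)
    IsUltrametric = Metric.IsGeneralMetric {A = Fin n} _≡_ _≈_ _≤_ 0# _⊔ᴷ_

    IsOPTfree : Carrier → Set (a ⊔ ℓ₁ ⊔ ℓ₂)
    IsOPTfree = IsMinimum _≈_ _≤_ (λ u → IsUltrametric u × DominatesDistance u) cost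

    hierarchyHeight : Hierarchy n → Fin n → Fin n → Carrier
    hierarchyHeight H x y = fromNat (height H x y)

    IsOPTcard : Carrier → Set (ℓ₁ ⊔ ℓ₂)
    IsOPTcard = IsMinimum _≈_ _≤_ (DominatesDistance ∘ hierarchyHeight) (cost ∘ hierarchyHeight)

    cutWeight : Subset n → Subset n → Carrier
    cutWeight A B = ∑[ (λ x y → (x ∈? A) ×-dec (y ∈? B) ×-dec (x ~? y)) ] weight

    inducedWeight : Subset n → Carrier
    inducedWeight S =
      ∑[ (λ x y → (x <? y) ×-dec (x ∈? S) ×-dec (y ∈? S) ×-dec (x ~? y)) ] weight

    record IsBalancedBipartition (α : Carrier) (S A B : Subset n) : Set ℓ₂ where
      field
        covers     : A ∪ B ≡ S
        disjoint   : A ∩ B ≡ ⊥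
        A-nonempty : Nonempty A
        B-nonempty : Nonempty B
        A-conn     : ConnectedOn graph A
        B-conn     : ConnectedOn graph B
        balanced   : fromNat ((∣ A ∣ ℕ.∸ 1) ℕ.⊔ (∣ B ∣ ℕ.∸ 1)) ≤ (1# - α) * fromNat (∣ S ∣ ℕ.∸ 1)

    fragCost : Subset n → Subset n × Subset n → Carrier
    fragCost S (A , B) = fromNat (∣ S ∣ ℕ.∸ 1) * cutWeight A B / inducedWeight S

    -- The value ⊤⁺ plays the role of +∞.
    IsFrag : Carrier → Subset n → Carrier ⁺ → Set (ℓ₁ ⊔ ℓ₂)
    IsFrag α S [ v ] =
      IsMinimum _≈_ _≤_ (λ (A , B) → IsBalancedBipartition α S A B) (fragCost S) v
    IsFrag α S ⊤⁺ = Lift (ℓ₁ ⊔ ℓ₂) (∀ A B → ¬ IsBalancedBipartition α S A B)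

{-# OPTIONS --safe #-}

-- Let B_h be the complete binary tree of height h, with n = 2 ^ (h + 1) − 1 vertices.
--
-- Twice the height of the lowest common ancestor is an ultrametric dominating the distance, and its cost is
-- less than 8 · 2 ^ h.  Every edge costs at least 1, so the free optimum lies between n − 1 and 8 · 2 ^ h.
--
-- Recursively splitting off the left subtree and then the root gives a hierarchy of cost at most 3 · h · 2 ^ h.
-- Conversely, in any hierarchy charge to each vertex below a node the cost, within that node, of the edge to its
-- parent in B_h.  When clusters with a and b vertices are merged, each contains a vertex whose parent lies
-- outside it, and the charges of these two vertices grow by b and a.  Hence the total charge is at least the
-- external path length of the hierarchy, which is at least n log₂ n.
--
-- A connected bipartition of a connected set S cuts exactly one of its |S| − 1 edges, so its fragmentation cost
-- is 1, and a balanced one exists because every vertex has at most two children.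
module Submission where

open import Defs
open import Data.Fin.Subset using (Subset; ∣_∣)
open import Data.Nat.Base as ℕ using (ℕ)
open import Data.Product.Base using (Σ; ∃; ∃₂; _×_; _,_; proj₁; proj₂)
open import Relation.Binary.Construct.Add.Supremum.NonStrict using (_≤⁺_)
open import Relation.Binary.PropositionalEquality.Core using (_≡_)
open import Relation.Nullary.Construct.Add.Supremum using (_⁺; [_])

module Separation where

  open import Algebra.Bundles using (CommutativeRing)
  import Algebra.Construct.NaturalChoice.Max as Max
  import Algebra.Properties.CommutativeSemigroup as CommutativeSemigroupProperties
  import Algebra.Properties.Ring as RingProperties
  import Algebra.Properties.Semiring.Mult as SemiringMult
  import Algebra.Properties.Semiring.Sum as SemiringSum
  open import Data.Bool.Base using (Bool; true; false; if_then_else_; _∧_; _∨_)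
  open import Data.Empty using (⊥; ⊥-elim)
  open import Data.Fin.Base as Fin using (Fin; zero; suc; toℕ; fromℕ; inject₁; _↑ˡ_; _↑ʳ_)
  import Data.Fin.Properties as Fin
  open import Data.Fin.Subset as Subset using (_∈_; _∉_; _∩_; _∪_; ∁; Nonempty)
  open import Data.Fin.Subset.Properties as Subset using (_∈?_)
  open import Data.List.Base as List using (List; []; _∷_; _++_; allFin)
  import Data.List.Extrema.Nat as Extrema
  import Data.List.Membership.DecPropositional as DecMembership
  open import Data.List.Membership.Propositional using (lose) renaming (_∈_ to _∈ᴸ_; _∉_ to _∉ᴸ_)
  import Data.List.Membership.Propositional.Properties as List
  import Data.List.Properties as List
  open import Data.List.Relation.Binary.Permutation.Propositional as Perm using (_↭_; ↭-sym; ↭⇒↭ₛ)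
  import Data.List.Relation.Binary.Permutation.Propositional.Properties as Perm
  import Data.List.Relation.Binary.Permutation.Setoid.Properties as PermSetoid
  import Data.List.Relation.Unary.All as All
  import Data.List.Relation.Unary.All.Properties as All
  open import Data.List.Relation.Unary.AllPairs using ([]; _∷_)
  open import Data.List.Relation.Unary.Any as Any using (here; there)
  import Data.List.Relation.Unary.Any.Properties as Any
  open import Data.List.Relation.Unary.Unique.Propositional using (Unique)
  import Data.List.Relation.Unary.Unique.Propositional.Properties as Unique
  open import Data.Nat.Base using (z≤n; s≤s; _≤_; _<_; _+_; _*_; _∸_; _^_; _⊔_)
  import Data.Nat.ListAction as ListAction
  import Data.Nat.ListAction.Properties as ListAction
  import Data.Nat.Properties as ℕ
  import Data.Nat.Solver
  open import Data.Sum.Base as Sum using (_⊎_; inj₁; inj₂)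
  open import Data.Tree.Binary as Tree using (Tree; leaf; node; #leaves; module Leaves)
  import Data.Tree.Binary.Properties as Tree
  open import Data.Unit.Base using (⊤; tt)
  open import Data.Vec.Base using ([]; _∷_; tabulate)
  import Data.Vec.Properties as Vec
  open import Function.Base using (_∘_; id; case_of_)
  open import Function.Bundles using (mk⇔)
  import Function.Metric.Structures as Metric
  open import Level using (0ℓ)
  open import Relation.Binary.Bundles using (DecTotalOrder)
  open import Relation.Binary.Construct.Add.Supremum.NonStrict using ([_])
  open import Relation.Binary.Construct.Closure.ReflexiveTransitive as Star using (Star; ε; _◅_; _◅◅_)
  open import Relation.Binary.Core using (Rel)
  open import Relation.Binary.PropositionalEquality
  import Relation.Binary.Reasoning.Preorder as PreorderReasoning
  import Relation.Binary.Reasoning.Setoid as SetoidReasoning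
  open import Relation.Nullary
  open import Relation.Nullary.Decidable using (map′; does-⇔; dec-true; dec-false; _×-dec_; _⊎-dec_; _→-dec_)

  open SemiringSum ℕ.+-*-semiring
    using (sum; sum-cong-≗; ∑-distrib-+; ∑-comm; *-distribˡ-sum; sum-replicate-zero)
  module ℕS = Data.Nat.Solver.+-*-Solver

  𝟙 : Bool → ℕ
  𝟙 b = if b then 1 else 0

  private variable
    n : ℕ

  sum-zero : {f : Fin n → ℕ} → (∀ i → f i ≡ 0) → sum f ≡ 0
  sum-zero {n} f≡0 = trans (sum-cong-≗ f≡0) (sum-replicate-zero n)

  sum-mono-≤ : {f g : Fin n → ℕ} → (∀ i → f i ≤ g i) → sum f ≤ sum g
  sum-mono-≤ {ℕ.zero}  f≤g = z≤n
  sum-mono-≤ {ℕ.suc n} f≤g = ℕ.+-mono-≤ (f≤g zero) (sum-mono-≤ (f≤g ∘ suc))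

  term≤sum : (f : Fin n → ℕ) → ∀ i → f i ≤ sum f
  term≤sum f zero    = ℕ.m≤m+n _ _
  term≤sum f (suc i) = ℕ.≤-trans (term≤sum (f ∘ suc) i) (ℕ.m≤n+m _ (f zero))

  sum-const : ∀ n k → sum {n} (λ _ → k) ≡ n * k
  sum-const ℕ.zero    k = refl
  sum-const (ℕ.suc n) k = cong (k +_) (sum-const n k)

  sum-if-≡ : (k : Fin n) (f : Fin n → ℕ) →
             sum (λ i → if does (k Fin.≟ i) then f i else 0) ≡ f k
  sum-if-≡ zero f = trans (cong (f zero +_) (sum-zero {f = λ i → if does (zero Fin.≟ suc i) then f (suc i) else 0} λ _ → refl))
                       (ℕ.+-identityʳ _)
  sum-if-≡ (suc k) f = sum-if-≡ k (f ∘ suc)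

  sum-↑ : ∀ a {b} (f : Fin (a + b) → ℕ) → sum f ≡ sum (λ i → f (i ↑ˡ b)) + sum (λ j → f (a ↑ʳ j))
  sum-↑ ℕ.zero    f = refl
  sum-↑ (ℕ.suc a) f = trans (cong (f zero +_) (sum-↑ a (f ∘ suc))) (sym (ℕ.+-assoc (f zero) _ _))

  ∣tabulate∣ : (f : Fin n → Bool) → ∣ tabulate f ∣ ≡ sum (𝟙 ∘ f)
  ∣tabulate∣ {ℕ.zero}  f = refl
  ∣tabulate∣ {ℕ.suc n} f with f zero
  ... | true  = cong ℕ.suc (∣tabulate∣ (f ∘ suc))
  ... | false = ∣tabulate∣ (f ∘ suc)

  χ : Subset n → Fin n → Bool
  χ X x = does (x ∈? X)

  ∣∣≡sum : (X : Subset n) → ∣ X ∣ ≡ sum (𝟙 ∘ χ X)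
  ∣∣≡sum []          = refl
  ∣∣≡sum (true  ∷ X) = cong ℕ.suc (∣∣≡sum X)
  ∣∣≡sum (false ∷ X) = ∣∣≡sum X

  maximiser : ∀ {k} (f : Fin (ℕ.suc k) → ℕ) → ∃ λ i → ∀ j → f j ≤ f i
  maximiser {ℕ.zero} f = zero , λ { zero → ℕ.≤-refl }
  maximiser {ℕ.suc k} f with maximiser (f ∘ suc)
  ... | i , fj≤fi with ℕ.≤-total (f zero) (f (suc i))
  ... | inj₁ f0≤fi = suc i , λ { zero → f0≤fi ; (suc j) → fj≤fi j }
  ... | inj₂ fi≤f0 = zero , λ { zero → ℕ.≤-refl ; (suc j) → ℕ.≤-trans (fj≤fi j) fi≤f0 }

  last-satisfying : ∀ {n} {P : Fin n → Set} → (∀ x → Dec (P x)) → ∃ P →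
                    ∃ λ x → P x × (∀ y → toℕ x < toℕ y → ¬ P y)
  last-satisfying {ℕ.suc n} {P} P? (x , px) with Fin.any? (P? ∘ suc)
  ... | yes ∃p with last-satisfying (P? ∘ suc) ∃p
  ...   | v , pv , last = suc v , pv , λ { (suc y) (s≤s v<y) → last y v<y }
  last-satisfying {ℕ.suc n} {P} P? (zero , px)  | no ∄p = zero , px , λ { (suc y) _ py → ∄p (y , py) }
  last-satisfying {ℕ.suc n} {P} P? (suc x , px) | no ∄p = ⊥-elim (∄p (x , px))

  -- Vertex zero is the root, and vertex suc i has the parent par i.
  module RootedTree {m : ℕ} (par : Fin m → Fin (ℕ.suc m)) (par≤ : ∀ i → toℕ (par i) ≤ toℕ i) where

    V : Set
    V = Fin (ℕ.suc m)

    infix 4 _◁_ _◁?_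

    data _◁_ : Rel V 0ℓ where
      edge : ∀ i → par i ◁ suc i

    _◁?_ : ∀ x y → Dec (x ◁ y)
    x ◁? zero  = no λ ()
    x ◁? suc i = map′ (λ { refl → edge i }) (λ { (edge i) → refl }) (par i Fin.≟ x)

    ◁⇒< : ∀ {x y} → x ◁ y → toℕ x < toℕ y
    ◁⇒< (edge i) = s≤s (par≤ i)

    ◁-unique : ∀ {x y z} → x ◁ z → y ◁ z → x ≡ y
    ◁-unique (edge i) (edge .i) = refl

    graph : Graph (ℕ.suc m)
    graph = record
      { _~_      = λ x y → x ◁ y ⊎ y ◁ x
      ; _~?_     = λ x y → (x ◁? y) ⊎-dec (y ◁? x)
      ; ~-sym    = Sum.swap
      ; ~-irrefl = λ { refl → Sum.[ irrefl , irrefl ] }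
      }
      where
      irrefl : ∀ {x} → ¬ x ◁ x
      irrefl x◁x = ℕ.<-irrefl refl (◁⇒< x◁x)

    open Graph graph using (_~_; _~?_; ~-sym)

    ~∧<⇒◁ : ∀ {x y} → toℕ x < toℕ y → x ~ y → x ◁ y
    ~∧<⇒◁ x<y (inj₁ x◁y) = x◁y
    ~∧<⇒◁ x<y (inj₂ y◁x) = ⊥-elim (ℕ.<-asym x<y (◁⇒< y◁x))

    to-root : ∀ k x → toℕ x < k → Star _~_ x zero
    to-root k         zero    _         = ε
    to-root (ℕ.suc k) (suc i) (s≤s i<k) = inj₂ (edge i) ◅ to-root k (par i) (ℕ.≤-<-trans (par≤ i) i<k)

    connected : Connected graph
    connected x y = to-root _ x ℕ.≤-refl ◅◅ Star.reverse Sum.swap (to-root _ y ℕ.≤-refl)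

    -- On a cycle, both neighbours of the vertex of largest index would be its parent.
    acyclic : ¬ Cycle graph
    acyclic C = two-neighbours top refl
      where
      open Cycle C
      top = proj₁ (maximiser (toℕ ∘ vertex))

      parent : ∀ i → i ≢ top → vertex i ~ vertex top → vertex i ◁ vertex top
      parent i i≢top = ~∧<⇒◁ (ℕ.≤∧≢⇒< (proj₂ (maximiser (toℕ ∘ vertex)) i)
                                       (i≢top ∘ injective ∘ Fin.toℕ-injective))

      clash : ∀ i j → i ≢ j → i ≢ top → j ≢ top → vertex i ~ vertex top → vertex j ~ vertex top → ⊥
      clash i j i≢j i≢t j≢t i~t j~t = i≢j (injective (◁-unique (parent i i≢t i~t) (parent j j≢t j~t)))

      inject₁≢suc : ∀ {l} (i : Fin l) → inject₁ i ≢ suc i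
      inject₁≢suc (suc i) eq = inject₁≢suc i (Fin.suc-injective eq)

      inner : ∀ {l} (i : Fin (ℕ.suc l)) → i ≢ fromℕ l → ∃ λ j → i ≡ inject₁ j
      inner {ℕ.zero}  zero    i≢ = ⊥-elim (i≢ refl)
      inner {ℕ.suc l} zero    i≢ = zero , refl
      inner {ℕ.suc l} (suc i) i≢ with inner i (i≢ ∘ cong suc)
      ... | j , refl = suc j , refl

      two-neighbours : ∀ i → i ≡ top → ⊥
      two-neighbours zero eq =
        clash (suc zero) (suc (fromℕ (ℕ.suc k))) (λ ()) (λ p → case-suc (trans p (sym eq))) (λ p → case-suc (trans p (sym eq)))
              (subst (λ t → vertex (suc zero) ~ vertex t) eq (~-sym (step zero)))
              (subst (λ t → vertex (suc (fromℕ (ℕ.suc k))) ~ vertex t) eq closing)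
        where
        case-suc : ∀ {l} {i : Fin l} → suc i ≢ zero
        case-suc ()
      two-neighbours (suc i) eq with i Fin.≟ fromℕ (ℕ.suc k)
      ... | yes refl =
        clash zero (inject₁ i) (λ { () }) (λ p → Fin.0≢1+n (trans p (sym eq)))
              (λ p → inject₁≢suc i (trans p (sym eq)))
              (subst (λ t → vertex zero ~ vertex t) eq (~-sym closing))
              (subst (λ t → vertex (inject₁ i) ~ vertex t) eq (step i))
      ... | no i≢ with inner i i≢
      ...   | j , refl =
        clash (inject₁ (inject₁ j)) (suc (suc j)) (λ p → far j p)
              (λ p → inject₁≢suc (inject₁ j) (trans p (sym eq)))
              (λ p → inject₁≢suc (suc j) (sym (trans p (sym eq))))
              (subst (λ t → vertex (inject₁ (inject₁ j)) ~ vertex t) eq (step (inject₁ j)))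
              (subst (λ t → vertex (suc (suc j)) ~ vertex t) eq (~-sym (step (suc j))))
        where
        far : ∀ {l} (j : Fin l) → inject₁ (inject₁ j) ≢ suc (suc j)
        far (suc j) p = far j (Fin.suc-injective p)

    isTree : IsTree graph
    isTree = connected , acyclic

    sum-◁ : (f : V → V → ℕ) →
            sum (λ x → sum λ y → if does (x ◁? y) then f x y else 0) ≡ sum (λ i → f (par i) (suc i))
    sum-◁ f = begin
      sum (λ x → sum λ y → if does (x ◁? y) then f x y else 0)  ≡⟨ ∑-comm (λ x y → if does (x ◁? y) then f x y else 0) ⟩
      sum (λ y → sum λ x → if does (x ◁? y) then f x y else 0)  ≡⟨ cong₂ _+_ (sum-zero {ℕ.suc m} λ _ → refl)
                                                                    (sum-cong-≗ λ i → sum-if-≡ (par i) (λ x → f x (suc i))) ⟩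
      sum (λ i → f (par i) (suc i))                             ∎
      where open ≡-Reasoning

    edgeCount : Subset (ℕ.suc m) → ℕ
    edgeCount X = sum λ i → 𝟙 (χ X (par i) ∧ χ X (suc i))

    childCount : V → ℕ
    childCount v = sum λ i → 𝟙 (does (par i Fin.≟ v))

    degree≡ : ∀ x → degree graph x ≡ childCount x + 𝟙 (does (zero {n = m} Fin.<? x))
    degree≡ x = begin
      degree graph x ≡⟨ ∣tabulate∣ (λ y → does (x ~? y)) ⟩
      sum (λ y → 𝟙 (does (x ~? y)))                                 ≡⟨ sum-cong-≗ exclusive ⟩
      sum (λ y → 𝟙 (does (x ◁? y)) + 𝟙 (does (y ◁? x)))
        ≡⟨ ∑-distrib-+ (λ y → 𝟙 (does (x ◁? y))) (λ y → 𝟙 (does (y ◁? x))) ⟩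
      sum (λ y → 𝟙 (does (x ◁? y))) + sum (λ y → 𝟙 (does (y ◁? x))) ≡⟨ cong (childCount x +_) (parents x) ⟩
      childCount x + 𝟙 (does (zero {n = m} Fin.<? x)) ∎
      where
      open ≡-Reasoning
      exclusive : ∀ y → 𝟙 (does (x ~? y)) ≡ 𝟙 (does (x ◁? y)) + 𝟙 (does (y ◁? x))
      exclusive y with x ◁? y | y ◁? x
      ... | yes p | yes q = ⊥-elim (ℕ.<-asym (◁⇒< p) (◁⇒< q))
      ... | yes p | no _  = refl
      ... | no _  | yes _ = refl
      ... | no _  | no _  = refl

      parents : ∀ x → sum (λ y → 𝟙 (does (y ◁? x))) ≡ 𝟙 (does (zero {n = m} Fin.<? x))
      parents zero    = sum-zero {ℕ.suc m} λ _ → refl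
      parents (suc i) = sum-if-≡ (par i) (λ _ → 1)

    record RootedAt (X : Subset (ℕ.suc m)) (t : V) : Set where
      field
        root∈  : t ∈ X
        parent : ∀ {z} → z ∈ X → z ≡ t ⊎ ∃ λ p → p ◁ z × p ∈ X
        top    : ∀ {p} → p ◁ t → p ∉ X

    ascend : ∀ X k x → toℕ x < k → x ∈ X → ∃ λ t → t ∈ X × (∀ {p} → p ◁ t → p ∉ X)
    ascend X k         zero    _         x∈X = zero , x∈X , λ ()
    ascend X (ℕ.suc k) (suc i) (s≤s i<k) x∈X with par i ∈? X
    ... | yes p∈X = ascend X k (par i) (ℕ.≤-<-trans (par≤ i) i<k) p∈X
    ... | no  p∉X = suc i , x∈X , λ { (edge i) → p∉X }

    data Below (X : Subset (ℕ.suc m)) (t : V) : V → Set where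
      here  : Below X t t
      under : ∀ {p z} → Below X t p → p ∈ X → p ◁ z → Below X t z

    connected⇒rooted : ∀ {X x} → x ∈ X → ConnectedOn graph X → ∃ (RootedAt X)
    connected⇒rooted {X} x∈X conn with ascend X _ _ ℕ.≤-refl x∈X
    ... | t , t∈X , top = t , record
      { root∈  = t∈X
      ; parent = λ z∈X → parent (walk here (conn t _ t∈X z∈X))
      ; top    = top
      }
      where
      walk : ∀ {z z′} → Below X t z → Star (InducedAdjacency graph X) z z′ → Below X t z′
      walk b ε = b
      walk b ((z∈X , _ , inj₁ z◁z′) ◅ w) = walk (under b z∈X z◁z′) w
      walk here ((_ , p∈X , inj₂ p◁t) ◅ w) = ⊥-elim (top p◁t p∈X)
      walk (under b _ p◁z) ((_ , _ , inj₂ p′◁z) ◅ w) with ◁-unique p◁z p′◁z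
      ... | refl = walk b w
      parent : ∀ {z} → Below X t z → z ≡ t ⊎ ∃ λ p → p ◁ z × p ∈ X
      parent here = inj₁ refl
      parent (under _ p∈X p◁z) = inj₂ (_ , p◁z , p∈X)

    rooted⇒connected : ∀ {X t} → RootedAt X t → ConnectedOn graph X
    rooted⇒connected {X} {t} R x y x∈X y∈X =
      up _ ℕ.≤-refl x∈X ◅◅ Star.reverse (λ (p , q , e) → q , p , Sum.swap e) (up _ ℕ.≤-refl y∈X)
      where
      open RootedAt R
      up : ∀ {z} k → toℕ z < k → z ∈ X → Star (InducedAdjacency graph X) z t
      up (ℕ.suc k) (s≤s z≤k) z∈X with parent z∈X
      ... | inj₁ refl = ε
      ... | inj₂ (p , p◁z , p∈X) = (z∈X , p∈X , inj₂ p◁z) ◅ up k (ℕ.<-≤-trans (◁⇒< p◁z) z≤k) p∈X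

    rooted⇒size : ∀ {X t} → RootedAt X t → ∣ X ∣ ≡ ℕ.suc (edgeCount X)
    rooted⇒size {X} {t} R = trans (∣∣≡sum X) (count t refl)
      where
      open RootedAt R
      open ≡-Reasoning

      hasParent : ∀ i → suc i ≢ t → 𝟙 (χ X (suc i)) ≡ 𝟙 (χ X (par i) ∧ χ X (suc i))
      hasParent i i≢t with suc i ∈? X
      ... | no _ with par i ∈? X
      ...   | yes _ = refl
      ...   | no _  = refl
      hasParent i i≢t | yes i∈X with par i ∈? X
      ...   | yes _ = refl
      ...   | no p∉X with parent i∈X
      ...     | inj₁ i≡t = ⊥-elim (i≢t i≡t)
      ...     | inj₂ (_ , edge .i , p∈X) = ⊥-elim (p∉X p∈X)

      count : ∀ s → s ≡ t → sum (𝟙 ∘ χ X) ≡ ℕ.suc (edgeCount X)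
      count zero refl = cong₂ _+_ (cong 𝟙 (dec-true (zero ∈? X) root∈)) (sum-cong-≗ λ i → hasParent i λ ())
      count (suc j) refl = begin
        sum (𝟙 ∘ χ X)
          ≡⟨ cong₂ _+_ (cong 𝟙 (dec-false (zero ∈? X) 0∉X)) (sum-cong-≗ split) ⟩
        sum (λ i → 𝟙 (does (j Fin.≟ i)) + 𝟙 (χ X (par i) ∧ χ X (suc i)))  ≡⟨ ∑-distrib-+ (λ i → 𝟙 (does (j Fin.≟ i))) _ ⟩
        sum (λ i → 𝟙 (does (j Fin.≟ i))) + edgeCount X                    ≡⟨ cong (_+ edgeCount X) (sum-if-≡ j (λ _ → 1)) ⟩
        ℕ.suc (edgeCount X)                                               ∎
        where
        0∉X : zero ∉ X
        0∉X 0∈X with parent 0∈X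
        ... | inj₁ ()
        ... | inj₂ (_ , () , _)
        split : ∀ i → 𝟙 (χ X (suc i)) ≡ 𝟙 (does (j Fin.≟ i)) + 𝟙 (χ X (par i) ∧ χ X (suc i))
        split i with j Fin.≟ i
        ... | no j≢i = hasParent i (j≢i ∘ sym ∘ Fin.suc-injective)
        ... | yes refl rewrite dec-true (suc j ∈? X) root∈ | dec-false (par j ∈? X) (top (edge j)) = refl

    connected⇒size : ∀ {X} → Nonempty X → ConnectedOn graph X → ∣ X ∣ ≡ ℕ.suc (edgeCount X)
    connected⇒size (_ , x∈X) conn = rooted⇒size (proj₂ (connected⇒rooted x∈X conn))

    cutCount : Subset (ℕ.suc m) → Subset (ℕ.suc m) → ℕ
    cutCount A B = sum λ i → 𝟙 (χ A (par i) ∧ χ B (suc i)) + 𝟙 (χ A (suc i) ∧ χ B (par i))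

    module _ {S A B : Subset (ℕ.suc m)} (covers : A ∪ B ≡ S) (disjoint : A ∩ B ≡ Subset.⊥) where

      χ-∪ : ∀ x → χ S x ≡ χ A x ∨ χ B x
      χ-∪ x with x ∈? S | x ∈? A | x ∈? B
      ... | yes _   | yes _   | _       = refl
      ... | yes _   | no _    | yes _   = refl
      ... | yes x∈S | no x∉A  | no x∉B  = ⊥-elim (Sum.[ x∉A , x∉B ] (Subset.x∈p∪q⁻ A B (subst (x ∈_) (sym covers) x∈S)))
      ... | no x∉S  | yes x∈A | _       = ⊥-elim (x∉S (subst (x ∈_) covers (Subset.x∈p∪q⁺ (inj₁ x∈A))))
      ... | no x∉S  | no _    | yes x∈B = ⊥-elim (x∉S (subst (x ∈_) covers (Subset.x∈p∪q⁺ (inj₂ x∈B))))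
      ... | no _    | no _    | no _    = refl

      χ-∩ : ∀ x → χ A x ∧ χ B x ≡ false
      χ-∩ x with x ∈? A | x ∈? B
      ... | yes x∈A | yes x∈B = ⊥-elim (Subset.∉⊥ (subst (x ∈_) disjoint (Subset.x∈p∩q⁺ (x∈A , x∈B))))
      ... | yes _   | no _    = refl
      ... | no _    | _       = refl

      size-∪ : ∣ S ∣ ≡ ∣ A ∣ + ∣ B ∣
      size-∪ = begin
        ∣ S ∣                                   ≡⟨ ∣∣≡sum S ⟩
        sum (𝟙 ∘ χ S)                           ≡⟨ sum-cong-≗ (λ x → trans (cong 𝟙 (χ-∪ x)) (or (χ A x) (χ B x) (χ-∩ x))) ⟩
        sum (λ x → 𝟙 (χ A x) + 𝟙 (χ B x))       ≡⟨ ∑-distrib-+ (𝟙 ∘ χ A) (𝟙 ∘ χ B) ⟩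
        sum (𝟙 ∘ χ A) + sum (𝟙 ∘ χ B)           ≡⟨ cong₂ _+_ (∣∣≡sum A) (∣∣≡sum B) ⟨
        ∣ A ∣ + ∣ B ∣                           ∎
        where
        open ≡-Reasoning
        or : ∀ a b → a ∧ b ≡ false → 𝟙 (a ∨ b) ≡ 𝟙 a + 𝟙 b
        or true  false _ = refl
        or false b     _ = refl

      edgeCount-∪ : edgeCount S ≡ (edgeCount A + edgeCount B) + cutCount A B
      edgeCount-∪ = begin
        edgeCount S  ≡⟨ sum-cong-≗ (λ i → trans (cong₂ (λ p q → 𝟙 (p ∧ q)) (χ-∪ (par i)) (χ-∪ (suc i)))
                                                (or (χ A (par i)) (χ B (par i)) (χ A (suc i)) (χ B (suc i)) (χ-∩ (par i)) (χ-∩ (suc i)))) ⟩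
        sum (λ i → (eA i + eB i) + c i)         ≡⟨ ∑-distrib-+ (λ i → eA i + eB i) c ⟩
        sum (λ i → eA i + eB i) + cutCount A B  ≡⟨ cong (_+ cutCount A B) (∑-distrib-+ eA eB) ⟩
        (edgeCount A + edgeCount B) + cutCount A B ∎
        where
        open ≡-Reasoning
        eA eB c : Fin m → ℕ
        eA i = 𝟙 (χ A (par i) ∧ χ A (suc i))
        eB i = 𝟙 (χ B (par i) ∧ χ B (suc i))
        c  i = 𝟙 (χ A (par i) ∧ χ B (suc i)) + 𝟙 (χ A (suc i) ∧ χ B (par i))
        or : ∀ a b a′ b′ → a ∧ b ≡ false → a′ ∧ b′ ≡ false →
             𝟙 ((a ∨ b) ∧ (a′ ∨ b′)) ≡ (𝟙 (a ∧ a′) + 𝟙 (b ∧ b′)) + (𝟙 (a ∧ b′) + 𝟙 (a′ ∧ b))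
        or false false false b′    _ _ = refl
        or false false true  false _ _ = refl
        or false true  false false _ _ = refl
        or false true  false true  _ _ = refl
        or false true  true  false _ _ = refl
        or true  false false false _ _ = refl
        or true  false false true  _ _ = refl
        or true  false true  false _ _ = refl

      cutCount≡1 : Nonempty A → Nonempty B → ConnectedOn graph A → ConnectedOn graph B → ConnectedOn graph S →
                   cutCount A B ≡ 1
      cutCount≡1 neA@(x , x∈A) neB connA connB connS =
        ℕ.+-cancelˡ-≡ (edgeCount A + edgeCount B) _ _ (ℕ.suc-injective (begin
          ℕ.suc ((edgeCount A + edgeCount B) + cutCount A B) ≡⟨ cong ℕ.suc edgeCount-∪ ⟨
          ℕ.suc (edgeCount S)                                ≡⟨ connected⇒size (x , subst (x ∈_) covers (Subset.x∈p∪q⁺ (inj₁ x∈A))) connS ⟨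
          ∣ S ∣                                              ≡⟨ size-∪ ⟩
          ∣ A ∣ + ∣ B ∣                                      ≡⟨ cong₂ _+_ (connected⇒size neA connA) (connected⇒size neB connB) ⟩
          ℕ.suc (edgeCount A + ℕ.suc (edgeCount B))          ≡⟨ cong ℕ.suc (ℕ.+-suc (edgeCount A) (edgeCount B)) ⟩
          ℕ.suc (ℕ.suc (edgeCount A + edgeCount B))          ≡⟨ cong ℕ.suc (ℕ.+-comm 1 (edgeCount A + edgeCount B)) ⟩
          ℕ.suc (edgeCount A + edgeCount B + 1)              ∎))
        where open ≡-Reasoning

  module BalancedSplit {m : ℕ} (par : Fin m → Fin (ℕ.suc m)) (par≤ : ∀ i → toℕ (par i) ≤ toℕ i)
                       (childCount≤2 : ∀ v → RootedTree.childCount par par≤ v ≤ 2) where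
    open RootedTree par par≤

    infix 4 _⊒_ _⊒?_

    data _⊒_ (v : V) : V → Set where
      here  : v ⊒ v
      there : ∀ {p z} → v ⊒ p → p ◁ z → v ⊒ z

    ⊒⇒≤ : ∀ {v z} → v ⊒ z → toℕ v ≤ toℕ z
    ⊒⇒≤ here = ℕ.≤-refl
    ⊒⇒≤ (there v⊒p p◁z) = ℕ.≤-trans (⊒⇒≤ v⊒p) (ℕ.<⇒≤ (◁⇒< p◁z))

    ⊒-trans : ∀ {u v z} → u ⊒ v → v ⊒ z → u ⊒ z
    ⊒-trans u⊒v here = u⊒v
    ⊒-trans u⊒v (there v⊒p p◁z) = there (⊒-trans u⊒v v⊒p) p◁z

    ⊒-dec : ∀ v k z → toℕ z < k → Dec (v ⊒ z)
    ⊒-dec v k zero _ = map′ (λ { refl → here }) (λ { here → refl ; (there _ ()) }) (v Fin.≟ zero)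
    ⊒-dec v (ℕ.suc k) (suc i) (s≤s i<k) =
      map′ Sum.[ (λ { refl → here }) , (λ v⊒p → there v⊒p (edge i)) ]
           (λ { here → inj₁ refl ; (there v⊒p (edge .i)) → inj₂ v⊒p })
           ((v Fin.≟ suc i) ⊎-dec ⊒-dec v k (par i) (ℕ.≤-<-trans (par≤ i) i<k))

    _⊒?_ : ∀ v z → Dec (v ⊒ z)
    v ⊒? z = ⊒-dec v _ z ℕ.≤-refl

    zero⊒ : ∀ k z → toℕ z < k → zero ⊒ z
    zero⊒ k         zero    _         = here
    zero⊒ (ℕ.suc k) (suc i) (s≤s i<k) = there (zero⊒ k (par i) (ℕ.≤-<-trans (par≤ i) i<k)) (edge i)

    ⊒-first : ∀ {v z} → v ⊒ z → v ≡ z ⊎ ∃ λ i → par i ≡ v × suc i ⊒ z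
    ⊒-first here = inj₁ refl
    ⊒-first (there v⊒p p◁z) with ⊒-first v⊒p | p◁z
    ... | inj₁ refl | edge i = inj₂ (i , refl , here)
    ... | inj₂ (i , eq , i⊒p) | _ = inj₂ (i , eq , there i⊒p p◁z)

    desc : V → Subset (ℕ.suc m)
    desc v = tabulate λ z → does (v ⊒? z)

    ∈-desc⁺ : ∀ {v z} → v ⊒ z → z ∈ desc v
    ∈-desc⁺ {v} {z} v⊒z = Vec.lookup⇒[]= z _ (trans (Vec.lookup∘tabulate (λ z → does (v ⊒? z)) z) (dec-true (v ⊒? z) v⊒z))

    ∈-desc⁻ : ∀ {v z} → z ∈ desc v → v ⊒ z
    ∈-desc⁻ {v} {z} z∈ with v ⊒? z | trans (sym (Vec.lookup∘tabulate (λ z → does (v ⊒? z)) z)) (Vec.[]=⇒lookup z∈)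
    ... | yes v⊒z | _ = v⊒z

    module _ (S : Subset (ℕ.suc m)) where

      sizeBelow : V → ℕ
      sizeBelow v = ∣ S ∩ desc v ∣

      sizeBelow-root : sizeBelow zero ≡ ∣ S ∣
      sizeBelow-root = cong ∣_∣ (Subset.⊆-antisym (Subset.p∩q⊆p S (desc zero))
                         (λ x∈S → Subset.x∈p∩q⁺ (x∈S , ∈-desc⁺ (zero⊒ _ _ ℕ.≤-refl))))

      sizeBelow≤ : ∀ v → sizeBelow v ≤ 1 + sum λ i → 𝟙 (does (par i Fin.≟ v)) * sizeBelow (suc i)
      sizeBelow≤ v = begin
        sizeBelow v                                                  ≡⟨ ∣∣≡sum (S ∩ desc v) ⟩
        sum (𝟙 ∘ χ (S ∩ desc v))                                     ≤⟨ sum-mono-≤ pointwise ⟩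
        sum (λ z → 𝟙 (does (v Fin.≟ z)) + sum λ i → below i z)
          ≡⟨ ∑-distrib-+ (λ z → 𝟙 (does (v Fin.≟ z))) (λ z → sum λ i → below i z) ⟩
        sum (λ z → 𝟙 (does (v Fin.≟ z))) + sum (λ z → sum λ i → below i z)
          ≡⟨ cong₂ _+_ (sum-if-≡ v (λ _ → 1)) (∑-comm (λ z i → below i z)) ⟩
        1 + sum (λ i → sum λ z → below i z)
          ≡⟨ cong (1 +_) (sum-cong-≗ λ i → trans (sym (*-distribˡ-sum (isChild i) (𝟙 ∘ χ (S ∩ desc (suc i)))))
                                                 (cong (isChild i *_) (sym (∣∣≡sum (S ∩ desc (suc i)))))) ⟩
        1 + sum (λ i → isChild i * sizeBelow (suc i)) ∎
        where
        open ℕ.≤-Reasoning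
        isChild : Fin m → ℕ
        isChild i = 𝟙 (does (par i Fin.≟ v))
        below : Fin m → V → ℕ
        below i z = isChild i * 𝟙 (χ (S ∩ desc (suc i)) z)
        pointwise : ∀ z → 𝟙 (χ (S ∩ desc v) z) ≤ 𝟙 (does (v Fin.≟ z)) + sum λ i → below i z
        pointwise z with z ∈? S ∩ desc v
        ... | no _ = z≤n
        ... | yes z∈ with Subset.x∈p∩q⁻ S (desc v) z∈
        ... | z∈S , z∈desc with ⊒-first (∈-desc⁻ z∈desc)
        ...   | inj₁ v≡z rewrite dec-true (v Fin.≟ z) v≡z = s≤s z≤n
        ...   | inj₂ (i , eq , i⊒z) = ℕ.m≤n⇒m≤o+n (𝟙 (does (v Fin.≟ z))) (begin
          1                  ≡⟨ cong₂ _*_ (cong 𝟙 (dec-true (par i Fin.≟ v) eq))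
                                          (cong 𝟙 (dec-true (z ∈? S ∩ desc (suc i)) (Subset.x∈p∩q⁺ (z∈S , ∈-desc⁺ i⊒z)))) ⟨
          below i z          ≤⟨ term≤sum (λ i → below i z) i ⟩
          sum (λ i → below i z) ∎)

      light-children⇒light : ∀ v k → (∀ i → par i ≡ v → 3 * sizeBelow (suc i) ≤ k) → 3 * sizeBelow v ≤ 3 + 2 * k
      light-children⇒light v k light = begin
        3 * sizeBelow v                                               ≤⟨ ℕ.*-monoʳ-≤ 3 (sizeBelow≤ v) ⟩
        3 * (1 + sum (λ i → isChild i * sizeBelow (suc i)))
          ≡⟨ ℕ.*-distribˡ-+ 3 1 (sum λ i → isChild i * sizeBelow (suc i)) ⟩
        3 + 3 * sum (λ i → isChild i * sizeBelow (suc i))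
          ≡⟨ cong (3 +_) (*-distribˡ-sum 3 (λ i → isChild i * sizeBelow (suc i))) ⟩
        3 + sum (λ i → 3 * (isChild i * sizeBelow (suc i)))           ≤⟨ ℕ.+-monoʳ-≤ 3 (sum-mono-≤ bound) ⟩
        3 + sum (λ i → k * isChild i)                                 ≡⟨ cong (3 +_) (*-distribˡ-sum k isChild) ⟨
        3 + k * childCount v                                          ≤⟨ ℕ.+-monoʳ-≤ 3 (ℕ.*-monoʳ-≤ k (childCount≤2 v)) ⟩
        3 + k * 2                                                     ≡⟨ cong (3 +_) (ℕ.*-comm k 2) ⟩
        3 + 2 * k                                                     ∎
        where
        open ℕ.≤-Reasoning
        isChild : Fin m → ℕ
        isChild i = 𝟙 (does (par i Fin.≟ v))
        bound : ∀ i → 3 * (isChild i * sizeBelow (suc i)) ≤ k * isChild i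
        bound i with par i Fin.≟ v
        ... | no _ = z≤n
        ... | yes eq = begin
          3 * (sizeBelow (suc i) + 0)  ≡⟨ cong (3 *_) (ℕ.+-identityʳ (sizeBelow (suc i))) ⟩
          3 * sizeBelow (suc i)        ≤⟨ light i eq ⟩
          k                            ≡⟨ ℕ.*-identityʳ k ⟨
          k * 1                        ∎

    ∣p∣>0⇒Nonempty : ∀ {n} (p : Subset n) → 0 < ∣ p ∣ → Nonempty p
    ∣p∣>0⇒Nonempty {n} p 0<p with Subset.nonempty? p
    ... | yes ne = ne
    ... | no ¬ne = ⊥-elim (ℕ.<-irrefl (sym (trans (cong ∣_∣ (Subset.Empty-unique ¬ne)) (Subset.∣⊥∣≡0 n))) 0<p)

    record BalancedSplit (S A B : Subset (ℕ.suc m)) : Set where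
      field
        covers     : A ∪ B ≡ S
        disjoint   : A ∩ B ≡ Subset.⊥
        A-nonempty : Nonempty A
        B-nonempty : Nonempty B
        A-conn     : ConnectedOn graph A
        B-conn     : ConnectedOn graph B
        balanced   : 3 * ((∣ A ∣ ∸ 1) ⊔ (∣ B ∣ ∸ 1)) ≤ 2 * (∣ S ∣ ∸ 1)

    splitAbove : ∀ {S k} v → ∣ S ∣ ≡ 2 + k → ConnectedOn graph S →
                 1 + k ≤ 3 * sizeBelow S v → 3 * sizeBelow S v ≤ 3 + 2 * k → ∃₂ (BalancedSplit S)
    splitAbove {S} {k} v size conn lower upper =
      A , B , record
        { covers     = covers
        ; disjoint   = disjoint
        ; A-nonempty = A-nonempty
        ; B-nonempty = B-nonempty
        ; A-conn     = rooted⇒connected A-rooted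
        ; B-conn     = rooted⇒connected B-rooted
        ; balanced   = balanced
        }
      where
      S-nonempty = ∣p∣>0⇒Nonempty S (subst (0 <_) (sym size) (s≤s z≤n))
      S-rooted = connected⇒rooted (proj₂ S-nonempty) conn
      t = proj₁ S-rooted
      module S = RootedAt (proj₂ S-rooted)

      A = S ∩ desc v
      B = S ∩ ∁ (desc v)

      covers : A ∪ B ≡ S
      covers = begin
        (S ∩ desc v) ∪ (S ∩ ∁ (desc v)) ≡⟨ Subset.∩-distribˡ-∪ S (desc v) (∁ (desc v)) ⟨
        S ∩ (desc v ∪ ∁ (desc v))       ≡⟨ cong (S ∩_) (Subset.p∪∁p≡⊤ (desc v)) ⟩
        S ∩ Subset.⊤                    ≡⟨ Subset.∩-identityʳ S ⟩
        S                               ∎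
        where open ≡-Reasoning

      A⊆S : ∀ {z} → z ∈ A → z ∈ S
      A⊆S = proj₁ ∘ Subset.x∈p∩q⁻ S (desc v)
      B⊆S : ∀ {z} → z ∈ B → z ∈ S
      B⊆S = proj₁ ∘ Subset.x∈p∩q⁻ S (∁ (desc v))
      A⇒⊒ : ∀ {z} → z ∈ A → v ⊒ z
      A⇒⊒ = ∈-desc⁻ ∘ proj₂ ∘ Subset.x∈p∩q⁻ S (desc v)
      B⇒⋣ : ∀ {z} → z ∈ B → ¬ v ⊒ z
      B⇒⋣ z∈B v⊒z = Subset.x∈∁p⇒x∉p (proj₂ (Subset.x∈p∩q⁻ S (∁ (desc v)) z∈B)) (∈-desc⁺ v⊒z)
      A⁺ : ∀ {z} → z ∈ S → v ⊒ z → z ∈ A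
      A⁺ z∈S v⊒z = Subset.x∈p∩q⁺ (z∈S , ∈-desc⁺ v⊒z)
      B⁺ : ∀ {z} → z ∈ S → ¬ v ⊒ z → z ∈ B
      B⁺ z∈S v⋣z = Subset.x∈p∩q⁺ (z∈S , Subset.x∉p⇒x∈∁p (v⋣z ∘ ∈-desc⁻))

      disjoint : A ∩ B ≡ Subset.⊥
      disjoint = Subset.Empty-unique λ (x , x∈) →
        let x∈A , x∈B = Subset.x∈p∩q⁻ A B x∈ in B⇒⋣ x∈B (A⇒⊒ x∈A)

      sizes : 2 + k ≡ ∣ A ∣ + ∣ B ∣
      sizes = trans (sym size) (size-∪ covers disjoint)

      lowerB : 3 + k ≤ 3 * ∣ B ∣
      lowerB = ℕ.+-cancelˡ-≤ (3 * ∣ A ∣) _ _ (begin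
        3 * ∣ A ∣ + (3 + k)        ≤⟨ ℕ.+-monoˡ-≤ (3 + k) upper ⟩
        3 + 2 * k + (3 + k)
          ≡⟨ solve 1 (λ k → con 3 :+ con 2 :* k :+ (con 3 :+ k) := con 3 :* (con 2 :+ k)) refl k ⟩
        3 * (2 + k)                ≡⟨ cong (3 *_) sizes ⟩
        3 * (∣ A ∣ + ∣ B ∣)        ≡⟨ ℕ.*-distribˡ-+ 3 ∣ A ∣ ∣ B ∣ ⟩
        3 * ∣ A ∣ + 3 * ∣ B ∣      ∎)
        where
        open ℕ.≤-Reasoning
        open ℕS

      positive : ∀ {a j} → ℕ.suc j ≤ 3 * a → 0 < a
      positive {ℕ.suc a} _ = s≤s z≤n

      A-nonempty : Nonempty A
      A-nonempty = ∣p∣>0⇒Nonempty A (positive lower)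
      B-nonempty : Nonempty B
      B-nonempty = ∣p∣>0⇒Nonempty B (positive lowerB)

      upperB : 3 * ∣ B ∣ ≤ 5 + 2 * k
      upperB = ℕ.+-cancelˡ-≤ (1 + k) _ _ (begin
        1 + k + 3 * ∣ B ∣          ≤⟨ ℕ.+-monoˡ-≤ (3 * ∣ B ∣) lower ⟩
        3 * ∣ A ∣ + 3 * ∣ B ∣      ≡⟨ ℕ.*-distribˡ-+ 3 ∣ A ∣ ∣ B ∣ ⟨
        3 * (∣ A ∣ + ∣ B ∣)        ≡⟨ cong (3 *_) sizes ⟨
        3 * (2 + k)
          ≡⟨ solve 1 (λ k → con 3 :* (con 2 :+ k) := con 1 :+ k :+ (con 5 :+ con 2 :* k)) refl k ⟩
        1 + k + (5 + 2 * k)        ∎)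
        where
        open ℕ.≤-Reasoning
        open ℕS

      balanced : 3 * ((∣ A ∣ ∸ 1) ⊔ (∣ B ∣ ∸ 1)) ≤ 2 * (∣ S ∣ ∸ 1)
      balanced = begin
        3 * ((∣ A ∣ ∸ 1) ⊔ (∣ B ∣ ∸ 1))     ≡⟨ ℕ.*-distribˡ-⊔ 3 (∣ A ∣ ∸ 1) (∣ B ∣ ∸ 1) ⟩
        3 * (∣ A ∣ ∸ 1) ⊔ 3 * (∣ B ∣ ∸ 1)   ≤⟨ ℕ.⊔-lub (drop ∣ A ∣ (ℕ.≤-trans upper (ℕ.m≤n+m (3 + 2 * k) 2)))
                                                       (drop ∣ B ∣ upperB) ⟩
        2 + 2 * k                           ≡⟨ ℕ.*-distribˡ-+ 2 1 k ⟨
        2 * (2 + k ∸ 1)                     ≡⟨ cong (λ l → 2 * (l ∸ 1)) size ⟨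
        2 * (∣ S ∣ ∸ 1)                     ∎
        where
        open ℕ.≤-Reasoning
        drop : ∀ a → 3 * a ≤ 5 + 2 * k → 3 * (a ∸ 1) ≤ 2 + 2 * k
        drop a 3a≤ = begin
          3 * (a ∸ 1)    ≡⟨ ℕ.*-distribˡ-∸ 3 a 1 ⟩
          3 * a ∸ 3      ≤⟨ ℕ.∸-monoˡ-≤ 3 3a≤ ⟩
          2 + 2 * k      ∎

      t⊒ : ∀ {z} j → toℕ z < j → z ∈ S → t ⊒ z
      t⊒ (ℕ.suc j) (s≤s z≤j) z∈S with S.parent z∈S
      ... | inj₁ refl = here
      ... | inj₂ (p , p◁z , p∈S) = there (t⊒ j (ℕ.<-≤-trans (◁⇒< p◁z) z≤j) p∈S) p◁z

      v⋣t : ¬ v ⊒ t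
      v⋣t v⊒t = let z , z∈B = B-nonempty in B⇒⋣ z∈B (⊒-trans v⊒t (t⊒ _ ℕ.≤-refl (B⊆S z∈B)))

      parent∈S : ∀ {p z} → v ⊒ z → z ∈ S → p ◁ z → p ∈ S
      parent∈S v⊒z z∈S p◁z with S.parent z∈S
      ... | inj₁ refl = ⊥-elim (v⋣t v⊒z)
      ... | inj₂ (_ , q◁z , q∈S) with ◁-unique p◁z q◁z
      ...   | refl = q∈S

      v∈S : ∀ {z} → v ⊒ z → z ∈ S → v ∈ S
      v∈S here z∈S = z∈S
      v∈S v⊒z@(there v⊒p p◁z) z∈S = v∈S v⊒p (parent∈S v⊒z z∈S p◁z)

      A-rooted : RootedAt A v
      A-rooted = record
        { root∈  = let z , z∈A = A-nonempty in A⁺ (v∈S (A⇒⊒ z∈A) (A⊆S z∈A)) here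
        ; parent = λ z∈A → parent (A⇒⊒ z∈A) (A⊆S z∈A)
        ; top    = λ p◁v p∈A → ℕ.<⇒≱ (◁⇒< p◁v) (⊒⇒≤ (A⇒⊒ p∈A))
        }
        where
        parent : ∀ {z} → v ⊒ z → z ∈ S → z ≡ v ⊎ ∃ λ p → p ◁ z × p ∈ A
        parent here _ = inj₁ refl
        parent v⊒z@(there v⊒p p◁z) z∈S = inj₂ (_ , p◁z , A⁺ (parent∈S v⊒z z∈S p◁z) v⊒p)

      B-rooted : RootedAt B t
      B-rooted = record
        { root∈  = B⁺ S.root∈ v⋣t
        ; parent = λ z∈B → Sum.map id (λ (p , p◁z , p∈S) → p , p◁z , B⁺ p∈S λ v⊒p → B⇒⋣ z∈B (there v⊒p p◁z))
                                   (S.parent (B⊆S z∈B))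
        ; top    = λ p◁t p∈B → S.top p◁t (B⊆S p∈B)
        }

    -- Cut above the last vertex v carrying at least (|S| − 1) / 3 vertices of S below it: the children
    -- of v carry less, and there are at most two of them, so v does not carry too much either.
    balancedSplit : ∀ {S k} → ∣ S ∣ ≡ 2 + k → ConnectedOn graph S → ∃₂ (BalancedSplit S)
    balancedSplit {S} {k} size conn
      with last-satisfying (λ v → 1 + k ℕ.≤? 3 * sizeBelow S v) (zero , root-heavy)
      where
      open ℕ.≤-Reasoning
      root-heavy = begin
        1 + k                 ≤⟨ ℕ.n≤1+n _ ⟩
        2 + k                 ≡⟨ size ⟨
        ∣ S ∣                 ≡⟨ sizeBelow-root S ⟨
        sizeBelow S zero      ≤⟨ ℕ.m≤n*m _ 3 ⟩
        3 * sizeBelow S zero  ∎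
    ... | v , heavy , last = splitAbove v size conn heavy
      (light-children⇒light S v k λ i eq →
        ℕ.s≤s⁻¹ (ℕ.≰⇒> (last (suc i) (s≤s (subst (λ u → toℕ u ≤ toℕ i) eq (par≤ i))))))

  module _ {A : Set} where

    leaves : Tree ⊤ A → List A
    leaves = Leaves.toList

    leaves-∷ : ∀ t xs → Leaves.toDiffList t xs ≡ leaves t ++ xs
    leaves-∷ (leaf x)     xs = refl
    leaves-∷ (node l _ r) xs = begin
      Leaves.toDiffList l (Leaves.toDiffList r xs)  ≡⟨ leaves-∷ l (Leaves.toDiffList r xs) ⟩
      leaves l ++ Leaves.toDiffList r xs            ≡⟨ cong (leaves l ++_) (leaves-∷ r xs) ⟩
      leaves l ++ (leaves r ++ xs)                  ≡⟨ List.++-assoc (leaves l) (leaves r) xs ⟨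
      (leaves l ++ leaves r) ++ xs                  ≡⟨ cong (_++ xs) (leaves-∷ l (leaves r)) ⟨
      Leaves.toDiffList l (leaves r) ++ xs          ∎
      where open ≡-Reasoning

    leaves-node : ∀ l r → leaves (node l tt r) ≡ leaves l ++ leaves r
    leaves-node l r = leaves-∷ l (leaves r)

    length-leaves : ∀ t → List.length (leaves t) ≡ #leaves t
    length-leaves (leaf x)     = refl
    length-leaves (node l _ r) = begin
      List.length (leaves (node l tt r))                  ≡⟨ cong List.length (leaves-node l r) ⟩
      List.length (leaves l ++ leaves r)                  ≡⟨ List.length-++ (leaves l) ⟩
      List.length (leaves l) + List.length (leaves r)     ≡⟨ cong₂ _+_ (length-leaves l) (length-leaves r) ⟩
      #leaves l + #leaves r                               ∎
      where open ≡-Reasoning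

    #leaves>0 : ∀ (t : Tree ⊤ A) → 0 < #leaves t
    #leaves>0 (leaf _)     = s≤s z≤n
    #leaves>0 (node l _ r) = ℕ.≤-trans (#leaves>0 l) (ℕ.m≤m+n _ _)

    some-leaf : ∀ t → ∃ (_∈ᴸ leaves t)
    some-leaf (leaf x)     = x , here refl
    some-leaf (node l _ r) = let x , x∈l = some-leaf l in
      x , subst (x ∈ᴸ_) (sym (leaves-node l r)) (List.∈-++⁺ˡ x∈l)

    externalPathLength : Tree ⊤ A → ℕ
    externalPathLength (leaf _)     = 0
    externalPathLength (node l _ r) = #leaves l + #leaves r + (externalPathLength l + externalPathLength r)

    private
      j<2^j : ∀ j → j < 2 ^ j
      j<2^j ℕ.zero    = s≤s z≤n
      j<2^j (ℕ.suc j) = begin-strict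
        ℕ.suc j              ≤⟨ j<2^j j ⟩
        2 ^ j                <⟨ ℕ.m<m+n (2 ^ j) (ℕ.≤-trans (ℕ.m^n>0 2 j) (ℕ.m≤m+n (2 ^ j) 0)) ⟩
        2 * 2 ^ j            ∎
        where open ℕ.≤-Reasoning

    -- A linear minorant of n log₂ n, where n = #leaves t, with equality at n = 2 ^ j.
    externalPathLength-bound : ∀ j (t : Tree ⊤ A) → ℕ.suc j * #leaves t ≤ externalPathLength t + 2 ^ j
    externalPathLength-bound j (leaf x) = begin
      ℕ.suc j * 1 ≡⟨ ℕ.*-identityʳ (ℕ.suc j) ⟩
      ℕ.suc j     ≤⟨ j<2^j j ⟩
      2 ^ j       ∎
      where open ℕ.≤-Reasoning
    externalPathLength-bound ℕ.zero (node l _ r) = begin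
      #leaves l + #leaves r + 0                                      ≤⟨ ℕ.+-monoʳ-≤ (#leaves l + #leaves r) z≤n ⟩
      #leaves l + #leaves r + (externalPathLength l + externalPathLength r)          ≤⟨ ℕ.m≤m+n _ 1 ⟩
      #leaves l + #leaves r + (externalPathLength l + externalPathLength r) + 1      ∎
      where open ℕ.≤-Reasoning
    externalPathLength-bound (ℕ.suc j) (node l _ r) = begin
      (1 + ℕ.suc j) * (a + b)
        ≡⟨ ℕS.solve 3 (λ a b j → (con 1 :+ j) :* (a :+ b) := a :+ b :+ (j :* a :+ j :* b)) refl a b (ℕ.suc j) ⟩
      a + b + (ℕ.suc j * a + ℕ.suc j * b)
        ≤⟨ ℕ.+-monoʳ-≤ (a + b) (ℕ.+-mono-≤ (externalPathLength-bound j l) (externalPathLength-bound j r)) ⟩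
      a + b + (externalPathLength l + 2 ^ j + (externalPathLength r + 2 ^ j))
        ≡⟨ solve 5 (λ a b p q e → a :+ b :+ (p :+ e :+ (q :+ e)) := a :+ b :+ (p :+ q) :+ con 2 :* e)
             refl a b (externalPathLength l) (externalPathLength r) (2 ^ j) ⟩
      a + b + (externalPathLength l + externalPathLength r) + 2 * 2 ^ j  ∎
      where
      open ℕ.≤-Reasoning
      open ℕS
      a = #leaves l
      b = #leaves r

    unique-++ˡ : ∀ {xs ys : List A} → Unique (xs ++ ys) → Unique xs
    unique-++ˡ {[]}     u        = []
    unique-++ˡ {x ∷ xs} (px ∷ u) = All.tabulate (λ y∈ → All.lookup px (List.∈-++⁺ˡ y∈)) ∷ unique-++ˡ u

    unique-++ʳ : ∀ xs {ys : List A} → Unique (xs ++ ys) → Unique ys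
    unique-++ʳ []       u       = u
    unique-++ʳ (x ∷ xs) (_ ∷ u) = unique-++ʳ xs u

    unique-++-disjoint : ∀ {xs ys : List A} {v} → Unique (xs ++ ys) → v ∈ᴸ xs → v ∉ᴸ ys
    unique-++-disjoint {x ∷ xs} (px ∷ _) (here refl) v∈ys = All.lookup px (List.∈-++⁺ʳ xs v∈ys) refl
    unique-++-disjoint          (_ ∷ u)  (there v∈)  v∈ys = unique-++-disjoint u v∈ v∈ys

  unique-leaves : ∀ {n} (H : Hierarchy n) → Unique (leaves (Hierarchy.tree H))
  unique-leaves {n} H = PermSetoid.Unique-resp-↭ (setoid (Fin n)) (↭⇒↭ₛ (↭-sym (Hierarchy.leaves↭ H))) (Unique.allFin⁺ n)

  module _ {n : ℕ} where
    open DecMembership (Fin._≟_ {n}) using () renaming (_∈?_ to _∈ᴸ?_)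

    lcaSize : Fin n → Fin n → Tree ⊤ (Fin n) → ℕ
    lcaSize x y t = #leaves (lcaSubtree x y t)

    module _ {x y : Fin n} where

      bothIn-true : ∀ {t} → x ∈ᴸ leaves t → y ∈ᴸ leaves t → bothIn x y t ≡ true
      bothIn-true {t} x∈ y∈ = dec-true ((x ∈ᴸ? leaves t) ×-dec (y ∈ᴸ? leaves t)) (x∈ , y∈)

      bothIn-false : ∀ {t} → ¬ (x ∈ᴸ leaves t × y ∈ᴸ leaves t) → bothIn x y t ≡ false
      bothIn-false {t} ¬both = dec-false ((x ∈ᴸ? leaves t) ×-dec (y ∈ᴸ? leaves t)) ¬both

      lcaSize-left : ∀ {l r} → x ∈ᴸ leaves l → y ∈ᴸ leaves l → lcaSize x y (node l tt r) ≡ lcaSize x y l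
      lcaSize-left {l} x∈ y∈ rewrite bothIn-true {l} x∈ y∈ = refl

      lcaSize-right : ∀ {l r} → ¬ (x ∈ᴸ leaves l × y ∈ᴸ leaves l) → x ∈ᴸ leaves r → y ∈ᴸ leaves r →
                      lcaSize x y (node l tt r) ≡ lcaSize x y r
      lcaSize-right {l} {r} ¬l x∈ y∈ rewrite bothIn-false {l} ¬l | bothIn-true {r} x∈ y∈ = refl

      lcaSize-split : ∀ {l r} → ¬ (x ∈ᴸ leaves l × y ∈ᴸ leaves l) → ¬ (x ∈ᴸ leaves r × y ∈ᴸ leaves r) →
                      lcaSize x y (node l tt r) ≡ #leaves l + #leaves r
      lcaSize-split {l} {r} ¬l ¬r rewrite bothIn-false {l} ¬l | bothIn-false {r} ¬r = refl

      lcaSize≤ : ∀ t → lcaSize x y t ≤ #leaves t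
      lcaSize≤ (leaf _) = ℕ.≤-refl
      lcaSize≤ (node l _ r) with bothIn x y l | bothIn x y r
      ... | true  | _     = ℕ.≤-trans (lcaSize≤ l) (ℕ.m≤m+n _ _)
      ... | false | true  = ℕ.≤-trans (lcaSize≤ r) (ℕ.m≤n+m _ _)
      ... | false | false = ℕ.≤-refl

  sum-map-++ : ∀ {A : Set} (f : A → ℕ) xs ys →
               ListAction.sum (List.map f (xs ++ ys)) ≡ ListAction.sum (List.map f xs) + ListAction.sum (List.map f ys)
  sum-map-++ f xs ys = trans (cong ListAction.sum (List.map-++ f xs ys)) (ListAction.sum-++ (List.map f xs) (List.map f ys))

  sum-map-allFin : ∀ {n} (f : Fin n → ℕ) → ListAction.sum (List.map f (allFin n)) ≡ sum f
  sum-map-allFin f = trans (cong ListAction.sum (List.map-tabulate id f)) (sum-tabulate f)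
    where
    sum-tabulate : ∀ {n} (f : Fin n → ℕ) → ListAction.sum (List.tabulate f) ≡ sum f
    sum-tabulate {ℕ.zero}  f = refl
    sum-tabulate {ℕ.suc n} f = cong (f zero +_) (sum-tabulate (f ∘ suc))

  sum-map-mono : ∀ {A : Set} {f g : A → ℕ} xs → (∀ {v} → v ∈ᴸ xs → f v ≤ g v) →
                 ListAction.sum (List.map f xs) ≤ ListAction.sum (List.map g xs)
  sum-map-mono []       f≤g = z≤n
  sum-map-mono (x ∷ xs) f≤g = ℕ.+-mono-≤ (f≤g (here refl)) (sum-map-mono xs (f≤g ∘ there))

  sum-map-mono-gap : ∀ {A : Set} {f g : A → ℕ} {xs w} b → (∀ {v} → v ∈ᴸ xs → f v ≤ g v) → w ∈ᴸ xs → b + f w ≤ g w →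
                     b + ListAction.sum (List.map f xs) ≤ ListAction.sum (List.map g xs)
  sum-map-mono-gap {f = f} {g} {x ∷ xs} b f≤g (here refl) gap = begin
    b + (f x + ListAction.sum (List.map f xs))  ≡⟨ ℕ.+-assoc b (f x) _ ⟨
    b + f x + ListAction.sum (List.map f xs)    ≤⟨ ℕ.+-mono-≤ gap (sum-map-mono xs (f≤g ∘ there)) ⟩
    g x + ListAction.sum (List.map g xs)        ∎
    where open ℕ.≤-Reasoning
  sum-map-mono-gap {f = f} {g} {x ∷ xs} b f≤g (there w∈) gap = begin
    b + (f x + ListAction.sum (List.map f xs))  ≡⟨ ℕS.solve 3 (λ b x s → b :+ (x :+ s) := x :+ (b :+ s)) refl b (f x) _ ⟩
    f x + (b + ListAction.sum (List.map f xs))  ≤⟨ ℕ.+-mono-≤ (f≤g (here refl)) (sum-map-mono-gap b (f≤g ∘ there) w∈ gap) ⟩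
    g x + ListAction.sum (List.map g xs)        ∎
    where
    open ℕ.≤-Reasoning
    open ℕS

  module HierarchyBound {m : ℕ} (par : Fin m → Fin (ℕ.suc m)) (par≤ : ∀ i → toℕ (par i) ≤ toℕ i) where
    open DecMembership (Fin._≟_ {ℕ.suc m}) using () renaming (_∈?_ to _∈ᴸ?_)

    treeCost : Tree ⊤ (Fin (ℕ.suc m)) → ℕ
    treeCost t = sum λ i → lcaSize (par i) (suc i) t ∸ 1

    -- If suc i or its parent is not a leaf of t, then lcaSubtree returns t itself, so the charge is #leaves t ∸ 1.
    charge : Tree ⊤ (Fin (ℕ.suc m)) → Fin (ℕ.suc m) → ℕ
    charge t zero    = #leaves t ∸ 1
    charge t (suc i) = lcaSize (par i) (suc i) t ∸ 1

    totalCharge : Tree ⊤ (Fin (ℕ.suc m)) → ℕ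
    totalCharge t = ListAction.sum (List.map (charge t) (leaves t))

    Orphan : Tree ⊤ (Fin (ℕ.suc m)) → Fin (ℕ.suc m) → Set
    Orphan t v = ∀ i → v ≡ suc i → par i ∉ᴸ leaves t

    orphan : ∀ t → ∃ λ v → v ∈ᴸ leaves t × Orphan t v
    orphan t = let v , v∈ = some-leaf t in climb _ v ℕ.≤-refl v∈
      where
      climb : ∀ k v → toℕ v < k → v ∈ᴸ leaves t → ∃ λ v → v ∈ᴸ leaves t × Orphan t v
      climb k         zero    _         v∈ = zero , v∈ , λ _ ()
      climb (ℕ.suc k) (suc i) (s≤s i<k) v∈ with par i ∈ᴸ? leaves t
      ... | yes p∈ = climb k (par i) (ℕ.≤-<-trans (par≤ i) i<k) p∈
      ... | no  p∉ = suc i , v∈ , λ { .i refl → p∉ }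

    charge≤ : ∀ t v → charge t v ≤ #leaves t ∸ 1
    charge≤ t zero    = ℕ.≤-refl
    charge≤ t (suc i) = ℕ.∸-monoˡ-≤ 1 (lcaSize≤ t)

    Outside : Tree ⊤ (Fin (ℕ.suc m)) → Fin (ℕ.suc m) → Set
    Outside t v = ∀ i → v ≡ suc i → ¬ (par i ∈ᴸ leaves t × v ∈ᴸ leaves t)

    charge-split : ∀ l r v → Outside l v → Outside r v → charge (node l tt r) v ≡ #leaves l + #leaves r ∸ 1
    charge-split l r zero    _  _  = refl
    charge-split l r (suc i) ¬l ¬r = cong (_∸ 1) (lcaSize-split {l = l} {r} (¬l i refl) (¬r i refl))

    -- The set of leaves of l contains a vertex whose parent lies outside it; merging l with r raises the
    -- charge of that vertex by #leaves r, and symmetrically.  This pays for the size of the new node.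
    externalPathLength≤totalCharge : ∀ t → Unique (leaves t) → externalPathLength t ≤ totalCharge t
    externalPathLength≤totalCharge (leaf _) _ = z≤n
    externalPathLength≤totalCharge t@(node l _ r) u = begin
      #leaves l + #leaves r + (externalPathLength l + externalPathLength r)
        ≤⟨ ℕ.+-monoʳ-≤ (#leaves l + #leaves r)
             (ℕ.+-mono-≤ (externalPathLength≤totalCharge l (unique-++ˡ u′)) (externalPathLength≤totalCharge r (unique-++ʳ (leaves l) u′))) ⟩
      #leaves l + #leaves r + (totalCharge l + totalCharge r)
        ≡⟨ ℕS.solve 4 (λ a b p q → a :+ b :+ (p :+ q) := (b :+ p) :+ (a :+ q)) refl (#leaves l) (#leaves r) (totalCharge l) (totalCharge r) ⟩
      (#leaves r + totalCharge l) + (#leaves l + totalCharge r)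
        ≤⟨ ℕ.+-mono-≤ (sum-map-mono-gap (#leaves r) mono-l (proj₁ (proj₂ (orphan l))) gap-l)
                      (sum-map-mono-gap (#leaves l) mono-r (proj₁ (proj₂ (orphan r))) gap-r) ⟩
      ListAction.sum (List.map (charge t) (leaves l)) + ListAction.sum (List.map (charge t) (leaves r))
        ≡⟨ sum-map-++ (charge t) (leaves l) (leaves r) ⟨
      ListAction.sum (List.map (charge t) (leaves l ++ leaves r))
        ≡⟨ cong (ListAction.sum ∘ List.map (charge t)) (leaves-node l r) ⟨
      totalCharge t ∎
      where
      open ℕ.≤-Reasoning
      open ℕS using (_:+_; _:=_)
      u′ : Unique (leaves l ++ leaves r)
      u′ = subst Unique (leaves-node l r) u

      in-l⇒outside-r : ∀ {v} → v ∈ᴸ leaves l → Outside r v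
      in-l⇒outside-r v∈l _ _ (_ , v∈r) = unique-++-disjoint u′ v∈l v∈r
      in-r⇒outside-l : ∀ {v} → v ∈ᴸ leaves r → Outside l v
      in-r⇒outside-l v∈r _ _ (_ , v∈l) = unique-++-disjoint u′ v∈l v∈r
      orphan⇒outside : ∀ s {v} → Orphan s v → Outside s v
      orphan⇒outside _ o i eq (p∈ , _) = o i eq p∈

      gap : ∀ a b {c} → 0 < b → c ≤ b ∸ 1 → a + c ≤ b + a ∸ 1
      gap a (ℕ.suc b) {c} _ c≤b = subst (a + c ≤_) (ℕ.+-comm a b) (ℕ.+-monoʳ-≤ a c≤b)

      gap-l : #leaves r + charge l (proj₁ (orphan l)) ≤ charge t (proj₁ (orphan l))
      gap-l with orphan l
      ... | v , v∈l , o = subst (_ ≤_) (sym (charge-split l r v (orphan⇒outside l o) (in-l⇒outside-r v∈l)))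
                            (gap (#leaves r) (#leaves l) (#leaves>0 l) (charge≤ l v))
      gap-r : #leaves l + charge r (proj₁ (orphan r)) ≤ charge t (proj₁ (orphan r))
      gap-r with orphan r
      ... | v , v∈r , o = subst (_ ≤_) (trans (cong (_∸ 1) (ℕ.+-comm (#leaves r) (#leaves l)))
                                              (sym (charge-split l r v (in-r⇒outside-l v∈r) (orphan⇒outside r o))))
                            (gap (#leaves l) (#leaves r) (#leaves>0 r) (charge≤ r v))

      mono-l : ∀ {v} → v ∈ᴸ leaves l → charge l v ≤ charge t v
      mono-l {zero} v∈ = ℕ.∸-monoˡ-≤ 1 (ℕ.m≤m+n (#leaves l) (#leaves r))
      mono-l {v@(suc i)} v∈ = case par i ∈ᴸ? leaves l of λ where
        (yes p∈) → ℕ.≤-reflexive (cong (_∸ 1) (sym (lcaSize-left {l = l} {r} p∈ v∈)))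
        (no p∉) → begin
          charge l v                      ≤⟨ charge≤ l v ⟩
          #leaves l ∸ 1                   ≤⟨ ℕ.∸-monoˡ-≤ 1 (ℕ.m≤m+n (#leaves l) (#leaves r)) ⟩
          #leaves l + #leaves r ∸ 1       ≡⟨ charge-split l r v (λ { _ refl (p∈ , _) → p∉ p∈ }) (in-l⇒outside-r v∈) ⟨
          charge t v                      ∎

      mono-r : ∀ {v} → v ∈ᴸ leaves r → charge r v ≤ charge t v
      mono-r {zero} v∈ = ℕ.∸-monoˡ-≤ 1 (ℕ.m≤n+m (#leaves r) (#leaves l))
      mono-r {v@(suc i)} v∈ = case par i ∈ᴸ? leaves r of λ where
        (yes p∈) → ℕ.≤-reflexive (cong (_∸ 1) (sym (lcaSize-right {l = l} {r} (in-r⇒outside-l v∈ i refl) p∈ v∈)))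
        (no p∉) → begin
          charge r v                      ≤⟨ charge≤ r v ⟩
          #leaves r ∸ 1                   ≤⟨ ℕ.∸-monoˡ-≤ 1 (ℕ.m≤n+m (#leaves r) (#leaves l)) ⟩
          #leaves l + #leaves r ∸ 1       ≡⟨ charge-split l r v (in-r⇒outside-l v∈) (λ { _ refl (p∈ , _) → p∉ p∈ }) ⟨
          charge t v                      ∎

    treeCost-bound : ∀ (H : Hierarchy (ℕ.suc m)) j →
                     ℕ.suc j * ℕ.suc m ≤ m + treeCost (Hierarchy.tree H) + 2 ^ j
    treeCost-bound H j = begin
      ℕ.suc j * ℕ.suc m            ≡⟨ cong (ℕ.suc j *_) size ⟨
      ℕ.suc j * #leaves t          ≤⟨ externalPathLength-bound j t ⟩
      externalPathLength t + 2 ^ j         ≤⟨ ℕ.+-monoˡ-≤ (2 ^ j) (externalPathLength≤totalCharge t (unique-leaves H)) ⟩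
      totalCharge t + 2 ^ j        ≡⟨ cong (_+ 2 ^ j) total ⟩
      m + treeCost t + 2 ^ j       ∎
      where
      open ℕ.≤-Reasoning
      t = Hierarchy.tree H
      size : #leaves t ≡ ℕ.suc m
      size = trans (sym (length-leaves t)) (trans (Perm.↭-length (Hierarchy.leaves↭ H)) (List.length-tabulate id))
      total : totalCharge t ≡ m + treeCost t
      total = trans (ListAction.sum-↭ (Perm.map⁺ (charge t) (Hierarchy.leaves↭ H)))
                (trans (sum-map-allFin (charge t)) (cong (λ k → k ∸ 1 + treeCost t) size))

  least : {P : ℕ → Set} → (∀ k → Dec (P k)) → ∀ k → P k → ∃ λ k → P k × (∀ j → P j → k ≤ j)
  least P? ℕ.zero    p0 = 0 , p0 , λ _ _ → z≤n
  least P? (ℕ.suc k) pk with P? 0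
  ... | yes p0 = 0 , p0 , λ _ _ → z≤n
  ... | no ¬p0 with least (P? ∘ ℕ.suc) k pk
  ...   | l , pl , min = ℕ.suc l , pl , λ { ℕ.zero p0 → ⊥-elim (¬p0 p0) ; (ℕ.suc j) pj → s≤s (min j pj) }

  minimum : {A : Set} {P : A → Set} (f : A → ℕ) → (∀ k → Dec (∃ λ a → P a × f a ≡ k)) → ∃ P →
            ∃ λ a → P a × (∀ b → P b → f a ≤ f b)
  minimum f attained? (a , pa) with least attained? (f a) (a , pa , refl)
  ... | _ , (b , pb , refl) , min = b , pb , λ c pc → min (f c) (c , pc , refl)

  module Distance {n : ℕ} (G : Graph n) (conn : Connected G) where
    open Graph G

    walk? : ∀ k x y → Dec (∃ λ (w : Star _~_ x y) → walkLength G w ≡ k)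
    walk? ℕ.zero x y = map′ (λ { refl → ε , refl }) (λ { (ε , _) → refl }) (x Fin.≟ y)
    walk? (ℕ.suc k) x y =
      map′ (λ (_ , e , w , eq) → e ◅ w , cong ℕ.suc eq) (λ { (e ◅ w , eq) → _ , e , w , ℕ.suc-injective eq })
           (Fin.any? λ z → (x ~? z) ×-dec walk? k z y)

    distance : ∀ x y → ∃ (IsDistance G x y)
    distance x y with least (λ k → walk? k x y) _ (conn x y , refl)
    ... | d , (w , eq) , min = d , (w , tt , eq) , λ w′ _ → min _ (w′ , refl)

    dist : Fin n → Fin n → ℕ
    dist x y = proj₁ (distance x y)

    dist≤ : ∀ {x y} (w : Star _~_ x y) → dist x y ≤ walkLength G w
    dist≤ {x} {y} w = proj₂ (proj₂ (distance x y)) w tt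

    walkLength≡0⇒≡ : ∀ {x y} (w : Star _~_ x y) → walkLength G w ≡ 0 → x ≡ y
    walkLength≡0⇒≡ ε _ = refl

    dist≡0⇒≡ : ∀ {x y} → dist x y ≡ 0 → x ≡ y
    dist≡0⇒≡ {x} {y} eq = let (w , _ , eq′) , _ = proj₂ (distance x y) in walkLength≡0⇒≡ w (trans eq′ eq)

    distance-unique : ∀ {x y d} → IsDistance G x y d → d ≡ dist x y
    distance-unique {x} {y} {d} ((w , _ , eq) , min) =
      let (w′ , _ , eq′) , _ = proj₂ (distance x y) in
      ℕ.≤-antisym (subst (d ≤_) eq′ (min w′ tt)) (subst (dist x y ≤_) eq (dist≤ w))

  module _ {n : ℕ} where
    open DecMembership (Fin._≟_ {n}) using () renaming (_∈?_ to _∈ᴸ?_)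

    _↭?_ : (xs ys : List (Fin n)) → Dec (xs ↭ ys)
    []       ↭? []      = yes Perm.refl
    []       ↭? (y ∷ _) = no λ p → case Perm.↭-length p of λ ()
    (x ∷ xs) ↭? ys with x ∈ᴸ? ys
    ... | no  x∉ys = no λ p → x∉ys (Perm.∈-resp-↭ p (here refl))
    ... | yes x∈ys with List.∈-∃++ x∈ys
    ...   | as , bs , refl = map′ (λ p → Perm.trans (Perm.prep x p) (↭-sym (Perm.shift x as bs)))
                                  (λ p → Perm.drop-∷ (Perm.trans p (Perm.shift x as bs)))
                                  (xs ↭? (as ++ bs))

    smallTrees : ℕ → List (Tree ⊤ (Fin n))
    smallTrees ℕ.zero    = []
    smallTrees (ℕ.suc k) = List.map leaf (allFin n) ++
                           List.cartesianProductWith (λ l r → node l tt r) (smallTrees k) (smallTrees k)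

    ∈-smallTrees : ∀ k t → #leaves t ≤ k → t ∈ᴸ smallTrees k
    ∈-smallTrees ℕ.zero    t            t≤0 = ⊥-elim (ℕ.<⇒≱ (#leaves>0 t) t≤0)
    ∈-smallTrees (ℕ.suc k) (leaf x)     _   = List.∈-++⁺ˡ (List.∈-map⁺ leaf (List.∈-allFin x))
    ∈-smallTrees (ℕ.suc k) (node l _ r) t≤k = List.∈-++⁺ʳ (List.map leaf (allFin n))
      (List.∈-cartesianProductWith⁺ (λ l r → node l tt r) (∈-smallTrees k l l≤k) (∈-smallTrees k r r≤k))
      where
      l≤k : #leaves l ≤ k
      l≤k = ℕ.s≤s⁻¹ (ℕ.<-≤-trans (ℕ.m<m+n (#leaves l) (#leaves>0 r)) t≤k)
      r≤k : #leaves r ≤ k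
      r≤k = ℕ.s≤s⁻¹ (ℕ.<-≤-trans (ℕ.m<n+m (#leaves r) (#leaves>0 l)) t≤k)

    treeHeight : Tree ⊤ (Fin n) → Fin n → Fin n → ℕ
    treeHeight t x y = if does (x Fin.≟ y) then 0 else lcaSize x y t ∸ 1

    infix 4 _≤₂_ _≤₂?_

    _≤₂_ : (f g : Fin n → Fin n → ℕ) → Set
    f ≤₂ g = ∀ x y → f x y ≤ g x y

    _≤₂?_ : ∀ f g → Dec (f ≤₂ g)
    f ≤₂? g = Fin.all? λ x → Fin.all? λ y → f x y ℕ.≤? g x y

    optimal-hierarchy : (d : Fin n → Fin n → ℕ) (f : Tree ⊤ (Fin n) → ℕ) →
                        (∃ λ (H : Hierarchy n) → d ≤₂ height H) →
                        ∃ λ (H : Hierarchy n) → d ≤₂ height H ×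
                          (∀ H′ → d ≤₂ height H′ → f (Hierarchy.tree H) ≤ f (Hierarchy.tree H′))
    optimal-hierarchy d f (H₀ , feasible₀)
      with minimum {P = Feasible} f attained? (Hierarchy.tree H₀ , Hierarchy.leaves↭ H₀ , feasible₀)
      where
      Feasible : Tree ⊤ (Fin n) → Set
      Feasible t = leaves t ↭ allFin n × d ≤₂ treeHeight t
      attained? : ∀ k → Dec (∃ λ t → Feasible t × f t ≡ k)
      attained? k = map′ Any.satisfied
        (λ { (t , p@((t↭ , _) , _)) → lose (∈-smallTrees n t (ℕ.≤-reflexive (size t t↭))) p })
        (Any.any? (λ t → ((leaves t ↭? allFin n) ×-dec (d ≤₂? treeHeight t)) ×-dec (f t ℕ.≟ k)) (smallTrees n))
        where
        size : ∀ t → leaves t ↭ allFin n → #leaves t ≡ n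
        size t t↭ = trans (sym (length-leaves t)) (trans (Perm.↭-length t↭) (List.length-tabulate id))
    ... | t , (t↭ , feasible) , min =
      record { tree = t ; leaves↭ = t↭ } , feasible , λ H′ feasible′ → min _ (Hierarchy.leaves↭ H′ , feasible′)

    record IsNatUltrametric (u : Fin n → Fin n → ℕ) : Set where
      field
        diagonal : ∀ x → u x x ≡ 0
        definite : ∀ x y → u x y ≡ 0 → x ≡ y
        symm     : ∀ x y → u x y ≡ u y x
        ultra    : ∀ x y z → u x z ≤ u x y ⊔ u y z

    isNatUltrametric? : ∀ u → Dec (IsNatUltrametric u)
    isNatUltrametric? u =
      map′ (λ (a , b , c , d) → record { diagonal = a ; definite = b ; symm = c ; ultra = d })
           (λ U → let open IsNatUltrametric U in diagonal , definite , symm , ultra)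
           ((Fin.all? λ x → u x x ℕ.≟ 0) ×-dec
            (Fin.all? λ x → Fin.all? λ y → (u x y ℕ.≟ 0) →-dec (x Fin.≟ y)) ×-dec
            (Fin.all? λ x → Fin.all? λ y → u x y ℕ.≟ u y x) ×-dec
            (Fin.all? λ x → Fin.all? λ y → Fin.all? λ z → u x z ℕ.≤? u x y ⊔ u y z))

    module _ {u v : Fin n → Fin n → ℕ} (u≗v : ∀ x y → u x y ≡ v x y) where

      isNatUltrametric-resp : IsNatUltrametric u → IsNatUltrametric v
      isNatUltrametric-resp U = record
        { diagonal = λ x → trans (sym (u≗v x x)) (diagonal x)
        ; definite = λ x y v≡0 → definite x y (trans (u≗v x y) v≡0)
        ; symm     = λ x y → trans (sym (u≗v x y)) (trans (symm x y) (u≗v y x))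
        ; ultra    = λ x y z → subst₂ _≤_ (u≗v x z) (cong₂ _⊔_ (u≗v x y) (u≗v y z)) (ultra x y z)
        }
        where open IsNatUltrametric U

    -- Functions bounded by b are coded by the elements of a finite set.
    decode : ∀ {b} → Fin ((ℕ.suc b ^ n) ^ n) → Fin n → Fin n → ℕ
    decode {b} c x y = toℕ (Fin.finToFun {ℕ.suc b} {n} (Fin.finToFun {ℕ.suc b ^ n} {n} c x) y)

    decode-surjective : ∀ {b} (u : Fin n → Fin n → ℕ) → (∀ x y → u x y ≤ b) → ∃ λ c → ∀ x y → decode {b} c x y ≡ u x y
    decode-surjective {b} u u≤b = Fin.funToFin (λ x → Fin.funToFin (g x)) , λ x y → begin
      toℕ (Fin.finToFun {ℕ.suc b} {n} (Fin.finToFun {ℕ.suc b ^ n} {n} (Fin.funToFin (λ x → Fin.funToFin (g x))) x) y)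
        ≡⟨ cong (λ r → toℕ (Fin.finToFun {ℕ.suc b} {n} r y)) (Fin.finToFun-funToFin (λ x → Fin.funToFin (g x)) x) ⟩
      toℕ (Fin.finToFun {ℕ.suc b} {n} (Fin.funToFin (g x)) y) ≡⟨ cong toℕ (Fin.finToFun-funToFin (g x) y) ⟩
      toℕ (g x y)                                   ≡⟨ Fin.toℕ-fromℕ< _ ⟩
      u x y                                         ∎
      where
      open ≡-Reasoning
      g : Fin n → Fin n → Fin (ℕ.suc b)
      g x y = Fin.fromℕ< (s≤s (u≤b x y))

    module _ (d : Fin n → Fin n → ℕ) (b : ℕ) (f : (Fin n → Fin n → ℕ) → ℕ) (f-cong : ∀ {u v} → (∀ x y → u x y ≡ v x y) → f u ≡ f v) where

      optimal-ultrametric : (∃ λ u → (∀ x y → u x y ≤ b) × IsNatUltrametric u × d ≤₂ u) →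
                            ∃ λ u → IsNatUltrametric u × d ≤₂ u ×
                              (∀ v → (∀ x y → v x y ≤ b) → IsNatUltrametric v → d ≤₂ v → f u ≤ f v)
      optimal-ultrametric (u₀ , u₀≤b , U₀ , d≤u₀)
        with decode-surjective u₀ u₀≤b
      ... | c₀ , eq₀
        with minimum {P = Feasible} (f ∘ decode {b}) attained? (c₀ , feasible eq₀ U₀ d≤u₀)
        where
        Feasible : Fin ((ℕ.suc b ^ n) ^ n) → Set
        Feasible c = IsNatUltrametric (decode c) × d ≤₂ decode c
        feasible : ∀ {c v} → (∀ x y → decode c x y ≡ v x y) → IsNatUltrametric v → d ≤₂ v → Feasible c
        feasible eq V d≤v = isNatUltrametric-resp (λ x y → sym (eq x y)) V ,
                            λ x y → subst (d x y ≤_) (sym (eq x y)) (d≤v x y)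
        attained? : ∀ k → Dec (∃ λ c → Feasible c × f (decode c) ≡ k)
        attained? k = Fin.any? λ c → (isNatUltrametric? (decode c) ×-dec (d ≤₂? decode c)) ×-dec (f (decode c) ℕ.≟ k)
      ... | c , (U , d≤u) , min = decode c , U , d≤u , λ v v≤b V d≤v →
        let c′ , eq = decode-surjective v v≤b in
        subst (f (decode c) ≤_) (f-cong eq)
          (min c′ (isNatUltrametric-resp (λ x y → sym (eq x y)) V , λ x y → subst (d x y ≤_) (sym (eq x y)) (d≤v x y)))

  module _ {n} (G : Graph n) where

    maxDegree-least : ∀ {k} → (∀ x → degree G x ≤ k) → maxDegree G ≤ k
    maxDegree-least deg≤k = Extrema.max≤v⁺ z≤n (All.map⁺ (All.universal deg≤k (allFin n)))

    maxDegree-attained : ∀ {k} → (∀ x → degree G x ≤ k) → ∀ x → degree G x ≡ k → maxDegree G ≡ k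
    maxDegree-attained deg≤k x refl = ℕ.≤-antisym (maxDegree-least deg≤k)
      (Extrema.v≤max⁺ 0 (List.map (degree G) (allFin n)) (inj₂ (Any.map⁺ (lose (List.∈-allFin x) ℕ.≤-refl))))

  module CompleteBinaryTree where

    -- In the tree of height h, vertex zero is the root; the left subtree is numbered before the right one.
    #edges : ℕ → ℕ
    #edges ℕ.zero    = 0
    #edges (ℕ.suc h) = ℕ.suc (#edges h) + ℕ.suc (#edges h)

    #vertices : ℕ → ℕ
    #vertices h = ℕ.suc (#edges h)

    Vertex : ℕ → Set
    Vertex h = Fin (#vertices h)

    L R : ∀ h → Vertex h → Vertex (ℕ.suc h)
    L h x = suc (x ↑ˡ #vertices h)
    R h x = suc (#vertices h ↑ʳ x)

    data View h : Vertex (ℕ.suc h) → Set where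
      root  : View h zero
      left  : ∀ x → View h (L h x)
      right : ∀ x → View h (R h x)

    view : ∀ h (x : Vertex (ℕ.suc h)) → View h x
    view h zero = root
    view h (suc i) with Fin.splitAt (#vertices h) i in eq
    ... | inj₁ x = subst (View h) (cong suc (Fin.splitAt⁻¹-↑ˡ eq)) (left x)
    ... | inj₂ y = subst (View h) (cong suc (Fin.splitAt⁻¹-↑ʳ eq)) (right y)

    L-injective : ∀ h {x y : Vertex h} → L h x ≡ L h y → x ≡ y
    L-injective h = Fin.↑ˡ-injective (#vertices h) _ _ ∘ Fin.suc-injective

    R-injective : ∀ h {x y : Vertex h} → R h x ≡ R h y → x ≡ y
    R-injective h = Fin.↑ʳ-injective (#vertices h) _ _ ∘ Fin.suc-injective

    L≢R : ∀ h {x y : Vertex h} → L h x ≢ R h y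
    L≢R h {x} {y} eq = case trans (sym (Fin.splitAt-↑ˡ (#vertices h) x (#vertices h)))
                           (trans (cong (Fin.splitAt (#vertices h)) (Fin.suc-injective eq)) (Fin.splitAt-↑ʳ (#vertices h) (#vertices h) y)) of λ ()

    parent  : ∀ h → Fin (#edges h) → Vertex h
    parent′ : ∀ h → (Vertex h → Vertex (ℕ.suc h)) → Vertex h → Vertex (ℕ.suc h)
    parent (ℕ.suc h) i = Sum.[ parent′ h (L h) , parent′ h (R h) ]′ (Fin.splitAt (#vertices h) i)
    parent′ h f zero    = zero
    parent′ h f (suc j) = f (parent h j)

    parent-L : ∀ h x → parent (ℕ.suc h) (x ↑ˡ #vertices h) ≡ parent′ h (L h) x
    parent-L h x = cong Sum.[ parent′ h (L h) , parent′ h (R h) ]′ (Fin.splitAt-↑ˡ (#vertices h) x (#vertices h))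

    parent-R : ∀ h x → parent (ℕ.suc h) (#vertices h ↑ʳ x) ≡ parent′ h (R h) x
    parent-R h x = cong Sum.[ parent′ h (L h) , parent′ h (R h) ]′ (Fin.splitAt-↑ʳ (#vertices h) (#vertices h) x)

    parent≤ : ∀ h i → toℕ (parent h i) ≤ toℕ i
    parent≤ (ℕ.suc h) i with view h (suc i)
    ... | left zero = z≤n
    ... | left (suc j) rewrite Fin.toℕ-↑ˡ j (#vertices h) | parent-L h (suc j) | Fin.toℕ-↑ˡ (parent h j) (#vertices h) = s≤s (parent≤ h j)
    ... | right zero rewrite parent-R h zero = z≤n
    ... | right (suc j) rewrite Fin.toℕ-↑ʳ (#vertices h) (suc j) | parent-R h (suc j) | Fin.toℕ-↑ʳ (#vertices h) (parent h j) =
      subst (_≤ #vertices h + ℕ.suc (toℕ j)) (ℕ.+-suc (#vertices h) (toℕ (parent h j))) (ℕ.+-monoʳ-≤ (#vertices h) (s≤s (parent≤ h j)))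

    module Rooted h = RootedTree (parent h) (parent≤ h)

    edgeSum : ∀ h → (Vertex h → Vertex h → ℕ) → ℕ
    edgeSum h f = sum λ i → f (parent h i) (suc i)

    edgeSum-suc : ∀ h f → edgeSum (ℕ.suc h) f ≡
                  (f zero (L h zero) + edgeSum h (λ x y → f (L h x) (L h y))) + (f zero (R h zero) + edgeSum h (λ x y → f (R h x) (R h y)))
    edgeSum-suc h f = trans (sum-↑ (#vertices h) (λ i → f (parent (ℕ.suc h) i) (suc i))) (cong₂ _+_
      (cong₂ _+_ (cong (λ p → f p (L h zero)) (parent-L h zero)) (sum-cong-≗ λ j → cong (λ p → f p (L h (suc j))) (parent-L h (suc j))))
      (cong₂ _+_ (cong (λ p → f p (R h zero)) (parent-R h zero)) (sum-cong-≗ λ j → cong (λ p → f p (R h (suc j))) (parent-R h (suc j)))))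

    edgeSum-cong : ∀ h {f g : Vertex h → Vertex h → ℕ} → (∀ x y → f x y ≡ g x y) → edgeSum h f ≡ edgeSum h g
    edgeSum-cong h f≗g = sum-cong-≗ λ i → f≗g (parent h i) (suc i)

    2+#edges : ∀ h → 2 + #edges h ≡ 2 * 2 ^ h
    2+#edges ℕ.zero = refl
    2+#edges (ℕ.suc h) = begin
      2 + (ℕ.suc e + ℕ.suc e)  ≡⟨ ℕS.solve 1 (λ e → con 2 :+ (con 1 :+ e :+ (con 1 :+ e)) := con 2 :* (con 2 :+ e)) refl e ⟩
      2 * (2 + e)              ≡⟨ cong (2 *_) (2+#edges h) ⟩
      2 * (2 * 2 ^ h)          ∎
      where
      open ≡-Reasoning
      open ℕS
      e = #edges h

    h≤#edges : ∀ h → h ≤ #edges h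
    h≤#edges ℕ.zero    = z≤n
    h≤#edges (ℕ.suc h) = s≤s (ℕ.m≤n⇒m≤n+o _ (h≤#edges h))

    2h≤#edges : ∀ h → 2 * h ≤ #edges h
    2h≤#edges ℕ.zero    = z≤n
    2h≤#edges (ℕ.suc h) = ℕ.+-mono-≤ (s≤s (h≤#edges h)) (subst (_≤ #vertices h) (sym (ℕ.+-identityʳ (ℕ.suc h))) (s≤s (h≤#edges h)))

    childCount-root : ∀ h → Rooted.childCount (ℕ.suc h) zero ≡ 2
    childCount-root h = trans (edgeSum-suc h (λ p _ → 𝟙 (does (p Fin.≟ zero))))
      (cong₂ (λ a b → 1 + a + (1 + b)) (sum-zero {#edges h} λ _ → refl) (sum-zero {#edges h} λ _ → refl))

    childCount-L : ∀ h x → Rooted.childCount (ℕ.suc h) (L h x) ≡ Rooted.childCount h x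
    childCount-L h x = trans (edgeSum-suc h (λ p _ → 𝟙 (does (p Fin.≟ L h x)))) (trans (cong₂ _+_
      (edgeSum-cong h λ p _ → cong 𝟙 (does-⇔ (mk⇔ (L-injective h) (cong (L h))) (L h p Fin.≟ L h x) (p Fin.≟ x)))
      (sum-zero λ i → cong 𝟙 (dec-false (R h (parent h i) Fin.≟ L h x) (L≢R h ∘ sym))))
      (ℕ.+-identityʳ _))

    childCount-R : ∀ h x → Rooted.childCount (ℕ.suc h) (R h x) ≡ Rooted.childCount h x
    childCount-R h x = trans (edgeSum-suc h (λ p _ → 𝟙 (does (p Fin.≟ R h x)))) (cong₂ _+_
      (sum-zero λ i → cong 𝟙 (dec-false (L h (parent h i) Fin.≟ R h x) (L≢R h)))
      (edgeSum-cong h λ p _ → cong 𝟙 (does-⇔ (mk⇔ (R-injective h) (cong (R h))) (R h p Fin.≟ R h x) (p Fin.≟ x))))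

    childCount≤2 : ∀ h x → Rooted.childCount h x ≤ 2
    childCount≤2 ℕ.zero x = z≤n
    childCount≤2 (ℕ.suc h) x with view h x
    ... | root    = ℕ.≤-reflexive (childCount-root h)
    ... | left y  = subst (_≤ 2) (sym (childCount-L h y)) (childCount≤2 h y)
    ... | right y = subst (_≤ 2) (sym (childCount-R h y)) (childCount≤2 h y)

    degree≤3 : ∀ h x → degree (Rooted.graph h) x ≤ 3
    degree≤3 h x = subst (_≤ 3) (sym (Rooted.degree≡ h x)) (ℕ.+-mono-≤ (childCount≤2 h x) (𝟙≤1 (does (zero {n = #edges h} Fin.<? x))))
      where
      𝟙≤1 : ∀ b → 𝟙 b ≤ 1
      𝟙≤1 true  = ℕ.≤-refl
      𝟙≤1 false = z≤n

    maxDegree≤3 : ∀ h → maxDegree (Rooted.graph h) ≤ 3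
    maxDegree≤3 h = maxDegree-least (Rooted.graph h) (degree≤3 h)

    inner⇒maxDegree≡3 : ∀ h i → Rooted.childCount h (suc i) ≡ 2 → maxDegree (Rooted.graph h) ≡ 3
    inner⇒maxDegree≡3 h i two-children =
      maxDegree-attained (Rooted.graph h) (degree≤3 h) (suc i) (trans (Rooted.degree≡ h (suc i)) (cong (_+ 1) two-children))

    L⇒maxDegree≡3 : ∀ h x → Rooted.childCount h x ≡ 2 → maxDegree (Rooted.graph (ℕ.suc h)) ≡ 3
    L⇒maxDegree≡3 h x two-children =
      inner⇒maxDegree≡3 (ℕ.suc h) (x ↑ˡ #vertices h) (trans (childCount-L h x) two-children)

    maxDegree≡3 : ∀ h → 2 ≤ h → maxDegree (Rooted.graph h) ≡ 3
    maxDegree≡3 (ℕ.suc ℕ.zero) (s≤s ())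
    maxDegree≡3 (ℕ.suc (ℕ.suc g)) _ = L⇒maxDegree≡3 (ℕ.suc g) zero (childCount-root g)

    -- Bounds the distance of x and y by way of a walk through their lowest common ancestor.
    δ : ∀ h → Vertex h → Vertex h → ℕ
    δ⊎ : ∀ h → Vertex h ⊎ Vertex h → Vertex h ⊎ Vertex h → ℕ
    δ ℕ.zero    _       _       = 0
    δ (ℕ.suc h) zero    zero    = 0
    δ (ℕ.suc h) zero    (suc _) = ℕ.suc h
    δ (ℕ.suc h) (suc _) zero    = ℕ.suc h
    δ (ℕ.suc h) (suc i) (suc j) = δ⊎ h (Fin.splitAt (#vertices h) i) (Fin.splitAt (#vertices h) j)
    δ⊎ h (inj₁ x) (inj₁ y) = δ h x y
    δ⊎ h (inj₂ x) (inj₂ y) = δ h x y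
    δ⊎ h _        _        = 2 * ℕ.suc h

    -- For x ≠ y, twice the height of the lowest common ancestor of x and y.
    υ : ∀ h → Vertex h → Vertex h → ℕ
    υ⊎ : ∀ h → Vertex h ⊎ Vertex h → Vertex h ⊎ Vertex h → ℕ
    υ ℕ.zero    _       _       = 0
    υ (ℕ.suc h) zero    zero    = 0
    υ (ℕ.suc h) zero    (suc _) = 2 * ℕ.suc h
    υ (ℕ.suc h) (suc _) zero    = 2 * ℕ.suc h
    υ (ℕ.suc h) (suc i) (suc j) = υ⊎ h (Fin.splitAt (#vertices h) i) (Fin.splitAt (#vertices h) j)
    υ⊎ h (inj₁ x) (inj₁ y) = υ h x y
    υ⊎ h (inj₂ x) (inj₂ y) = υ h x y
    υ⊎ h _        _        = 2 * ℕ.suc h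

    module _ (h : ℕ) (x y : Vertex h) where
      private
        v = #vertices h
        sˡ = λ z → Fin.splitAt-↑ˡ v z v
        sʳ = λ z → Fin.splitAt-↑ʳ v v z

      δ-LL : δ (ℕ.suc h) (L h x) (L h y) ≡ δ h x y
      δ-LL = cong₂ (δ⊎ h) (sˡ x) (sˡ y)
      δ-LR : δ (ℕ.suc h) (L h x) (R h y) ≡ 2 * ℕ.suc h
      δ-LR = cong₂ (δ⊎ h) (sˡ x) (sʳ y)
      δ-RL : δ (ℕ.suc h) (R h x) (L h y) ≡ 2 * ℕ.suc h
      δ-RL = cong₂ (δ⊎ h) (sʳ x) (sˡ y)
      δ-RR : δ (ℕ.suc h) (R h x) (R h y) ≡ δ h x y
      δ-RR = cong₂ (δ⊎ h) (sʳ x) (sʳ y)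

      υ-LL : υ (ℕ.suc h) (L h x) (L h y) ≡ υ h x y
      υ-LL = cong₂ (υ⊎ h) (sˡ x) (sˡ y)
      υ-LR : υ (ℕ.suc h) (L h x) (R h y) ≡ 2 * ℕ.suc h
      υ-LR = cong₂ (υ⊎ h) (sˡ x) (sʳ y)
      υ-RL : υ (ℕ.suc h) (R h x) (L h y) ≡ 2 * ℕ.suc h
      υ-RL = cong₂ (υ⊎ h) (sʳ x) (sˡ y)
      υ-RR : υ (ℕ.suc h) (R h x) (R h y) ≡ υ h x y
      υ-RR = cong₂ (υ⊎ h) (sʳ x) (sʳ y)

    Adj : ∀ h → Vertex h → Vertex h → Set
    Adj h = Graph._~_ (Rooted.graph h)

    Walk : ∀ h → Vertex h → Vertex h → Set
    Walk h = Star (Adj h)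

    length : ∀ h {x y} → Walk h x y → ℕ
    length h = walkLength (Rooted.graph h)

    length-◅◅ : ∀ h {x y z} (p : Walk h x y) (q : Walk h y z) → length h (p ◅◅ q) ≡ length h p + length h q
    length-◅◅ h ε       q = refl
    length-◅◅ h (_ ◅ p) q = cong ℕ.suc (length-◅◅ h p q)

    module _ (h : ℕ) (f : Vertex h → Vertex (ℕ.suc h)) (f-adj : ∀ {x y} → Adj h x y → Adj (ℕ.suc h) (f x) (f y)) where

      embed : ∀ {x y} → Walk h x y → Walk (ℕ.suc h) (f x) (f y)
      embed = Star.gmap f f-adj

      length-embed : ∀ {x y} (w : Walk h x y) → length (ℕ.suc h) (embed w) ≡ length h w
      length-embed ε       = refl
      length-embed (_ ◅ w) = cong ℕ.suc (length-embed w)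

      embed≤ : ∀ {x y k} → ∃ (λ (w : Walk h x y) → length h w ≤ k) → ∃ λ (w : Walk (ℕ.suc h) (f x) (f y)) → length (ℕ.suc h) w ≤ k
      embed≤ (w , w≤k) = embed w , subst (_≤ _) (sym (length-embed w)) w≤k

    module _ (h : ℕ) where
      open Rooted (ℕ.suc h) using (_◁_; edge)

      L-◁ : ∀ {x y} → Rooted._◁_ h x y → L h x ◁ L h y
      L-◁ (RootedTree.edge i) = subst (_◁ L h (suc i)) (parent-L h (suc i)) (edge (suc i ↑ˡ #vertices h))

      R-◁ : ∀ {x y} → Rooted._◁_ h x y → R h x ◁ R h y
      R-◁ (RootedTree.edge i) = subst (_◁ R h (suc i)) (parent-R h (suc i)) (edge (#vertices h ↑ʳ suc i))

      L-root : zero ◁ L h zero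
      L-root = subst (_◁ L h zero) (parent-L h zero) (edge (zero ↑ˡ #vertices h))

      R-root : zero ◁ R h zero
      R-root = subst (_◁ R h zero) (parent-R h zero) (edge (#vertices h ↑ʳ zero))

      L-adj : ∀ {x y} → Adj h x y → Adj (ℕ.suc h) (L h x) (L h y)
      L-adj = Sum.map L-◁ L-◁

      R-adj : ∀ {x y} → Adj h x y → Adj (ℕ.suc h) (R h x) (R h y)
      R-adj = Sum.map R-◁ R-◁

    ShortWalk : ∀ h → Vertex h → Vertex h → ℕ → Set
    ShortWalk h x y k = ∃ λ (w : Walk h x y) → length h w ≤ k

    from-root : ∀ h x → ShortWalk h zero x h
    from-root ℕ.zero    zero = ε , z≤n
    from-root (ℕ.suc h) x with view h x
    ... | root    = ε , z≤n
    ... | left y  = let w , w≤h = embed≤ h (L h) (L-adj h) (from-root h y) in inj₁ (L-root h) ◅ w , s≤s w≤h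
    ... | right y = let w , w≤h = embed≤ h (R h) (R-adj h) (from-root h y) in inj₁ (R-root h) ◅ w , s≤s w≤h

    append : ∀ h {x y z j k} → ShortWalk h x y j → ShortWalk h y z k → ShortWalk h x z (j + k)
    append h (p , p≤j) (q , q≤k) = p ◅◅ q , subst (_≤ _) (sym (length-◅◅ h p q)) (ℕ.+-mono-≤ p≤j q≤k)

    snoc : ∀ h {x y z k} → ShortWalk h x y k → Adj h y z → ShortWalk h x z (ℕ.suc k)
    snoc h {k = k} p e = subst (ShortWalk h _ _) (ℕ.+-comm k 1) (append h p (e ◅ ε , ℕ.≤-refl))

    to-root : ∀ h x → ShortWalk h x zero h
    to-root ℕ.zero    zero = ε , z≤n
    to-root (ℕ.suc h) x with view h x
    ... | root    = ε , z≤n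
    ... | left y  = snoc (ℕ.suc h) (embed≤ h (L h) (L-adj h) (to-root h y)) (inj₂ (L-root h))
    ... | right y = snoc (ℕ.suc h) (embed≤ h (R h) (R-adj h) (to-root h y)) (inj₂ (R-root h))

    walk : ∀ h x y → ShortWalk h x y (δ h x y)
    walk ℕ.zero    zero zero = ε , z≤n
    walk (ℕ.suc h) x y with view h x | view h y
    ... | root     | root     = ε , z≤n
    ... | root     | left y′  = from-root (ℕ.suc h) (L h y′)
    ... | root     | right y′ = from-root (ℕ.suc h) (R h y′)
    ... | left x′  | root     = to-root (ℕ.suc h) (L h x′)
    ... | right x′ | root     = to-root (ℕ.suc h) (R h x′)
    ... | left x′  | left y′  = subst (ShortWalk _ _ _) (sym (δ-LL h x′ y′)) (embed≤ h (L h) (L-adj h) (walk h x′ y′))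
    ... | right x′ | right y′ = subst (ShortWalk _ _ _) (sym (δ-RR h x′ y′)) (embed≤ h (R h) (R-adj h) (walk h x′ y′))
    ... | left x′  | right y′ = subst (ShortWalk _ _ _) (trans (cong (ℕ.suc h +_) (sym (ℕ.+-identityʳ _))) (sym (δ-LR h x′ y′)))
                                  (append (ℕ.suc h) (to-root (ℕ.suc h) (L h x′)) (from-root (ℕ.suc h) (R h y′)))
    ... | right x′ | left y′  = subst (ShortWalk _ _ _) (trans (cong (ℕ.suc h +_) (sym (ℕ.+-identityʳ _))) (sym (δ-RL h x′ y′)))
                                  (append (ℕ.suc h) (to-root (ℕ.suc h) (R h x′)) (from-root (ℕ.suc h) (L h y′)))

    module Dist h = Distance (Rooted.graph h) (Rooted.connected h)

    dist≤δ : ∀ h x y → Dist.dist h x y ≤ δ h x y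
    dist≤δ h x y = let w , w≤ = walk h x y in ℕ.≤-trans (Dist.dist≤ h w) w≤

    υ-diagonal : ∀ h x → υ h x x ≡ 0
    υ-diagonal ℕ.zero    x = refl
    υ-diagonal (ℕ.suc h) x with view h x
    ... | root    = refl
    ... | left y  = trans (υ-LL h y y) (υ-diagonal h y)
    ... | right y = trans (υ-RR h y y) (υ-diagonal h y)

    υ-definite : ∀ h x y → υ h x y ≡ 0 → x ≡ y
    υ-definite ℕ.zero    zero zero _ = refl
    υ-definite (ℕ.suc h) x y eq with view h x | view h y
    ... | root     | root     = refl
    ... | left x′  | left y′  = cong (L h) (υ-definite h x′ y′ (trans (sym (υ-LL h x′ y′)) eq))
    ... | right x′ | right y′ = cong (R h) (υ-definite h x′ y′ (trans (sym (υ-RR h x′ y′)) eq))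
    ... | left x′  | right y′ = case trans (sym (υ-LR h x′ y′)) eq of λ ()
    ... | right x′ | left y′  = case trans (sym (υ-RL h x′ y′)) eq of λ ()

    υ-symm : ∀ h x y → υ h x y ≡ υ h y x
    υ-symm ℕ.zero    x y = refl
    υ-symm (ℕ.suc h) x y with view h x | view h y
    ... | root     | root     = refl
    ... | root     | left _   = refl
    ... | root     | right _  = refl
    ... | left _   | root     = refl
    ... | right _  | root     = refl
    ... | left x′  | left y′  = trans (υ-LL h x′ y′) (trans (υ-symm h x′ y′) (sym (υ-LL h y′ x′)))
    ... | right x′ | right y′ = trans (υ-RR h x′ y′) (trans (υ-symm h x′ y′) (sym (υ-RR h y′ x′)))
    ... | left x′  | right y′ = trans (υ-LR h x′ y′) (sym (υ-RL h y′ x′))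
    ... | right x′ | left y′  = trans (υ-RL h x′ y′) (sym (υ-LR h y′ x′))

    2h≤ : ∀ h → 2 * h ≤ 2 * ℕ.suc h
    2h≤ h = ℕ.*-monoʳ-≤ 2 (ℕ.n≤1+n h)

    υ≤2h : ∀ h x y → υ h x y ≤ 2 * h
    υ≤2h ℕ.zero    x y = z≤n
    υ≤2h (ℕ.suc h) x y with view h x | view h y
    ... | root     | root     = z≤n
    ... | root     | left _   = ℕ.≤-refl
    ... | root     | right _  = ℕ.≤-refl
    ... | left _   | root     = ℕ.≤-refl
    ... | right _  | root     = ℕ.≤-refl
    ... | left x′  | left y′  = ℕ.≤-trans (ℕ.≤-reflexive (υ-LL h x′ y′)) (ℕ.≤-trans (υ≤2h h x′ y′) (2h≤ h))
    ... | right x′ | right y′ = ℕ.≤-trans (ℕ.≤-reflexive (υ-RR h x′ y′)) (ℕ.≤-trans (υ≤2h h x′ y′) (2h≤ h))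
    ... | left x′  | right y′ = ℕ.≤-reflexive (υ-LR h x′ y′)
    ... | right x′ | left y′  = ℕ.≤-reflexive (υ-RL h x′ y′)

    υ-ultra : ∀ h x y z → υ h x z ≤ υ h x y ⊔ υ h y z
    υ-ultra ℕ.zero    x y z = z≤n
    υ-ultra (ℕ.suc h) x y z = ultra (view h x) (view h y) (view h z)
      where
      far-first : ∀ {x y z : Vertex (ℕ.suc h)} → υ (ℕ.suc h) x y ≡ 2 * ℕ.suc h →
                  υ (ℕ.suc h) x z ≤ υ (ℕ.suc h) x y ⊔ υ (ℕ.suc h) y z
      far-first {x} {y} {z} eq = ℕ.m≤n⇒m≤n⊔o _ (subst (υ (ℕ.suc h) x z ≤_) (sym eq) (υ≤2h (ℕ.suc h) x z))
      far-second : ∀ {x y z : Vertex (ℕ.suc h)} → υ (ℕ.suc h) y z ≡ 2 * ℕ.suc h →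
                   υ (ℕ.suc h) x z ≤ υ (ℕ.suc h) x y ⊔ υ (ℕ.suc h) y z
      far-second {x} {y} {z} eq = ℕ.m≤n⇒m≤o⊔n _ (subst (υ (ℕ.suc h) x z ≤_) (sym eq) (υ≤2h (ℕ.suc h) x z))
      ultra : ∀ {x y z : Vertex (ℕ.suc h)} → View h x → View h y → View h z → υ (ℕ.suc h) x z ≤ υ (ℕ.suc h) x y ⊔ υ (ℕ.suc h) y z
      ultra root      root      _         = ℕ.≤-refl
      ultra {x} {y} {z} root      (left y′)  _ = far-first {x} {y} {z} refl
      ultra {x} {y} {z} root      (right y′) _ = far-first {x} {y} {z} refl
      ultra {x} {y} {z} (left x′)  root      _ = far-first {x} {y} {z} refl
      ultra {x} {y} {z} (right x′) root      _ = far-first {x} {y} {z} refl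
      ultra {x} {y} {z} (left x′)  (right y′) _ = far-first {x} {y} {z} (υ-LR h x′ y′)
      ultra {x} {y} {z} (right x′) (left y′) _ = far-first {x} {y} {z} (υ-RL h x′ y′)
      ultra {x} {y} {z} (left x′)  (left y′) root = far-second {x} {y} {z} refl
      ultra {x} {y} {z} (right x′) (right y′) root = far-second {x} {y} {z} refl
      ultra {x} {y} {z} (left x′)  (left y′) (right z′) = far-second {x} {y} {z} (υ-LR h y′ z′)
      ultra {x} {y} {z} (right x′) (right y′) (left z′) = far-second {x} {y} {z} (υ-RL h y′ z′)
      ultra (left x′)  (left y′)  (left z′)
        rewrite υ-LL h x′ z′ | υ-LL h x′ y′ | υ-LL h y′ z′ = υ-ultra h x′ y′ z′
      ultra (right x′) (right y′) (right z′)
        rewrite υ-RR h x′ z′ | υ-RR h x′ y′ | υ-RR h y′ z′ = υ-ultra h x′ y′ z′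

    υ-isNatUltrametric : ∀ h → IsNatUltrametric (υ h)
    υ-isNatUltrametric h = record { diagonal = υ-diagonal h ; definite = υ-definite h ; symm = υ-symm h ; ultra = υ-ultra h }

    δ≤υ : ∀ h x y → δ h x y ≤ υ h x y
    δ≤υ ℕ.zero    x y = z≤n
    δ≤υ (ℕ.suc h) x y with view h x | view h y
    ... | root     | root     = z≤n
    ... | root     | left _   = ℕ.m≤n*m (ℕ.suc h) 2
    ... | root     | right _  = ℕ.m≤n*m (ℕ.suc h) 2
    ... | left _   | root     = ℕ.m≤n*m (ℕ.suc h) 2
    ... | right _  | root     = ℕ.m≤n*m (ℕ.suc h) 2
    ... | left x′  | left y′  = subst₂ _≤_ (sym (δ-LL h x′ y′)) (sym (υ-LL h x′ y′)) (δ≤υ h x′ y′)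
    ... | right x′ | right y′ = subst₂ _≤_ (sym (δ-RR h x′ y′)) (sym (υ-RR h x′ y′)) (δ≤υ h x′ y′)
    ... | left x′  | right y′ = ℕ.≤-reflexive (trans (δ-LR h x′ y′) (sym (υ-LR h x′ y′)))
    ... | right x′ | left y′  = ℕ.≤-reflexive (trans (δ-RL h x′ y′) (sym (υ-RL h x′ y′)))

    υ-cost : ∀ h → edgeSum h (υ h) + (4 * h + 8) ≡ 8 * 2 ^ h
    υ-cost ℕ.zero    = refl
    υ-cost (ℕ.suc h) = begin
      edgeSum (ℕ.suc h) (υ (ℕ.suc h)) + (4 * ℕ.suc h + 8)
        ≡⟨ cong (_+ (4 * ℕ.suc h + 8)) (trans (edgeSum-suc h (υ (ℕ.suc h)))
             (cong₂ (λ a b → (2 * ℕ.suc h + a) + (2 * ℕ.suc h + b)) (edgeSum-cong h (υ-LL h)) (edgeSum-cong h (υ-RR h)))) ⟩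
      (2 * ℕ.suc h + c) + (2 * ℕ.suc h + c) + (4 * ℕ.suc h + 8)
        ≡⟨ ℕS.solve 2 (λ h c → let s = con 1 :+ h in (con 2 :* s :+ c) :+ (con 2 :* s :+ c) :+ (con 4 :* s :+ con 8)
                               := con 2 :* (c :+ (con 4 :* h :+ con 8))) refl h c ⟩
      2 * (c + (4 * h + 8))  ≡⟨ cong (2 *_) (υ-cost h) ⟩
      2 * (8 * 2 ^ h)        ≡⟨ ℕS.solve 1 (λ e → con 2 :* (con 8 :* e) := con 8 :* (con 2 :* e)) refl (2 ^ h) ⟩
      8 * (2 * 2 ^ h)        ∎
      where
      open ≡-Reasoning
      open ℕS
      c = edgeSum h (υ h)

  module _ {A B : Set} (f : A → B) where

    leaves-map : ∀ t → leaves (Tree.mapₗ f t) ≡ List.map f (leaves t)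
    leaves-map (leaf x)     = refl
    leaves-map (node l _ r) = begin
      leaves (node (Tree.mapₗ f l) tt (Tree.mapₗ f r))           ≡⟨ leaves-node (Tree.mapₗ f l) (Tree.mapₗ f r) ⟩
      leaves (Tree.mapₗ f l) ++ leaves (Tree.mapₗ f r)           ≡⟨ cong₂ _++_ (leaves-map l) (leaves-map r) ⟩
      List.map f (leaves l) ++ List.map f (leaves r)             ≡⟨ List.map-++ f (leaves l) (leaves r) ⟨
      List.map f (leaves l ++ leaves r)                          ≡⟨ cong (List.map f) (leaves-node l r) ⟨
      List.map f (leaves (node l tt r))                          ∎
      where open ≡-Reasoning

  module _ {m n : ℕ} (f : Fin m → Fin n) (f-injective : ∀ {x y} → f x ≡ f y → x ≡ y) where
    open DecMembership (Fin._≟_ {m}) using () renaming (_∈?_ to _∈ᵐ?_)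
    open DecMembership (Fin._≟_ {n}) using () renaming (_∈?_ to _∈ⁿ?_)

    ∈-leaves-map : ∀ {x} t → x ∈ᴸ leaves t → f x ∈ᴸ leaves (Tree.mapₗ f t)
    ∈-leaves-map t x∈ = subst (_ ∈ᴸ_) (sym (leaves-map f t)) (List.∈-map⁺ f x∈)

    ∈-leaves-map⁻ : ∀ {x} t → f x ∈ᴸ leaves (Tree.mapₗ f t) → x ∈ᴸ leaves t
    ∈-leaves-map⁻ t fx∈ with List.∈-map⁻ f (subst (_ ∈ᴸ_) (leaves-map f t) fx∈)
    ... | y , y∈ , eq = subst (_∈ᴸ leaves t) (sym (f-injective eq)) y∈

    bothIn-map : ∀ x y t → bothIn (f x) (f y) (Tree.mapₗ f t) ≡ bothIn x y t
    bothIn-map x y t = cong₂ _∧_ (same x) (same y)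
      where
      same : ∀ x → does (f x ∈ⁿ? leaves (Tree.mapₗ f t)) ≡ does (x ∈ᵐ? leaves t)
      same x = does-⇔ (mk⇔ (∈-leaves-map⁻ t) (∈-leaves-map t)) (f x ∈ⁿ? leaves (Tree.mapₗ f t)) (x ∈ᵐ? leaves t)

    lcaSize-map : ∀ x y t → lcaSize (f x) (f y) (Tree.mapₗ f t) ≡ lcaSize x y t
    lcaSize-map x y (leaf _) = refl
    lcaSize-map x y (node l _ r) rewrite bothIn-map x y l | bothIn-map x y r with bothIn x y l | bothIn x y r
    ... | true  | _     = lcaSize-map x y l
    ... | false | true  = lcaSize-map x y r
    ... | false | false = cong₂ _+_ (Tree.#leaves-mapₗ f l) (Tree.#leaves-mapₗ f r)

  tabulate-↑ : ∀ {A : Set} a {b} (f : Fin (a + b) → A) →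
               List.tabulate f ≡ List.tabulate (λ i → f (i ↑ˡ b)) ++ List.tabulate (λ j → f (a ↑ʳ j))
  tabulate-↑ ℕ.zero    f = refl
  tabulate-↑ (ℕ.suc a) f = cong (f zero ∷_) (tabulate-↑ a (f ∘ suc))

  module CompleteHierarchy where
    open CompleteBinaryTree

    tree : ∀ h → Tree ⊤ (Vertex h)
    rightPart : ∀ h → Tree ⊤ (Vertex (ℕ.suc h))
    tree ℕ.zero    = leaf zero
    tree (ℕ.suc h) = node (Tree.mapₗ (L h) (tree h)) tt (rightPart h)
    rightPart h = node (leaf zero) tt (Tree.mapₗ (R h) (tree h))

    allFin-suc : ∀ h → allFin (#vertices (ℕ.suc h)) ≡ zero ∷ List.map (L h) (allFin (#vertices h)) ++ List.map (R h) (allFin (#vertices h))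
    allFin-suc h = cong (zero ∷_) (trans (tabulate-↑ (#vertices h) suc)
      (cong₂ _++_ (sym (List.map-tabulate id (L h))) (sym (List.map-tabulate id (R h)))))

    leaves-rightPart : ∀ h → leaves (rightPart h) ≡ zero ∷ List.map (R h) (leaves (tree h))
    leaves-rightPart h = trans (leaves-node (leaf zero) (Tree.mapₗ (R h) (tree h))) (cong (zero ∷_) (leaves-map (R h) (tree h)))

    leaves↭ : ∀ h → leaves (tree h) ↭ allFin (#vertices h)
    leaves↭ ℕ.zero    = Perm.refl
    leaves↭ (ℕ.suc h) = begin
      leaves (tree (ℕ.suc h))                              ≡⟨ leaves-node (Tree.mapₗ (L h) (tree h)) (rightPart h) ⟩
      leaves (Tree.mapₗ (L h) (tree h)) ++ leaves (rightPart h) ≡⟨ cong₂ _++_ (leaves-map (L h) (tree h)) (leaves-rightPart h) ⟩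
      List.map (L h) ls ++ zero ∷ List.map (R h) ls        ↭⟨ Perm.shift zero (List.map (L h) ls) (List.map (R h) ls) ⟩
      zero ∷ List.map (L h) ls ++ List.map (R h) ls
        ↭⟨ Perm.prep zero (Perm.++⁺ (Perm.map⁺ (L h) (leaves↭ h)) (Perm.map⁺ (R h) (leaves↭ h))) ⟩
      zero ∷ List.map (L h) (allFin (#vertices h)) ++ List.map (R h) (allFin (#vertices h)) ≡⟨ allFin-suc h ⟨
      allFin (#vertices (ℕ.suc h))                         ∎
      where
      open Perm.PermutationReasoning
      ls = leaves (tree h)

    hierarchy : ∀ h → Hierarchy (#vertices h)
    hierarchy h = record { tree = tree h ; leaves↭ = leaves↭ h }

    ∈-tree : ∀ h x → x ∈ᴸ leaves (tree h)
    ∈-tree h x = Perm.∈-resp-↭ (↭-sym (leaves↭ h)) (List.∈-allFin x)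

    #leaves-tree : ∀ h → #leaves (tree h) ≡ #vertices h
    #leaves-tree h = trans (sym (length-leaves (tree h))) (trans (Perm.↭-length (leaves↭ h)) (List.length-tabulate id))

    #leaves-split : ∀ h → #leaves (Tree.mapₗ (L h) (tree h)) + #leaves (rightPart h) ≡ #vertices (ℕ.suc h)
    #leaves-split h = #leaves-tree (ℕ.suc h)

    L∈ : ∀ h x → L h x ∈ᴸ leaves (Tree.mapₗ (L h) (tree h))
    L∈ h x = ∈-leaves-map (L h) (L-injective h) (tree h) (∈-tree h x)

    R∈ : ∀ h x → R h x ∈ᴸ leaves (Tree.mapₗ (R h) (tree h))
    R∈ h x = ∈-leaves-map (R h) (R-injective h) (tree h) (∈-tree h x)

    0∉L : ∀ h → zero ∉ᴸ leaves (Tree.mapₗ (L h) (tree h))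
    0∉L h 0∈ with List.∈-map⁻ (L h) (subst (zero ∈ᴸ_) (leaves-map (L h) (tree h)) 0∈)
    ... | _ , _ , ()

    R∉L : ∀ h x → R h x ∉ᴸ leaves (Tree.mapₗ (L h) (tree h))
    R∉L h x R∈L with List.∈-map⁻ (L h) (subst (R h x ∈ᴸ_) (leaves-map (L h) (tree h)) R∈L)
    ... | _ , _ , eq = L≢R h (sym eq)

    0∈r : ∀ h → zero ∈ᴸ leaves (rightPart h)
    0∈r h = here refl

    R∈r : ∀ h x → R h x ∈ᴸ leaves (rightPart h)
    R∈r h x = there (R∈ h x)

    L∉r : ∀ h x → L h x ∉ᴸ leaves (rightPart h)
    L∉r h x L∈r with subst (L h x ∈ᴸ_) (leaves-rightPart h) L∈r
    ... | there L∈R with List.∈-map⁻ (R h) L∈R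
    ...   | _ , _ , eq = L≢R h eq

    lca-LL : ∀ h x y → lcaSize (L h x) (L h y) (tree (ℕ.suc h)) ≡ lcaSize x y (tree h)
    lca-LL h x y = trans (lcaSize-left {l = Tree.mapₗ (L h) (tree h)} {rightPart h} (L∈ h x) (L∈ h y))
                         (lcaSize-map (L h) (L-injective h) x y (tree h))

    lca-RR : ∀ h x y → lcaSize (R h x) (R h y) (tree (ℕ.suc h)) ≡ lcaSize x y (tree h)
    lca-RR h x y = begin
      lcaSize (R h x) (R h y) (tree (ℕ.suc h))
        ≡⟨ lcaSize-right {l = Tree.mapₗ (L h) (tree h)} {rightPart h} (R∉L h x ∘ proj₁) (R∈r h x) (R∈r h y) ⟩
      lcaSize (R h x) (R h y) (rightPart h)
        ≡⟨ lcaSize-right {l = leaf zero} {Tree.mapₗ (R h) (tree h)} (λ { (here () , _) }) (R∈ h x) (R∈ h y) ⟩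
      lcaSize (R h x) (R h y) (Tree.mapₗ (R h) (tree h))       ≡⟨ lcaSize-map (R h) (R-injective h) x y (tree h) ⟩
      lcaSize x y (tree h)                                     ∎
      where open ≡-Reasoning

    lca-far : ∀ h {x y} → ¬ (x ∈ᴸ leaves (Tree.mapₗ (L h) (tree h)) × y ∈ᴸ leaves (Tree.mapₗ (L h) (tree h))) →
              ¬ (x ∈ᴸ leaves (rightPart h) × y ∈ᴸ leaves (rightPart h)) → lcaSize x y (tree (ℕ.suc h)) ≡ #vertices (ℕ.suc h)
    lca-far h ¬l ¬r = trans (lcaSize-split {l = Tree.mapₗ (L h) (tree h)} {rightPart h} ¬l ¬r) (#leaves-split h)

    0∉R : ∀ h → zero ∉ᴸ leaves (Tree.mapₗ (R h) (tree h))
    0∉R h 0∈ with List.∈-map⁻ (R h) (subst (zero ∈ᴸ_) (leaves-map (R h) (tree h)) 0∈)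
    ... | _ , _ , ()

    lca-near : ∀ h {x y} → ¬ (x ∈ᴸ leaves (Tree.mapₗ (L h) (tree h)) × y ∈ᴸ leaves (Tree.mapₗ (L h) (tree h))) →
               x ∈ᴸ leaves (rightPart h) → y ∈ᴸ leaves (rightPart h) → ¬ (x ∈ᴸ zero ∷ [] × y ∈ᴸ zero ∷ []) →
               ¬ (x ∈ᴸ leaves (Tree.mapₗ (R h) (tree h)) × y ∈ᴸ leaves (Tree.mapₗ (R h) (tree h))) →
               lcaSize x y (tree (ℕ.suc h)) ≡ ℕ.suc (#vertices h)
    lca-near h {x} {y} ¬l x∈r y∈r ¬0 ¬R = begin
      lcaSize x y (tree (ℕ.suc h))                    ≡⟨ lcaSize-right {l = Tree.mapₗ (L h) (tree h)} {rightPart h} ¬l x∈r y∈r ⟩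
      lcaSize x y (rightPart h)                       ≡⟨ lcaSize-split {l = leaf zero} {Tree.mapₗ (R h) (tree h)} ¬0 ¬R ⟩
      ℕ.suc (#leaves (Tree.mapₗ (R h) (tree h)))      ≡⟨ cong ℕ.suc (trans (Tree.#leaves-mapₗ (R h) (tree h)) (#leaves-tree h)) ⟩
      ℕ.suc (#vertices h)                             ∎
      where open ≡-Reasoning

    lca-0L : ∀ h x → lcaSize zero (L h x) (tree (ℕ.suc h)) ≡ #vertices (ℕ.suc h)
    lca-0L h x = lca-far h (0∉L h ∘ proj₁) (L∉r h x ∘ proj₂)
    lca-L0 : ∀ h x → lcaSize (L h x) zero (tree (ℕ.suc h)) ≡ #vertices (ℕ.suc h)
    lca-L0 h x = lca-far h (0∉L h ∘ proj₂) (L∉r h x ∘ proj₁)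
    lca-LR : ∀ h x y → lcaSize (L h x) (R h y) (tree (ℕ.suc h)) ≡ #vertices (ℕ.suc h)
    lca-LR h x y = lca-far h (R∉L h y ∘ proj₂) (L∉r h x ∘ proj₁)
    lca-RL : ∀ h x y → lcaSize (R h x) (L h y) (tree (ℕ.suc h)) ≡ #vertices (ℕ.suc h)
    lca-RL h x y = lca-far h (R∉L h x ∘ proj₁) (L∉r h y ∘ proj₂)
    lca-0R : ∀ h x → lcaSize zero (R h x) (tree (ℕ.suc h)) ≡ ℕ.suc (#vertices h)
    lca-0R h x = lca-near h (0∉L h ∘ proj₁) (0∈r h) (R∈r h x) (λ { (_ , here ()) }) (0∉R h ∘ proj₁)
    lca-R0 : ∀ h x → lcaSize (R h x) zero (tree (ℕ.suc h)) ≡ ℕ.suc (#vertices h)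
    lca-R0 h x = lca-near h (0∉L h ∘ proj₂) (R∈r h x) (0∈r h) (λ { (here () , _) }) (0∉R h ∘ proj₂)

    δ-diagonal : ∀ h x → δ h x x ≡ 0
    δ-diagonal h x = ℕ.n≤0⇒n≡0 (subst (δ h x x ≤_) (υ-diagonal h x) (δ≤υ h x x))

    δ≤lca : ∀ h x y → δ h x y ≤ lcaSize x y (tree h) ∸ 1
    δ≤lca ℕ.zero    x y = z≤n
    δ≤lca (ℕ.suc h) x y with view h x | view h y
    ... | root     | root     = z≤n
    ... | root     | left y′  = subst (λ s → ℕ.suc h ≤ s ∸ 1) (sym (lca-0L h y′)) (h≤#edges (ℕ.suc h))
    ... | root     | right y′ = subst (λ s → ℕ.suc h ≤ s ∸ 1) (sym (lca-0R h y′)) (s≤s (h≤#edges h))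
    ... | left x′  | root     = subst (λ s → ℕ.suc h ≤ s ∸ 1) (sym (lca-L0 h x′)) (h≤#edges (ℕ.suc h))
    ... | right x′ | root     = subst (λ s → ℕ.suc h ≤ s ∸ 1) (sym (lca-R0 h x′)) (s≤s (h≤#edges h))
    ... | left x′  | left y′  = subst₂ _≤_ (sym (δ-LL h x′ y′)) (cong (_∸ 1) (sym (lca-LL h x′ y′))) (δ≤lca h x′ y′)
    ... | right x′ | right y′ = subst₂ _≤_ (sym (δ-RR h x′ y′)) (cong (_∸ 1) (sym (lca-RR h x′ y′))) (δ≤lca h x′ y′)
    ... | left x′  | right y′ = subst₂ _≤_ (sym (δ-LR h x′ y′)) (cong (_∸ 1) (sym (lca-LR h x′ y′))) (2h≤#edges (ℕ.suc h))
    ... | right x′ | left y′  = subst₂ _≤_ (sym (δ-RL h x′ y′)) (cong (_∸ 1) (sym (lca-RL h x′ y′))) (2h≤#edges (ℕ.suc h))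

    δ≤height : ∀ h x y → δ h x y ≤ treeHeight (tree h) x y
    δ≤height h x y with x Fin.≟ y
    ... | yes refl = ℕ.≤-reflexive (δ-diagonal h x)
    ... | no _     = δ≤lca h x y

    cost : ℕ → ℕ
    cost h = edgeSum h (λ x y → lcaSize x y (tree h) ∸ 1)

    cost≤ : ∀ h → cost h ≤ 3 * (h * 2 ^ h)
    cost≤ ℕ.zero = z≤n
    cost≤ (ℕ.suc h) = begin
      cost (ℕ.suc h)
        ≡⟨ edgeSum-suc h (λ x y → lcaSize x y (tree (ℕ.suc h)) ∸ 1) ⟩
      (lcaSize zero (L h zero) (tree (ℕ.suc h)) ∸ 1 + edgeSum h (λ x y → lcaSize (L h x) (L h y) (tree (ℕ.suc h)) ∸ 1)) +
      (lcaSize zero (R h zero) (tree (ℕ.suc h)) ∸ 1 + edgeSum h (λ x y → lcaSize (R h x) (R h y) (tree (ℕ.suc h)) ∸ 1))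
        ≡⟨ cong₂ _+_ (cong₂ _+_ (cong (_∸ 1) (lca-0L h zero)) (edgeSum-cong h λ x y → cong (_∸ 1) (lca-LL h x y)))
                     (cong₂ _+_ (cong (_∸ 1) (lca-0R h zero)) (edgeSum-cong h λ x y → cong (_∸ 1) (lca-RR h x y))) ⟩
      (#edges (ℕ.suc h) + cost h) + (#vertices h + cost h)
        ≤⟨ ℕ.+-mono-≤ (ℕ.+-mono-≤ (ℕ.m≤n+m (#edges (ℕ.suc h)) 2) (cost≤ h)) (ℕ.+-mono-≤ (ℕ.n≤1+n (#vertices h)) (cost≤ h)) ⟩
      (2 + #edges (ℕ.suc h) + 3 * (h * e)) + (2 + #edges h + 3 * (h * e))
        ≡⟨ cong₂ (λ a b → (a + 3 * (h * e)) + (b + 3 * (h * e))) (2+#edges (ℕ.suc h)) (2+#edges h) ⟩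
      (2 * (2 * e) + 3 * (h * e)) + (2 * e + 3 * (h * e))
        ≡⟨ ℕS.solve 2 (λ h e → (con 2 :* (con 2 :* e) :+ con 3 :* (h :* e)) :+ (con 2 :* e :+ con 3 :* (h :* e))
                               := con 3 :* ((con 1 :+ h) :* (con 2 :* e))) refl h e ⟩
      3 * (ℕ.suc h * (2 * e)) ∎
      where
      open ℕ.≤-Reasoning
      open ℕS
      e = 2 ^ h

  module OrderedFieldProperties {a ℓ₁ ℓ₂} (K : OrderedField a ℓ₁ ℓ₂) where
    open OrderedField K public using (Carrier; _≈_; -_; _-_; 0#; 1#; _⁻¹; ⁻¹-cong; ⁻¹-inverseʳ; _/_; fromNat; 0≉1; _⊔ᴷ_)
      renaming (_≤_ to _≤ᴷ_; _<_ to _<ᴷ_; _+_ to _+ᴷ_; _*_ to _*ᴷ_; sum to sumᴷ; +-monoʳ-≤ to +ᴷ-monoʳ-≤)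
    open OrderedField K using (commutativeRing; decTotalOrder; *-nonNegative)
    private module R = CommutativeRing commutativeRing
    open DecTotalOrder decTotalOrder public
      using ()
      renaming (refl to ≤ᴷ-refl; trans to ≤ᴷ-trans; antisym to ≤ᴷ-antisym; total to ≤ᴷ-total;
                reflexive to ≤ᴷ-reflexive; _≤?_ to _≤ᴷ?_; totalOrder to ≤ᴷ-totalOrder)
    open RingProperties R.ring using (-‿distribʳ-*; -‿involutive)
    open SemiringMult R.semiring using (×-homo-+; ×1-homo-*)
    open CommutativeSemigroupProperties (CommutativeRing.*-commutativeSemigroup commutativeRing) using (interchange)
    module ≤ᴷ-Reasoning = PreorderReasoning (DecTotalOrder.preorder decTotalOrder)
    module ≈-Reasoning = SetoidReasoning R.setoid
    open R public
      using ()
      renaming (refl to ≈-refl; sym to ≈-sym; trans to ≈-trans; reflexive to ≈-reflexive; *-identityˡ to *ᴷ-identityˡ;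
                *-identityʳ to *ᴷ-identityʳ; *-congˡ to *ᴷ-congˡ; *-congʳ to *ᴷ-congʳ)

    +ᴷ-mono-≤ : ∀ {x y u v} → x ≤ᴷ y → u ≤ᴷ v → x +ᴷ u ≤ᴷ y +ᴷ v
    +ᴷ-mono-≤ {x} {y} {u} {v} x≤y u≤v = begin
      x +ᴷ u ≲⟨ +ᴷ-monoʳ-≤ x u≤v ⟩
      x +ᴷ v ≈⟨ R.+-comm x v ⟩
      v +ᴷ x ≲⟨ +ᴷ-monoʳ-≤ v x≤y ⟩
      v +ᴷ y ≈⟨ R.+-comm v y ⟩
      y +ᴷ v ∎
      where open ≤ᴷ-Reasoning

    x≤y⇒0≤y-x : ∀ {x y} → x ≤ᴷ y → 0# ≤ᴷ y - x
    x≤y⇒0≤y-x {x} {y} x≤y = begin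
      0#        ≈⟨ R.-‿inverseˡ x ⟨
      - x +ᴷ x  ≲⟨ +ᴷ-monoʳ-≤ (- x) x≤y ⟩
      - x +ᴷ y  ≈⟨ R.+-comm (- x) y ⟩
      y - x     ∎
      where open ≤ᴷ-Reasoning

    0≤1 : 0# ≤ᴷ 1#
    0≤1 with ≤ᴷ-total 0# 1#
    ... | inj₁ 0≤1 = 0≤1
    ... | inj₂ 1≤0 = begin
      0#              ≲⟨ *-nonNegative 0≤-1 0≤-1 ⟩
      - 1# *ᴷ - 1#    ≈⟨ -‿distribʳ-* (- 1#) 1# ⟨
      - (- 1# *ᴷ 1#)  ≈⟨ R.-‿cong (R.*-identityʳ (- 1#)) ⟩
      - (- 1#)        ≈⟨ -‿involutive 1# ⟩
      1#              ∎
      where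
      open ≤ᴷ-Reasoning
      0≤-1 : 0# ≤ᴷ - 1#
      0≤-1 = ≤ᴷ-trans (x≤y⇒0≤y-x 1≤0) (≤ᴷ-reflexive (R.+-identityˡ (- 1#)))

    1≰0 : ¬ 1# ≤ᴷ 0#
    1≰0 1≤0 = 0≉1 (≤ᴷ-antisym 0≤1 1≤0)

    *ᴷ-monoˡ-≤ : ∀ {c x y} → 0# ≤ᴷ c → x ≤ᴷ y → c *ᴷ x ≤ᴷ c *ᴷ y
    *ᴷ-monoˡ-≤ {c} {x} {y} 0≤c x≤y = begin
      c *ᴷ x                        ≈⟨ R.+-identityʳ (c *ᴷ x) ⟨
      c *ᴷ x +ᴷ 0#                  ≲⟨ +ᴷ-monoʳ-≤ (c *ᴷ x) (*-nonNegative 0≤c (x≤y⇒0≤y-x x≤y)) ⟩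
      c *ᴷ x +ᴷ c *ᴷ (y - x)        ≈⟨ R.distribˡ c x (y - x) ⟨
      c *ᴷ (x +ᴷ (y - x))           ≈⟨ R.*-congˡ (R.+-congˡ (R.+-comm y (- x))) ⟩
      c *ᴷ (x +ᴷ (- x +ᴷ y))        ≈⟨ R.*-congˡ (R.+-assoc x (- x) y) ⟨
      c *ᴷ ((x - x) +ᴷ y)           ≈⟨ R.*-congˡ (R.+-congʳ (R.-‿inverseʳ x)) ⟩
      c *ᴷ (0# +ᴷ y)                ≈⟨ R.*-congˡ (R.+-identityˡ y) ⟩
      c *ᴷ y                        ∎
      where open ≤ᴷ-Reasoning

    *ᴷ-monoʳ-≤ : ∀ {c x y} → 0# ≤ᴷ c → x ≤ᴷ y → x *ᴷ c ≤ᴷ y *ᴷ c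
    *ᴷ-monoʳ-≤ {c} {x} {y} 0≤c x≤y = ≤ᴷ-trans (≤ᴷ-reflexive (R.*-comm x c)) (≤ᴷ-trans (*ᴷ-monoˡ-≤ 0≤c x≤y) (≤ᴷ-reflexive (R.*-comm c y)))

    fromNat-+ : ∀ m n → fromNat (m + n) ≈ fromNat m +ᴷ fromNat n
    fromNat-+ = ×-homo-+ 1#

    fromNat-* : ∀ m n → fromNat (m * n) ≈ fromNat m *ᴷ fromNat n
    fromNat-* = ×1-homo-*

    fromNat-1 : fromNat 1 ≈ 1#
    fromNat-1 = R.+-identityʳ 1#

    0≤fromNat : ∀ m → 0# ≤ᴷ fromNat m
    0≤fromNat ℕ.zero    = ≤ᴷ-refl
    0≤fromNat (ℕ.suc m) = ≤ᴷ-trans (≤ᴷ-reflexive (R.sym (R.+-identityˡ 0#))) (+ᴷ-mono-≤ 0≤1 (0≤fromNat m))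

    fromNat-mono : ∀ {m n} → m ≤ n → fromNat m ≤ᴷ fromNat n
    fromNat-mono {n = n} z≤n = 0≤fromNat n
    fromNat-mono (s≤s m≤n)   = +ᴷ-monoʳ-≤ 1# (fromNat-mono m≤n)

    fromNat-suc≉0 : ∀ m → ¬ fromNat (ℕ.suc m) ≈ 0#
    fromNat-suc≉0 m eq = 1≰0 (begin
      1#                ≈⟨ R.+-identityʳ 1# ⟨
      1# +ᴷ 0#          ≲⟨ +ᴷ-monoʳ-≤ 1# (0≤fromNat m) ⟩
      1# +ᴷ fromNat m   ≈⟨ eq ⟩
      0#                ∎)
      where open ≤ᴷ-Reasoning

    fromNat-reflects-≤ : ∀ m n → fromNat m ≤ᴷ fromNat n → m ≤ n
    fromNat-reflects-≤ ℕ.zero    n         _  = z≤n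
    fromNat-reflects-≤ (ℕ.suc m) ℕ.zero    le = ⊥-elim (fromNat-suc≉0 m (≤ᴷ-antisym le (0≤fromNat (ℕ.suc m))))
    fromNat-reflects-≤ (ℕ.suc m) (ℕ.suc n) le = s≤s (fromNat-reflects-≤ m n (begin
      fromNat m                         ≈⟨ cancel (fromNat m) ⟨
      - 1# +ᴷ (1# +ᴷ fromNat m)         ≲⟨ +ᴷ-monoʳ-≤ (- 1#) le ⟩
      - 1# +ᴷ (1# +ᴷ fromNat n)         ≈⟨ cancel (fromNat n) ⟩
      fromNat n                         ∎))
      where
      open ≤ᴷ-Reasoning
      cancel : ∀ x → - 1# +ᴷ (1# +ᴷ x) ≈ x
      cancel x = R.trans (R.sym (R.+-assoc (- 1#) 1# x)) (R.trans (R.+-congʳ (R.-‿inverseˡ 1#)) (R.+-identityˡ x))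

    0≤⁻¹ : ∀ {x} → 0# ≤ᴷ x → ¬ x ≈ 0# → 0# ≤ᴷ x ⁻¹
    0≤⁻¹ {x} 0≤x x≉0 with ≤ᴷ-total 0# (x ⁻¹)
    ... | inj₁ 0≤x⁻¹ = 0≤x⁻¹
    ... | inj₂ x⁻¹≤0 = ⊥-elim (1≰0 (begin
      1#          ≈⟨ ⁻¹-inverseʳ x≉0 ⟨
      x *ᴷ x ⁻¹   ≲⟨ *ᴷ-monoˡ-≤ 0≤x x⁻¹≤0 ⟩
      x *ᴷ 0#     ≈⟨ R.zeroʳ x ⟩
      0#          ∎))
      where open ≤ᴷ-Reasoning

    Positive : Carrier → Set _
    Positive x = 0# ≤ᴷ x × ¬ x ≈ 0#

    fromNat-positive : ∀ {m} → 0 < m → Positive (fromNat m)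
    fromNat-positive {ℕ.suc m} _ = 0≤fromNat (ℕ.suc m) , fromNat-suc≉0 m

    ⁻¹-unique : ∀ {x y} → ¬ x ≈ 0# → x *ᴷ y ≈ 1# → y ≈ x ⁻¹
    ⁻¹-unique {x} {y} x≉0 xy≈1 = begin
      y                   ≈⟨ R.*-identityʳ y ⟨
      y *ᴷ 1#             ≈⟨ R.*-congˡ (⁻¹-inverseʳ x≉0) ⟨
      y *ᴷ (x *ᴷ x ⁻¹)    ≈⟨ R.*-assoc y x (x ⁻¹) ⟨
      (y *ᴷ x) *ᴷ x ⁻¹    ≈⟨ R.*-congʳ (R.trans (R.*-comm y x) xy≈1) ⟩
      1# *ᴷ x ⁻¹          ≈⟨ R.*-identityˡ (x ⁻¹) ⟩
      x ⁻¹                ∎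
      where open ≈-Reasoning

    expandʳ : ∀ x {y z} → ¬ z ≈ 0# → x / y ≈ (x *ᴷ z) *ᴷ (y ⁻¹ *ᴷ z ⁻¹)
    expandʳ x {y} {z} z≉0 = begin
      x / y                         ≈⟨ R.*-identityʳ (x / y) ⟨
      (x / y) *ᴷ 1#                 ≈⟨ R.*-congˡ (⁻¹-inverseʳ z≉0) ⟨
      (x / y) *ᴷ (z *ᴷ z ⁻¹)        ≈⟨ interchange x (y ⁻¹) z (z ⁻¹) ⟩
      (x *ᴷ z) *ᴷ (y ⁻¹ *ᴷ z ⁻¹)    ∎
      where open ≈-Reasoning

    /-mono : ∀ {x y u v} → Positive y → Positive v → x *ᴷ v ≤ᴷ u *ᴷ y → x / y ≤ᴷ u / v
    /-mono {x} {y} {u} {v} (0≤y , y≉0) (0≤v , v≉0) le = begin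
      x / y                         ≈⟨ expandʳ x v≉0 ⟩
      (x *ᴷ v) *ᴷ (y ⁻¹ *ᴷ v ⁻¹)    ≲⟨ *ᴷ-monoʳ-≤ (*-nonNegative (0≤⁻¹ 0≤y y≉0) (0≤⁻¹ 0≤v v≉0)) le ⟩
      (u *ᴷ y) *ᴷ (y ⁻¹ *ᴷ v ⁻¹)    ≈⟨ R.*-congˡ (R.*-comm (y ⁻¹) (v ⁻¹)) ⟩
      (u *ᴷ y) *ᴷ (v ⁻¹ *ᴷ y ⁻¹)    ≈⟨ expandʳ u y≉0 ⟨
      u / v                         ∎
      where open ≤ᴷ-Reasoning

    /-*-/ : ∀ {x y u v} → ¬ y ≈ 0# → ¬ v ≈ 0# → ¬ y *ᴷ v ≈ 0# → (x / y) *ᴷ (u / v) ≈ (x *ᴷ u) / (y *ᴷ v)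
    /-*-/ {x} {y} {u} {v} y≉0 v≉0 yv≉0 = R.trans (interchange x (y ⁻¹) u (v ⁻¹)) (R.*-congˡ (⁻¹-unique yv≉0 (begin
      (y *ᴷ v) *ᴷ (y ⁻¹ *ᴷ v ⁻¹)    ≈⟨ interchange y v (y ⁻¹) (v ⁻¹) ⟩
      (y *ᴷ y ⁻¹) *ᴷ (v *ᴷ v ⁻¹)    ≈⟨ R.*-cong (⁻¹-inverseʳ y≉0) (⁻¹-inverseʳ v≉0) ⟩
      1# *ᴷ 1#                      ≈⟨ R.*-identityʳ 1# ⟩
      1#                            ∎)))
      where open ≈-Reasoning

    0</ : ∀ {x y} → Positive x → Positive y → 0# <ᴷ x / y
    0</ {x} {y} (0≤x , x≉0) (0≤y , y≉0) = *-nonNegative 0≤x (0≤⁻¹ 0≤y y≉0) , λ 0≈x/y → x≉0 (begin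
      x                     ≈⟨ R.*-identityʳ x ⟨
      x *ᴷ 1#               ≈⟨ R.*-congˡ (R.trans (R.*-comm (y ⁻¹) y) (⁻¹-inverseʳ y≉0)) ⟨
      x *ᴷ (y ⁻¹ *ᴷ y)      ≈⟨ R.*-assoc x (y ⁻¹) y ⟨
      (x / y) *ᴷ y          ≈⟨ R.*-congʳ 0≈x/y ⟨
      0# *ᴷ y               ≈⟨ R.zeroˡ y ⟩
      0#                    ∎)
      where open ≈-Reasoning

    /-cong : ∀ {x y u v} → x ≈ u → y ≈ v → x / y ≈ u / v
    /-cong x≈u y≈v = R.*-cong x≈u (⁻¹-cong y≈v)

    fraction-mono : ∀ {m n k l} → 0 < n → 0 < l → m * l ≤ k * n → fromNat m / fromNat n ≤ᴷ fromNat k / fromNat l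
    fraction-mono {m} {n} {k} {l} 0<n 0<l le = /-mono (fromNat-positive 0<n) (fromNat-positive 0<l) (begin
      fromNat m *ᴷ fromNat l  ≈⟨ fromNat-* m l ⟨
      fromNat (m * l)         ≲⟨ fromNat-mono le ⟩
      fromNat (k * n)         ≈⟨ fromNat-* k n ⟩
      fromNat k *ᴷ fromNat n  ∎)
      where open ≤ᴷ-Reasoning

    fraction-* : ∀ {m n k l} → 0 < n → 0 < l → (fromNat m / fromNat n) *ᴷ (fromNat k / fromNat l) ≈ fromNat (m * k) / fromNat (n * l)
    fraction-* {m} {ℕ.suc n} {k} {ℕ.suc l} _ _ =
      R.trans (/-*-/ (fromNat-suc≉0 n) (fromNat-suc≉0 l) (fromNat-suc≉0 (l + n * ℕ.suc l) ∘ R.trans (fromNat-* (ℕ.suc n) (ℕ.suc l))))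
              (/-cong (R.sym (fromNat-* m k)) (R.sym (fromNat-* (ℕ.suc n) (ℕ.suc l))))

    two-thirds : ∀ m n → 3 * m ≤ 2 * n → fromNat m ≤ᴷ (1# - 1# / fromNat 3) *ᴷ fromNat n
    two-thirds m n 3m≤2n = begin
      fromNat m                                  ≈⟨ R.*-identityˡ (fromNat m) ⟨
      1# *ᴷ fromNat m                            ≈⟨ R.*-congʳ t3 ⟨
      (t *ᴷ fromNat 3) *ᴷ fromNat m              ≈⟨ R.*-assoc t (fromNat 3) (fromNat m) ⟩
      t *ᴷ (fromNat 3 *ᴷ fromNat m)              ≈⟨ R.*-congˡ (fromNat-* 3 m) ⟨
      t *ᴷ fromNat (3 * m)                       ≲⟨ *ᴷ-monoˡ-≤ (0≤⁻¹ (0≤fromNat 3) (fromNat-suc≉0 2)) (fromNat-mono 3m≤2n) ⟩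
      t *ᴷ fromNat (2 * n)                       ≈⟨ R.*-congˡ (fromNat-* 2 n) ⟩
      t *ᴷ (fromNat 2 *ᴷ fromNat n)              ≈⟨ R.*-assoc t (fromNat 2) (fromNat n) ⟨
      (t *ᴷ fromNat 2) *ᴷ fromNat n              ≈⟨ R.*-congʳ 2t ⟩
      (1# - 1# / fromNat 3) *ᴷ fromNat n         ∎
      where
      open ≤ᴷ-Reasoning
      t = fromNat 3 ⁻¹
      t3 : t *ᴷ fromNat 3 ≈ 1#
      t3 = R.trans (R.*-comm t (fromNat 3)) (⁻¹-inverseʳ (fromNat-suc≉0 2))
      2t : t *ᴷ fromNat 2 ≈ 1# - 1# / fromNat 3
      2t = ≈-Reasoning.begin
        (t *ᴷ fromNat 2                        ≈-Reasoning.≈⟨ R.+-identityʳ _ ⟨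
        (t *ᴷ fromNat 2 +ᴷ 0#                  ≈-Reasoning.≈⟨ R.+-congˡ (R.-‿inverseʳ t) ⟨
        (t *ᴷ fromNat 2 +ᴷ (t - t)             ≈-Reasoning.≈⟨ R.+-assoc _ t (- t) ⟨
        ((t *ᴷ fromNat 2 +ᴷ t) - t             ≈-Reasoning.≈⟨ R.+-cong 3t (R.-‿cong (R.sym (R.*-identityˡ t))) ⟩
        (1# - 1# / fromNat 3                   ≈-Reasoning.∎)))))
        where
        3t : t *ᴷ fromNat 2 +ᴷ t ≈ 1#
        3t = R.trans (R.+-comm _ t) (R.trans (R.+-congʳ (R.sym (R.*-identityʳ t))) (R.trans (R.sym (R.distribˡ t 1# (fromNat 2))) t3))

    fromNat-sum : ∀ {n} (f : Fin n → ℕ) → fromNat (sum f) ≈ sumᴷ (fromNat ∘ f)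
    fromNat-sum {ℕ.zero}  f = R.refl
    fromNat-sum {ℕ.suc n} f = R.trans (fromNat-+ (f zero) (sum (f ∘ suc))) (R.+-congˡ (fromNat-sum (f ∘ suc)))

    sumᴷ-cong : ∀ {n} {f g : Fin n → Carrier} → (∀ i → f i ≈ g i) → sumᴷ f ≈ sumᴷ g
    sumᴷ-cong {ℕ.zero}  f≈g = R.refl
    sumᴷ-cong {ℕ.suc n} f≈g = R.+-cong (f≈g zero) (sumᴷ-cong (f≈g ∘ suc))

    sumᴷ-mono : ∀ {n} {f g : Fin n → Carrier} → (∀ i → f i ≤ᴷ g i) → sumᴷ f ≤ᴷ sumᴷ g
    sumᴷ-mono {ℕ.zero}  f≤g = ≤ᴷ-refl
    sumᴷ-mono {ℕ.suc n} f≤g = +ᴷ-mono-≤ (f≤g zero) (sumᴷ-mono (f≤g ∘ suc))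

    module _ {n p} {P : Rel (Fin n) p} (P? : ∀ x y → Dec (P x y)) where
      open Weighted K using (∑[_]_)

      ∑-fromNat : ∀ {f : Fin n → Fin n → Carrier} {g : Fin n → Fin n → ℕ} → (∀ x y → f x y ≈ fromNat (g x y)) →
                  ∑[ P? ] f ≈ fromNat (sum λ x → sum λ y → if does (P? x y) then g x y else 0)
      ∑-fromNat {f} {g} f≈g = R.sym (R.trans (fromNat-sum (λ x → sum λ y → if does (P? x y) then g x y else 0))
        (sumᴷ-cong λ x → R.trans (fromNat-sum (λ y → if does (P? x y) then g x y else 0)) (sumᴷ-cong λ y → term (does (P? x y)) (f≈g x y))))
        where
        term : ∀ b {x k} → x ≈ fromNat k → fromNat (if b then k else 0) ≈ (if b then x else 0#)
        term true  eq = R.sym eq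
        term false _  = R.refl

      ∑-mono : ∀ {f g : Fin n → Fin n → Carrier} → (∀ x y → f x y ≤ᴷ g x y) → ∑[ P? ] f ≤ᴷ ∑[ P? ] g
      ∑-mono f≤g = sumᴷ-mono λ x → sumᴷ-mono λ y → term (does (P? x y)) (f≤g x y)
        where
        term : ∀ b {x y} → x ≤ᴷ y → (if b then x else 0#) ≤ᴷ (if b then y else 0#)
        term true  le = le
        term false _  = ≤ᴷ-refl

    -- Capped at b, and 0 for negative x.
    floor : ℕ → Carrier → ℕ
    floor ℕ.zero    x = 0
    floor (ℕ.suc b) x = if does (fromNat (ℕ.suc b) ≤ᴷ? x) then ℕ.suc b else floor b x

    floor≤b : ∀ b x → floor b x ≤ b
    floor≤b ℕ.zero    x = z≤n
    floor≤b (ℕ.suc b) x with fromNat (ℕ.suc b) ≤ᴷ? x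
    ... | yes _ = ℕ.≤-refl
    ... | no _  = ℕ.m≤n⇒m≤1+n (floor≤b b x)

    floor≤ : ∀ b {x} → 0# ≤ᴷ x → fromNat (floor b x) ≤ᴷ x
    floor≤ ℕ.zero    0≤x = 0≤x
    floor≤ (ℕ.suc b) {x} 0≤x with fromNat (ℕ.suc b) ≤ᴷ? x
    ... | yes le = le
    ... | no _   = floor≤ b 0≤x

    floor-greatest : ∀ {b k x} → k ≤ b → fromNat k ≤ᴷ x → k ≤ floor b x
    floor-greatest {ℕ.zero}  z≤n _ = z≤n
    floor-greatest {ℕ.suc b} {k} {x} k≤b le with fromNat (ℕ.suc b) ≤ᴷ? x
    ... | yes _ = k≤b
    ... | no ¬le with ℕ.m≤n⇒m<n∨m≡n k≤b
    ...   | inj₁ k<b  = floor-greatest (ℕ.s≤s⁻¹ k<b) le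
    ...   | inj₂ refl = ⊥-elim (¬le le)

    floor-mono : ∀ b {x y} → 0# ≤ᴷ x → x ≤ᴷ y → floor b x ≤ floor b y
    floor-mono b {x} 0≤x x≤y = floor-greatest (floor≤b b x) (≤ᴷ-trans (floor≤ b 0≤x) x≤y)

    open Max ≤ᴷ-totalOrder using (⊔-sel; x≤x⊔y; x≤y⊔x)

    fromNat-⊔ : ∀ m n → fromNat (m ⊔ n) ≤ᴷ fromNat m ⊔ᴷ fromNat n
    fromNat-⊔ m n with ℕ.⊔-sel m n
    ... | inj₁ eq rewrite eq = x≤x⊔y (fromNat m) (fromNat n)
    ... | inj₂ eq rewrite eq = x≤y⊔x (fromNat m) (fromNat n)

    floor-⊔ : ∀ b {x y} → 0# ≤ᴷ x → 0# ≤ᴷ y → floor b (x ⊔ᴷ y) ≤ floor b x ⊔ floor b y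
    floor-⊔ b {x} {y} 0≤x 0≤y with ⊔-sel x y
    ... | inj₁ eq = ℕ.m≤n⇒m≤n⊔o _ (floor-mono b (≤ᴷ-trans 0≤x (x≤x⊔y x y)) (≤ᴷ-reflexive eq))
    ... | inj₂ eq = ℕ.m≤n⇒m≤o⊔n _ (floor-mono b (≤ᴷ-trans 0≤x (x≤x⊔y x y)) (≤ᴷ-reflexive eq))

  module EdgeSums {m : ℕ} (par : Fin m → Fin (ℕ.suc m)) (par≤ : ∀ i → toℕ (par i) ≤ toℕ i) where
    open RootedTree par par≤
    open Graph graph using (_~?_)

    sum₂-cong : {f g : V → V → ℕ} → (∀ x y → f x y ≡ g x y) → sum (λ x → sum (f x)) ≡ sum (λ x → sum (g x))
    sum₂-cong f≗g = sum-cong-≗ λ x → sum-cong-≗ (f≗g x)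

    does-<∧~ : ∀ x y → does ((x Fin.<? y) ×-dec (x ~? y)) ≡ does (x ◁? y)
    does-<∧~ x y = does-⇔ (mk⇔ (λ (x<y , x~y) → ~∧<⇒◁ x<y x~y) (λ x◁y → ◁⇒< x◁y , inj₁ x◁y))
                          ((x Fin.<? y) ×-dec (x ~? y)) (x ◁? y)

    sum-edges : ∀ f → sum (λ x → sum λ y → if does ((x Fin.<? y) ×-dec (x ~? y)) then f x y else 0) ≡
                      sum (λ i → f (par i) (suc i))
    sum-edges f = trans (sum₂-cong λ x y → cong (λ b → if b then f x y else 0) (does-<∧~ x y)) (sum-◁ f)

    sum-induced : ∀ S → sum (λ x → sum λ y → if does ((x Fin.<? y) ×-dec (x ∈? S) ×-dec (y ∈? S) ×-dec (x ~? y)) then 1 else 0) ≡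
                        edgeCount S
    sum-induced S = trans
      (sum₂-cong λ x y → regroup (does (x Fin.<? y)) (χ S x) (χ S y) (does (x ~? y)))
      (sum-edges λ x y → 𝟙 (χ S x ∧ χ S y))
      where
      regroup : ∀ a s t b → (if a ∧ (s ∧ (t ∧ b)) then 1 else 0) ≡ (if a ∧ b then 𝟙 (s ∧ t) else 0)
      regroup false s     t     b     = refl
      regroup true  true  true  b     = refl
      regroup true  true  false true  = refl
      regroup true  true  false false = refl
      regroup true  false t     true  = refl
      regroup true  false t     false = refl

    sum-cut : ∀ A B → sum (λ x → sum λ y → if does ((x ∈? A) ×-dec (y ∈? B) ×-dec (x ~? y)) then 1 else 0) ≡ cutCount A B
    sum-cut A B = begin
      sum (λ x → sum λ y → if does ((x ∈? A) ×-dec (y ∈? B) ×-dec (x ~? y)) then 1 else 0)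
        ≡⟨ sum₂-cong exclusive ⟩
      sum (λ x → sum λ y → down x y + up x y)
        ≡⟨ sum-cong-≗ (λ x → ∑-distrib-+ (down x) (up x)) ⟩
      sum (λ x → sum (down x) + sum (up x))
        ≡⟨ ∑-distrib-+ (λ x → sum (down x)) (λ x → sum (up x)) ⟩
      sum (λ x → sum (down x)) + sum (λ x → sum (up x))
        ≡⟨ cong₂ _+_ (sum-◁ λ x y → 𝟙 (χ A x ∧ χ B y)) (trans (∑-comm up) (sum-◁ λ y x → 𝟙 (χ A x ∧ χ B y))) ⟩
      sum (λ i → 𝟙 (χ A (par i) ∧ χ B (suc i))) + sum (λ i → 𝟙 (χ A (suc i) ∧ χ B (par i)))
        ≡⟨ ∑-distrib-+ (λ i → 𝟙 (χ A (par i) ∧ χ B (suc i))) (λ i → 𝟙 (χ A (suc i) ∧ χ B (par i))) ⟨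
      cutCount A B ∎
      where
      open ≡-Reasoning
      down up : V → V → ℕ
      down x y = if does (x ◁? y) then 𝟙 (χ A x ∧ χ B y) else 0
      up   x y = if does (y ◁? x) then 𝟙 (χ A x ∧ χ B y) else 0

      regroup : ∀ a b d u → d ∧ u ≡ false →
                (if a ∧ (b ∧ (d ∨ u)) then 1 else 0) ≡ (if d then 𝟙 (a ∧ b) else 0) + (if u then 𝟙 (a ∧ b) else 0)
      regroup true  true  true  false _ = refl
      regroup true  true  false true  _ = refl
      regroup true  true  false false _ = refl
      regroup true  false true  false _ = refl
      regroup true  false false true  _ = refl
      regroup true  false false false _ = refl
      regroup false b     true  false _ = refl
      regroup false b     false true  _ = refl
      regroup false b     false false _ = refl

      exclusive : ∀ x y → (if does ((x ∈? A) ×-dec (y ∈? B) ×-dec (x ~? y)) then 1 else 0) ≡ down x y + up x y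
      exclusive x y = regroup (χ A x) (χ B y) (does (x ◁? y)) (does (y ◁? x))
        (dec-false ((x ◁? y) ×-dec (y ◁? x)) λ (x◁y , y◁x) → ℕ.<-asym (◁⇒< x◁y) (◁⇒< y◁x))

  module WeightedTree {a ℓ₁ ℓ₂} (K : OrderedField a ℓ₁ ℓ₂) {m : ℕ} (par : Fin m → Fin (ℕ.suc m)) (par≤ : ∀ i → toℕ (par i) ≤ toℕ i) where
    open OrderedFieldProperties K
    open Weighted K
    open RootedTree par par≤ using (V; edgeCount; cutCount; cutCount≡1; connected⇒size) renaming (graph to tree; connected to tree-connected)
    open EdgeSums par par≤
    open Graph tree using (_~?_)
    open Distance tree tree-connected

    G : WeightedGraph (ℕ.suc m)
    G = record
      { graph      = tree
      ; weight     = λ _ _ → 1#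
      ; weight-sym = λ _ _ → ≈-refl
      ; weight-pos = λ _ → 0≤1 , 0≉1
      }

    edgeSum : (V → V → ℕ) → ℕ
    edgeSum u = sum λ i → u (par i) (suc i)

    cost-fromNat : ∀ u → cost G (λ x y → fromNat (u x y)) ≈ fromNat (edgeSum u)
    cost-fromNat u = ≈-trans (∑-fromNat (λ x y → (x Fin.<? y) ×-dec (x ~? y)) {g = u} (λ x y → *ᴷ-identityˡ (fromNat (u x y))))
                             (≈-reflexive (cong fromNat (sum-edges u)))

    cost-mono : ∀ {u v} → (∀ x y → u x y ≤ᴷ v x y) → cost G u ≤ᴷ cost G v
    cost-mono u≤v = ∑-mono (λ x y → (x Fin.<? y) ×-dec (x ~? y)) λ x y → *ᴷ-monoˡ-≤ 0≤1 (u≤v x y)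

    dominates⁺ : ∀ {u} → (∀ x y → fromNat (dist x y) ≤ᴷ u x y) → DominatesDistance G u
    dominates⁺ {u} d≤u x y d isDist = subst (λ k → fromNat k ≤ᴷ u x y) (sym (distance-unique isDist)) (d≤u x y)

    dominates⁻ : ∀ {u} → DominatesDistance G u → ∀ x y → fromNat (dist x y) ≤ᴷ u x y
    dominates⁻ dom x y = dom x y (dist x y) (proj₂ (distance x y))

    inducedWeight≈ : ∀ S → inducedWeight G S ≈ fromNat (edgeCount S)
    inducedWeight≈ S = ≈-trans (∑-fromNat (λ x y → (x Fin.<? y) ×-dec (x ∈? S) ×-dec (y ∈? S) ×-dec (x ~? y))
                                          {g = λ _ _ → 1} (λ _ _ → ≈-sym fromNat-1))
                               (≈-reflexive (cong fromNat (sum-induced S)))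

    cutWeight≈ : ∀ A B → cutWeight G A B ≈ fromNat (cutCount A B)
    cutWeight≈ A B = ≈-trans (∑-fromNat (λ x y → (x ∈? A) ×-dec (y ∈? B) ×-dec (x ~? y))
                                          {g = λ _ _ → 1} (λ _ _ → ≈-sym fromNat-1))
                             (≈-reflexive (cong fromNat (sum-cut A B)))

    -- A connected set with k + 1 vertices has k edges, and exactly one of them is cut by a connected bipartition.
    fragCost≈1 : ∀ {α S A B} → 2 ≤ ∣ S ∣ → ConnectedOn tree S → IsBalancedBipartition G α S A B → fragCost G S (A , B) ≈ 1#
    fragCost≈1 {S = S} {A} {B} 2≤S conn P = begin
      fragCost G S (A , B)
        ≈⟨ /-cong (*ᴷ-congˡ (cutWeight≈ A B)) (inducedWeight≈ S) ⟩
      (fromNat (∣ S ∣ ∸ 1) *ᴷ fromNat (cutCount A B)) / fromNat (edgeCount S)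
        ≡⟨ cong₂ (λ k c → (fromNat (k ∸ 1) *ᴷ fromNat c) / fromNat (edgeCount S)) size cut ⟩
      (fromNat (edgeCount S) *ᴷ fromNat 1) / fromNat (edgeCount S)
        ≈⟨ *ᴷ-congʳ (≈-trans (*ᴷ-congˡ fromNat-1) (*ᴷ-identityʳ _)) ⟩
      fromNat (edgeCount S) / fromNat (edgeCount S)
        ≈⟨ ⁻¹-inverseʳ (proj₂ (fromNat-positive (ℕ.s≤s⁻¹ (subst (2 ≤_) size 2≤S)))) ⟩
      1# ∎
      where
      open ≈-Reasoning
      open IsBalancedBipartition P
      size : ∣ S ∣ ≡ ℕ.suc (edgeCount S)
      size = connected⇒size (proj₁ A-nonempty , subst (_ ∈_) covers (Subset.x∈p∪q⁺ (inj₁ (proj₂ A-nonempty)))) conn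
      cut : cutCount A B ≡ 1
      cut = cutCount≡1 covers disjoint A-nonempty B-nonempty A-conn B-conn conn

    split⇒frag≤1 : ∀ {S A B} → 2 ≤ ∣ S ∣ → ConnectedOn tree S → IsBalancedBipartition G (1# / fromNat 3) S A B →
                   ∃ λ v → IsFrag G (1# / fromNat 3) S v × _≤⁺_ _≤ᴷ_ v [ 1# ]
    split⇒frag≤1 {S} {A} {B} 2≤S conn P =
      [ 1# ] , (((A , B) , P , fragCost≈1 2≤S conn P) , λ _ Q → ≤ᴷ-reflexive (≈-sym (fragCost≈1 2≤S conn Q))) , [ ≤ᴷ-refl ]

    balanced⇒IsBalanced : ∀ {S A B} (childCount≤2 : ∀ v → RootedTree.childCount par par≤ v ≤ 2) →
                          BalancedSplit.BalancedSplit par par≤ childCount≤2 S A B → IsBalancedBipartition G (1# / fromNat 3) S A B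
    balanced⇒IsBalanced {S} {A} {B} _ split = record
      { covers = covers ; disjoint = disjoint ; A-nonempty = A-nonempty ; B-nonempty = B-nonempty
      ; A-conn = A-conn ; B-conn = B-conn ; balanced = two-thirds ((∣ A ∣ ∸ 1) ⊔ (∣ B ∣ ∸ 1)) (∣ S ∣ ∸ 1) balanced }
      where open BalancedSplit.BalancedSplit split

    frag≤1 : (∀ v → RootedTree.childCount par par≤ v ≤ 2) → ∀ S → 2 ≤ ∣ S ∣ → ConnectedOn tree S →
             ∃ λ v → IsFrag G (1# / fromNat 3) S v × _≤⁺_ _≤ᴷ_ v [ 1# ]
    frag≤1 childCount≤2 S 2≤S conn =
      let _ , _ , split = BalancedSplit.balancedSplit par par≤ childCount≤2 (sym (ℕ.m+[n∸m]≡n 2≤S)) conn in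
      split⇒frag≤1 2≤S conn (balanced⇒IsBalanced childCount≤2 split)

    fromNat-isUltrametric : ∀ {u} → IsNatUltrametric u → IsUltrametric G (λ x y → fromNat (u x y))
    fromNat-isUltrametric {u} U = record
      { isSemiMetric = record
        { isQuasiSemiMetric = record
          { isPreMetric = record
            { isProtoMetric = record
              { isPartialOrder  = DecTotalOrder.isPartialOrder (OrderedField.decTotalOrder K)
              ; ≈-isEquivalence = isEquivalence
              ; cong            = λ { refl refl → ≈-refl }
              ; nonNegative     = λ {x} {y} → 0≤fromNat (u x y)
              }
            ; ≈⇒0 = λ { {x} refl → ≈-reflexive (cong fromNat (diagonal x)) }
            }
          ; 0⇒≈ = λ {x} {y} eq → definite x y (ℕ.n≤0⇒n≡0 (fromNat-reflects-≤ (u x y) 0 (≤ᴷ-reflexive eq)))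
          }
        ; sym = λ x y → ≈-reflexive (cong fromNat (symm x y))
        }
      ; triangle = λ x y z → ≤ᴷ-trans (fromNat-mono (ultra x y z)) (fromNat-⊔ (u x y) (u y z))
      }
      where open IsNatUltrametric U

    module _ {v} (b : ℕ) (dist≤b : ∀ x y → dist x y ≤ b) (U : IsUltrametric G v) (dom : DominatesDistance G v) where
      private module U = Metric.IsGeneralMetric U

      dist≤floor : ∀ x y → dist x y ≤ floor b (v x y)
      dist≤floor x y = floor-greatest (dist≤b x y) (dominates⁻ dom x y)

      floor-isNatUltrametric : IsNatUltrametric (λ x y → floor b (v x y))
      floor-isNatUltrametric = record
        { diagonal = λ x → ℕ.n≤0⇒n≡0 (fromNat-reflects-≤ (floor b (v x x)) 0 (≤ᴷ-trans (floor≤ b U.nonNegative) (≤ᴷ-reflexive (U.≈⇒0 refl))))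
        ; definite = λ x y eq → dist≡0⇒≡ (ℕ.n≤0⇒n≡0 (subst (dist x y ≤_) eq (dist≤floor x y)))
        ; symm     = λ x y → ℕ.≤-antisym (floor-mono b U.nonNegative (≤ᴷ-reflexive (U.sym x y)))
                                         (floor-mono b U.nonNegative (≤ᴷ-reflexive (U.sym y x)))
        ; ultra    = λ x y z → ℕ.≤-trans (floor-mono b U.nonNegative (U.triangle x y z)) (floor-⊔ b U.nonNegative U.nonNegative)
        }

      floor-cost≤ : fromNat (edgeSum (λ x y → floor b (v x y))) ≤ᴷ cost G v
      floor-cost≤ = ≤ᴷ-trans (≤ᴷ-reflexive (≈-sym (cost-fromNat (λ x y → floor b (v x y)))))
                             (cost-mono λ x y → floor≤ b (U.nonNegative {x} {y}))

    -- Rounding down an ultrametric to the integers preserves the ultrametric inequality and domination, as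
    -- distances are integers; hence the optimum is attained by one of finitely many integral ultrametrics.
    free-optimum : ∀ b u → (∀ x y → u x y ≤ b) → IsNatUltrametric u → dist ≤₂ u →
                   ∃ λ k → IsOPTfree G (fromNat k) × m ≤ k × k ≤ edgeSum u
    free-optimum b u u≤b U d≤u
      with optimal-ultrametric dist b edgeSum (λ eq → sum-cong-≗ λ i → eq (par i) (suc i)) (u , u≤b , U , d≤u)
    ... | v , V , d≤v , min =
      edgeSum v ,
      (((λ x y → fromNat (v x y)) , (fromNat-isUltrametric V , dominates⁺ λ x y → fromNat-mono (d≤v x y)) , cost-fromNat v) ,
        λ w (W , dom) → ≤ᴷ-trans (fromNat-mono (min (λ x y → floor b (w x y)) (λ x y → floor≤b b (w x y))
                                                 (floor-isNatUltrametric b dist≤b W dom) (dist≤floor b dist≤b W dom)))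
                       (floor-cost≤ b dist≤b W dom)) ,
      ℕ.≤-trans (ℕ.≤-reflexive (sym (trans (sum-const m 1) (ℕ.*-identityʳ m)))) (sum-mono-≤ positive) ,
      min u u≤b U d≤u
      where
      dist≤b : ∀ x y → dist x y ≤ b
      dist≤b x y = ℕ.≤-trans (d≤u x y) (u≤b x y)
      positive : ∀ i → 1 ≤ v (par i) (suc i)
      positive i = ℕ.n≢0⇒n>0 λ eq → ℕ.<-irrefl (cong toℕ (IsNatUltrametric.definite V (par i) (suc i) eq)) (s≤s (par≤ i))

    card-optimum : ∀ H → dist ≤₂ height H →
                   ∃ λ k → IsOPTcard G (fromNat k) × (∃ λ H′ → k ≡ edgeSum (height H′)) × k ≤ edgeSum (height H)
    card-optimum H d≤H with optimal-hierarchy dist (edgeSum ∘ treeHeight) (H , d≤H)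
    ... | O , d≤O , min =
      edgeSum (height O) ,
      ((O , dominates⁺ (λ x y → fromNat-mono (d≤O x y)) , cost-fromNat (height O)) ,
       λ H′ dom → ≤ᴷ-trans (fromNat-mono (min H′ λ x y → fromNat-reflects-≤ (dist x y) (height H′ x y) (dominates⁻ dom x y)))
                           (≤ᴷ-reflexive (≈-sym (cost-fromNat (height H′))))) ,
      (O , refl) , min H d≤H

    edgeSum-height : ∀ H → edgeSum (height H) ≡ HierarchyBound.treeCost par par≤ (Hierarchy.tree H)
    edgeSum-height H = sum-cong-≗ λ i → cong (λ b → if b then 0 else lcaSize (par i) (suc i) (Hierarchy.tree H) ∸ 1)
      (dec-false (par i Fin.≟ suc i) λ eq → ℕ.<-irrefl (cong toℕ eq) (s≤s (par≤ i)))

  module Asymptotics where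
    open CompleteBinaryTree using (#edges; #vertices; 2+#edges)

    2^-reflects-≤ : ∀ {p k} → 2 ^ p ≤ 2 ^ k → p ≤ k
    2^-reflects-≤ {p} {k} le = ℕ.≮⇒≥ λ k<p → ℕ.<⇒≱ (ℕ.^-monoʳ-< 2 (s≤s (s≤s z≤n)) k<p) le

    #vertices≤2^ : ∀ h → #vertices h ≤ 2 ^ ℕ.suc h
    #vertices≤2^ h = subst (#vertices h ≤_) (2+#edges h) (ℕ.n≤1+n _)

    2^≤#vertices : ∀ h → 2 ^ h ≤ #vertices h
    2^≤#vertices h = ℕ.+-cancelˡ-≤ 1 _ _ (begin
      1 + 2 ^ h       ≤⟨ ℕ.+-monoˡ-≤ (2 ^ h) (ℕ.m^n>0 2 h) ⟩
      2 ^ h + 2 ^ h   ≡⟨ cong (2 ^ h +_) (ℕ.+-identityʳ (2 ^ h)) ⟨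
      2 * 2 ^ h       ≡⟨ 2+#edges h ⟨
      2 + #edges h    ∎)
      where open ℕ.≤-Reasoning

    2^≤#edges : ∀ {h} → 1 ≤ h → 2 ^ h ≤ #edges h
    2^≤#edges {h} 1≤h = ℕ.+-cancelˡ-≤ 2 _ _ (begin
      2 + 2 ^ h       ≤⟨ ℕ.+-monoˡ-≤ (2 ^ h) (ℕ.^-monoʳ-≤ 2 1≤h) ⟩
      2 ^ h + 2 ^ h   ≡⟨ cong (2 ^ h +_) (ℕ.+-identityʳ (2 ^ h)) ⟨
      2 * 2 ^ h       ≡⟨ 2+#edges h ⟨
      2 + #edges h    ∎)
      where open ℕ.≤-Reasoning

    log-upper : ∀ {h p q} → 2 ^ p ≤ #vertices h ^ q → p ≤ ℕ.suc h * q
    log-upper {h} {p} {q} le = 2^-reflects-≤ (begin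
      2 ^ p               ≤⟨ le ⟩
      #vertices h ^ q     ≤⟨ ℕ.^-monoˡ-≤ q (#vertices≤2^ h) ⟩
      (2 ^ ℕ.suc h) ^ q   ≡⟨ ℕ.^-*-assoc 2 (ℕ.suc h) q ⟩
      2 ^ (ℕ.suc h * q)   ∎)
      where open ℕ.≤-Reasoning

    log-lower : ∀ {h p q} → #vertices h ^ q ≤ 2 ^ p → h * q ≤ p
    log-lower {h} {p} {q} le = 2^-reflects-≤ (begin
      2 ^ (h * q)         ≡⟨ ℕ.^-*-assoc 2 h q ⟨
      (2 ^ h) ^ q         ≤⟨ ℕ.^-monoˡ-≤ q (2^≤#vertices h) ⟩
      #vertices h ^ q     ≤⟨ le ⟩
      2 ^ p               ∎)
      where open ℕ.≤-Reasoning

    h+e≤1+h*e : ∀ {h e} → 1 ≤ h → 1 ≤ e → h + e ≤ 1 + h * e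
    h+e≤1+h*e {ℕ.suc g} {ℕ.suc f} _ _ = begin
      ℕ.suc g + ℕ.suc f               ≤⟨ ℕ.m≤n+m _ (g * f) ⟩
      g * f + (ℕ.suc g + ℕ.suc f)
        ≡⟨ ℕS.solve 2 (λ g f → g :* f :+ (con 1 :+ g :+ (con 1 :+ f)) := con 1 :+ (con 1 :+ g) :* (con 1 :+ f)) refl g f ⟩
      1 + ℕ.suc g * ℕ.suc f           ∎
      where
      open ℕ.≤-Reasoning
      open ℕS

    card-lower : ∀ {h k} → 1 ≤ h → ℕ.suc h * #vertices h ≤ #edges h + k + 2 ^ h → h * 2 ^ h ≤ k
    card-lower {h} {k} 1≤h le = ℕ.+-cancelˡ-≤ (E + e + (1 + h * e)) _ _ (begin
      E + e + (1 + h * e) + h * e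
        ≡⟨ solve 3 (λ E e s → E :+ e :+ (con 1 :+ s) :+ s := e :+ (con 1 :+ E :+ con 2 :* s)) refl E e (h * e) ⟩
      e + (1 + E + 2 * (h * e))
        ≡⟨ cong (λ s → e + (1 + E + s)) (solve 2 (λ h e → con 2 :* (h :* e) := h :* (con 2 :* e)) refl h e) ⟩
      e + (1 + E + h * (2 * e))         ≡⟨ cong (λ s → e + (1 + E + h * s)) (2+#edges h) ⟨
      e + (1 + E + h * (2 + E))
        ≡⟨ solve 3 (λ E e h → e :+ (con 1 :+ E :+ h :* (con 2 :+ E)) := h :+ e :+ (con 1 :+ h) :* (con 1 :+ E)) refl E e h ⟩
      h + e + ℕ.suc h * ℕ.suc E         ≤⟨ ℕ.+-mono-≤ (h+e≤1+h*e 1≤h (ℕ.m^n>0 2 h)) le ⟩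
      1 + h * e + (E + k + e)
        ≡⟨ solve 4 (λ E e s k → con 1 :+ s :+ (E :+ k :+ e) := E :+ e :+ (con 1 :+ s) :+ k) refl E e (h * e) k ⟩
      E + e + (1 + h * e) + k           ∎)
      where
      open ℕ.≤-Reasoning
      open ℕS
      E = #edges h
      e = 2 ^ h

    ratio-lower : ∀ {h k l p q} → 1 ≤ h → h * 2 ^ h ≤ k → l ≤ 8 * 2 ^ h → 2 ^ p ≤ #vertices h ^ q →
                  (1 * p) * l ≤ k * (16 * q)
    ratio-lower {h} {k} {l} {p} {q} 1≤h he≤k l≤8e le = begin
      (1 * p) * l
        ≤⟨ ℕ.*-mono-≤ (ℕ.≤-trans (ℕ.≤-reflexive (ℕ.*-identityˡ p)) (log-upper {h} {p} {q} le)) l≤8e ⟩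
      (ℕ.suc h * q) * (8 * 2 ^ h)       ≤⟨ ℕ.*-monoˡ-≤ (8 * 2 ^ h) (ℕ.*-monoˡ-≤ q (ℕ.+-monoˡ-≤ h 1≤h)) ⟩
      ((h + h) * q) * (8 * 2 ^ h)
        ≡⟨ solve 3 (λ h q e → ((h :+ h) :* q) :* (con 8 :* e) := (h :* e) :* (con 16 :* q)) refl h q (2 ^ h) ⟩
      (h * 2 ^ h) * (16 * q)            ≤⟨ ℕ.*-monoˡ-≤ (16 * q) he≤k ⟩
      k * (16 * q)                      ∎
      where
      open ℕ.≤-Reasoning
      open ℕS

    ratio-upper : ∀ {h k l p q} → 1 ≤ h → k ≤ 3 * (h * 2 ^ h) → #edges h ≤ l → #vertices h ^ q ≤ 2 ^ p →
                  k * (1 * q) ≤ (3 * p) * l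
    ratio-upper {h} {k} {l} {p} {q} 1≤h k≤ E≤l le = begin
      k * (1 * q)                       ≤⟨ ℕ.*-monoˡ-≤ (1 * q) k≤ ⟩
      3 * (h * 2 ^ h) * (1 * q)
        ≡⟨ solve 3 (λ h q e → con 3 :* (h :* e) :* (con 1 :* q) := (con 3 :* (h :* q)) :* e) refl h q (2 ^ h) ⟩
      (3 * (h * q)) * 2 ^ h             ≤⟨ ℕ.*-mono-≤ (ℕ.*-monoʳ-≤ 3 (log-lower {h} {p} {q} le)) (ℕ.≤-trans (2^≤#edges 1≤h) E≤l) ⟩
      (3 * p) * l                       ∎
      where
      open ℕ.≤-Reasoning
      open ℕS

  module _ {a ℓ₁ ℓ₂} (K : OrderedField a ℓ₁ ℓ₂) where
    open OrderedFieldProperties K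
    open OrderedField K using (_·log₂_≼_; _≼_·log₂_)
    open Weighted K
    open CompleteBinaryTree
      using (#edges; #vertices; parent; parent≤; 2+#edges; childCount≤2; maxDegree≤3; maxDegree≡3;
             υ; υ≤2h; υ-isNatUltrametric; υ-cost; dist≤δ; δ≤υ)
    open CompleteHierarchy using (hierarchy; δ≤height; cost≤)
    open Asymptotics
    private module T h = WeightedTree K (parent h) (parent≤ h)

    Separates : Carrier → Carrier → ∀ h {n} → WeightedGraph n → Set _
    Separates c C h {n} B =
      (IsTree (WeightedGraph.graph B) ×
       Unweighted B ×
       maxDegree (WeightedGraph.graph B) ≤ 3 ×
       (2 ≤ h → maxDegree (WeightedGraph.graph B) ≡ 3)) ×
      (∃₂ λ card free → IsOPTcard B card × IsOPTfree B free × (c ·log₂ n ≼ card / free) × (card / free ≼ C ·log₂ n)) ×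
      ((S : Subset n) → 2 ≤ ∣ S ∣ → ConnectedOn (WeightedGraph.graph B) S →
       ∃ λ v → IsFrag B (1# / fromNat 3) S v × _≤⁺_ _≤ᴷ_ v [ 1# ])

    lower upper : Carrier
    lower = fromNat 1 / fromNat 16
    upper = fromNat 3 / fromNat 1

    free-bounds : ∀ h → ∃ λ l → IsOPTfree (T.G h) (fromNat l) × #edges h ≤ l × l ≤ 8 * 2 ^ h
    free-bounds h =
      let l , opt , E≤l , l≤ = T.free-optimum h (2 * h) (υ h) (υ≤2h h) (υ-isNatUltrametric h) (λ x y → ℕ.≤-trans (dist≤δ h x y) (δ≤υ h x y)) in
      l , opt , E≤l , ℕ.≤-trans l≤ (subst (T.edgeSum h (υ h) ≤_) (υ-cost h) (ℕ.m≤m+n _ (4 * h + 8)))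

    card-bounds : ∀ h → 1 ≤ h → ∃ λ k → IsOPTcard (T.G h) (fromNat k) × h * 2 ^ h ≤ k × k ≤ 3 * (h * 2 ^ h)
    card-bounds h 1≤h =
      let k , opt , (H , k≡) , k≤ = T.card-optimum h (hierarchy h) (λ x y → ℕ.≤-trans (dist≤δ h x y) (δ≤height h x y)) in
      k , opt ,
      card-lower 1≤h (subst (λ k → ℕ.suc h * #vertices h ≤ #edges h + k + 2 ^ h) (sym (trans k≡ (T.edgeSum-height h H)))
                            (HierarchyBound.treeCost-bound (parent h) (parent≤ h) H h)) ,
      ℕ.≤-trans k≤ (ℕ.≤-trans (ℕ.≤-reflexive (T.edgeSum-height h (hierarchy h))) (cost≤ h))

    module _ {h k l : ℕ} (1≤h : 1 ≤ h) (E≤l : #edges h ≤ l) where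

      0<l : 0 < l
      0<l = ℕ.≤-trans (ℕ.≤-trans (ℕ.m^n>0 2 h) (2^≤#edges 1≤h)) E≤l

      lower-ratio : h * 2 ^ h ≤ k → l ≤ 8 * 2 ^ h → lower ·log₂ #vertices h ≼ fromNat k / fromNat l
      lower-ratio he≤k l≤ p q 0<q le = ≤ᴷ-trans
        (≤ᴷ-reflexive (fraction-* {1} {16} {p} {q} (s≤s z≤n) 0<q))
        (fraction-mono {1 * p} {16 * q} {k} {l} (ℕ.*-mono-≤ {1} {16} (s≤s z≤n) 0<q) 0<l
          (ratio-lower {h} {k} {l} {p} {q} 1≤h he≤k l≤ le))

      upper-ratio : k ≤ 3 * (h * 2 ^ h) → fromNat k / fromNat l ≼ upper ·log₂ #vertices h
      upper-ratio k≤ p q 0<q le = ≤ᴷ-trans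
        (fraction-mono {k} {l} {3 * p} {1 * q} 0<l (ℕ.*-mono-≤ {1} {1} (s≤s z≤n) 0<q)
          (ratio-upper {h} {k} {l} {p} {q} 1≤h k≤ E≤l le))
        (≤ᴷ-reflexive (≈-sym (fraction-* {3} {1} {p} {q} (s≤s z≤n) 0<q)))

    separation : ∀ h → 1 ≤ h → Separates lower upper h (T.G h)
    separation h 1≤h =
      let k , card , he≤k , k≤ = card-bounds h 1≤h
          l , free , E≤l , l≤ = free-bounds h
      in
      (RootedTree.isTree (parent h) (parent≤ h) , (λ _ _ _ → ≈-refl) , maxDegree≤3 h , maxDegree≡3 h) ,
      (fromNat k , fromNat l , card , free , lower-ratio {h} {k} {l} 1≤h E≤l he≤k l≤ , upper-ratio {h} {k} {l} 1≤h E≤l k≤) ,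
      T.frag≤1 h (childCount≤2 h)

    #vertices≡ : ∀ h → #vertices h ≡ 2 ^ (h + 1) ∸ 1
    #vertices≡ h = cong (_∸ 1) (trans (2+#edges h) (cong (2 ^_) (ℕ.+-comm 1 h)))

    family : ∀ h → Σ (WeightedGraph (2 ^ (h + 1) ∸ 1)) λ B → 1 ≤ h → Separates lower upper h B
    family h = subst (λ n → Σ (WeightedGraph n) λ B → 1 ≤ h → Separates lower upper h B) (#vertices≡ h) (T.G h , separation h)

    constants : 0# <ᴷ lower × lower ≤ᴷ upper
    constants = 0</ (fromNat-positive {1} (s≤s z≤n)) (fromNat-positive {16} (s≤s z≤n)) ,
                fraction-mono {1} {16} {3} {1} (s≤s z≤n) (s≤s z≤n) (s≤s z≤n)

open Separation using (family; lower; upper; constants)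

theorem14 : ∀ {a ℓ₁ ℓ₂} (K : OrderedField a ℓ₁ ℓ₂) →
    let open OrderedField K
        open Weighted K
        n = λ (h : ℕ) → 2 ℕ.^ (h ℕ.+ 1) ℕ.∸ 1
    in
    Σ (∀ h → WeightedGraph (n h)) λ B →
      (∀ h → 1 ℕ.≤ h →
        IsTree (WeightedGraph.graph (B h)) ×
        Unweighted (B h) ×
        maxDegree (WeightedGraph.graph (B h)) ℕ.≤ 3 ×
        (2 ℕ.≤ h → maxDegree (WeightedGraph.graph (B h)) ≡ 3)) ×
      (∃₂ λ c C → 0# < c × c ≤ C ×
        (∀ h → 1 ℕ.≤ h →
          ∃₂ λ card free → IsOPTcard (B h) card × IsOPTfree (B h) free ×
            (c ·log₂ n h ≼ card / free) ×
            (card / free ≼ C ·log₂ n h))) ×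
      (∀ h → 1 ℕ.≤ h → (S : Subset (n h)) → 2 ℕ.≤ ∣ S ∣ →
        ConnectedOn (WeightedGraph.graph (B h)) S →
        ∃ λ v → IsFrag (B h) (1# / fromNat 3) S v × _≤⁺_ _≤_ v [ 1# ])
theorem14 K =
  (λ h → proj₁ (family K h)) ,
  (λ h 1≤h → proj₁ (proj₂ (family K h) 1≤h)) ,
  (lower K , upper K , proj₁ (constants K) , proj₂ (constants K) ,
   λ h 1≤h → proj₁ (proj₂ (proj₂ (family K h) 1≤h))) ,
  (λ h 1≤h → proj₂ (proj₂ (proj₂ (family K h) 1≤h)))
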